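{- If a tournament $H$ is regular, then it satisfies the Erdős–Hajnal Conjecture: there exists $\epsilon(H)>0$ such that every tournament $T$ not containing $H$ as a subtournament contains a transitive subtournament on at least $|T|^{\epsilon(H)}$ vertices.
   Context: Tournaments are finite; subtournament = induced subtournament; transitive = no directed cycle; $tr(T)$ = maximum size of a transitive subtournament of $T$. $V_1$ is complete to $V_2$ if every vertex of $V_1$ has an edge to every vertex of $V_2$. For disjoint nonempty $X,Y$, $d(X,Y)=e_{X,Y}/(|X||Y|)$, $e_{X,Y}$ = number of edges $(x,y)$ with $x\in X,y\in Y$. For a $\{0,1\}$-vector $v$ of length $m$, $\zeta^v(i)=|\{j\le i:v(j)=1\}|$; $\eta$ is a vector of positive integers of length $\zeta^v(m)$; $k=|\{j:v(j)=0\}|+\sum_i\eta(i)$. For a tournament $T$, $c>0$, $0\le\lambda<1$, a $(v,\eta,c,\lambda)$-m-sequence in $T$ is a sequence $\chi=(S_1,\dots,S_m)$ of pairwise disjoint subsets of $V(T)$ such that: if $v(i)=1$, $S_i$ induces a transitive subtournament partitioned into $S_{i,1},\dots,S_{i,\eta(\zeta^v(i))}$ with $S_{i,a}$ complete to $S_{i,b}$ for $a<b$ and $|S_{i,a}|\ge c\,tr(T)$; if $v(i)=0$, $|S_i|\ge c|T|$; $d(S_i,S_j)\ge1-\lambda$ for $i<j$. Its long representation $l(\chi)=(T_1,\dots,T_k)$ replaces each $S_i$ with $v(i)=1$ by $S_{i,1},\dots,S_{i,\eta(\zeta^v(i))}$ in order; $V(\chi)=\bigcup S_i$. A $c'$-strong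 pair in $\chi$ is a pair $(A,B)$ of disjoint subsets of $V(\chi)$ with $|A|\ge c'|T|$, either $|B|\ge c'|T|$ or ($B$ transitive and $|B|\ge c'\,tr(T)$), and $d(A,B)=1$ or $d(B,A)=1$. For $\mathcal{H}=\{H_1,\dots,H_t\}$, $V(H_i)=\{h^i_1,\dots\}$, and $\mathcal{F}=\{f_1,\dots,f_t\}$ with $f_i:V(H_i)\to\{1,\dots,k\}$ injective, $\mathcal{H}$ has the $(\mathcal{F},v,\eta)$-strong EH-property if for every $c_1>0$ there exist $\lambda_0>0,c_2>0$ such that for every tournament $T$, $0\le\lambda\le\lambda_0$ and $(v,\eta,c_1,\lambda)$-m-sequence $\chi$ in $T$ with $l(\chi)=(T_1,\dots,T_k)$, either there are $i$ and $x_j\in T_{f_i(h^i_j)}$ with $x_j\mapsto h^i_j$ an isomorphism from the subtournament induced on $\{x_j\}$ onto $H_i$, or $\chi$ contains a $c_2$-strong pair. Products: an edge $(x,y)$ is backward under an ordering if $y$ precedes $x$. For tournaments $H_1,H_2$ with disjoint vertex sets and injective $f_1:V(H_1)\to\mathbb{N}$, $f_2:V(H_2)\to\mathbb{N}$ with $f_1(x)\ne f_2(y)$ for all $x,y$ ($\langle f_1,f_2\rangle=0$), let $\theta_i$ order $V(H_i)$ by increasing $f_i$ and $\theta$ order $V(H_1)\cup V(H_2)$ by increasing value of $f_1$ on $V(H_1)$ and $f_2$ on $V(H_2)$. $H_1^{f_1}\oplus H_2^{f_2}$ is the tournament on $V(H_1)\cup V(H_2)$ whose backward edges under $\theta$ are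 exactly those of $H_1$ under $\theta_1$ and those of $H_2$ under $\theta_2$. For $\mathcal{F}=\{f_1,\dots,f_r\}$, $\mathcal{G}=\{g_1,\dots,g_s\}$ with $\langle f,g\rangle=0$ for all $f\in\mathcal{F},g\in\mathcal{G}$, $\mathcal{H}_1^{\mathcal{F}}\oplus\mathcal{H}_2^{\mathcal{G}}=\{H_{1,i}^{f_i}\oplus H_{2,j}^{g_j}\}$; if one of the two families is empty, the product is taken to be the other family. A tournament $H$ is regular if there exist vectors $v,\eta$, a family $\mathcal{H}_1$ with the $(\mathcal{F},v,\eta)$-strong EH-property and a family $\mathcal{H}_2$ with the $(\mathcal{G},v,\eta)$-strong EH-property (one of $\mathcal{H}_1,\mathcal{H}_2$ may be empty; vertex sets of members of $\mathcal{H}_1$ disjoint from those of $\mathcal{H}_2$; $\langle f,g\rangle=0$ for all $f\in\mathcal{F},g\in\mathcal{G}$) such that $\mathcal{H}_1^{\mathcal{F}}\oplus\mathcal{H}_2^{\mathcal{G}}$ is a nonempty family each member of which contains $H$ as a subtournament. -}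

module Defs where

open import Data.Bool using (Bool; true; false; not; _∧_; if_then_else_)
open import Data.Nat as ℕ using (ℕ; zero; suc; _+_; _<ᵇ_)
open import Data.Integer using (+_)
open import Data.Rational using (ℚ; _/_; _*_; _-_; _≤_; _<_; 0ℚ; 1ℚ)
open import Data.Fin using (Fin; toℕ; splitAt)
open import Data.Fin.Subset using (Subset; _∈_; _⊆_; _∩_; ∣_∣; ⋃; Nonempty; Empty)
open import Data.Vec using (lookup)
open import Data.List using (List; []; _∷_; _++_; length; map; concatMap; allFin)
open import Data.Nat.ListAction using (sum)
open import Data.List.Relation.Unary.All using (All)
open import Data.List.Relation.Unary.Any using (Any)
open import Data.List.Relation.Unary.AllPairs using (AllPairs)
open import Data.List.Relation.Unary.Linked using (Linked)
open import Data.List.Membership.Propositional using () renaming (_∈_ to _∈ₗ_)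
open import Data.Product using (Σ; ∃; ∃-syntax; _×_; _,_)
open import Data.Sum using (_⊎_; inj₁; inj₂)
open import Data.Unit using (⊤)
open import Data.Empty using (⊥)
open import Relation.Binary.PropositionalEquality using (_≡_; _≢_)
open import Function.Definitions using (Injective)

ℕ→ℚ : ℕ → ℚ
ℕ→ℚ n = + n / 1

record Tournament : Set where
  field
    size   : ℕ
    adj    : Fin size → Fin size → Bool
    irrefl : ∀ x → adj x x ≡ false
    tour   : ∀ x y → x ≢ y → adj x y ≡ not (adj y x)
open Tournament public

record Digraph : Set where
  field
    dsize : ℕ
    dadj  : Fin dsize → Fin dsize → Bool
open Digraph public

Contains : ∀ {n m} → (Fin n → Fin n → Bool) → (Fin m → Fin m → Bool) → Set
Contains {n} {m} adjT adjH =
  ∃[ φ ] (Injective _≡_ _≡_ φ × (∀ a b → adjT (φ a) (φ b) ≡ adjH a b))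

module _ (T : Tournament) where

  Arc : Fin (size T) → Fin (size T) → Set
  Arc x y = adj T x y ≡ true

  HasCycle : Subset (size T) → Set
  HasCycle S = ∃[ x ] ∃[ xs ] (All (_∈ S) (x ∷ xs) × Linked Arc (x ∷ xs ++ x ∷ []))

  Transitive : Subset (size T) → Set
  Transitive S = HasCycle S → ⊥

  -- c · tr(T) ≤ |A|  (tr(T) = max size of a transitive subset)
  AtLeastTr : ℚ → Subset (size T) → Set
  AtLeastTr c A = ∀ S → Transitive S → c * ℕ→ℚ ∣ S ∣ ≤ ℕ→ℚ ∣ A ∣

  AtLeastV : ℚ → Subset (size T) → Set
  AtLeastV c A = c * ℕ→ℚ (size T) ≤ ℕ→ℚ ∣ A ∣

  CompleteTo : Subset (size T) → Subset (size T) → Set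
  CompleteTo A B = ∀ x y → x ∈ A → y ∈ B → Arc x y

  edges : Subset (size T) → Subset (size T) → ℕ
  edges X Y = sum (map (λ x → sum (map (λ y →
                 if lookup X x ∧ lookup Y y ∧ adj T x y then 1 else 0)
                 (allFin (size T)))) (allFin (size T)))

  -- d(X,Y) ≥ 1 - λ, i.e. e_{X,Y} ≥ (1 - λ)|X||Y|
  DensityAtLeast : ℚ → Subset (size T) → Subset (size T) → Set
  DensityAtLeast μ X Y = μ * ℕ→ℚ (∣ X ∣ ℕ.* ∣ Y ∣) ≤ ℕ→ℚ (edges X Y)

  DensityOne : Subset (size T) → Subset (size T) → Set
  DensityOne X Y = edges X Y ≡ ∣ X ∣ ℕ.* ∣ Y ∣

  Disjoint : Subset (size T) → Subset (size T) → Set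
  Disjoint A B = Empty (A ∩ B)

count : Bool → List Bool → ℕ
count b [] = 0
count true  (true  ∷ v) = suc (count true v)
count true  (false ∷ v) = count true v
count false (true  ∷ v) = count false v
count false (false ∷ v) = suc (count false v)

ValidVη : List Bool → List ℕ → Set
ValidVη v η = (length η ≡ count true v) × All (λ r → 1 ℕ.≤ r) η

kOf : List Bool → List ℕ → ℕ
kOf v η = count false v + sum η

-- m-sequences.  An entry S_i with v(i)=0 is (dense S_i); an entry with
-- v(i)=1 is (trans [S_{i,1}, …, S_{i,η}]) and S_i is their union.

data Block (n : ℕ) : Set where
  dense : Subset n → Block n
  trans : List (Subset n) → Block n

blockSet : ∀ {n} → Block n → Subset n
blockSet (dense S) = S
blockSet (trans ps) = ⋃ ps

blockLong : ∀ {n} → Block n → List (Subset n)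
blockLong (dense S) = S ∷ []
blockLong (trans ps) = ps

long : ∀ {n} → List (Block n) → List (Subset n)
long = concatMap blockLong

Vχ : ∀ {n} → List (Block n) → Subset n
Vχ bs = ⋃ (map blockSet bs)

Shape : ∀ {n} → List Bool → List ℕ → List (Block n) → Set
Shape [] [] [] = ⊤
Shape (false ∷ v) η (dense _ ∷ bs) = Shape v η bs
Shape (true ∷ v) (r ∷ η) (trans ps ∷ bs) = (length ps ≡ r) × Shape v η bs
Shape _ _ _ = ⊥

module _ (T : Tournament) (c : ℚ) where

  BlockOK : Block (size T) → Set
  BlockOK (dense S) = AtLeastV T c S
  BlockOK (trans ps) =
    Transitive T (⋃ ps) × AllPairs (CompleteTo T) ps × All (AtLeastTr T c) ps

-- (v,η,c,λ)-m-sequence in T.  Sets are required nonempty (d is only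
-- defined for nonempty sets); the S_{i,a} are pairwise disjoint, which
-- together with disjointness of the S_i is the partition condition.
MSeq : (T : Tournament) → List Bool → List ℕ → ℚ → ℚ → List (Block (size T)) → Set
MSeq T v η c lam bs =
  Shape v η bs
  × All Nonempty (long bs)
  × AllPairs (Disjoint T) (long bs)
  × All (BlockOK T c) bs
  × AllPairs (λ B₁ B₂ → DensityAtLeast T (1ℚ - lam) (blockSet B₁) (blockSet B₂)) bs

StrongPair : (T : Tournament) → ℚ → List (Block (size T)) → Set
StrongPair T c' bs = ∃[ A ] ∃[ B ]
  ( A ⊆ Vχ bs × B ⊆ Vχ bs × Disjoint T A B × Nonempty A × Nonempty B
  × AtLeastV T c' A
  × (AtLeastV T c' B ⊎ (Transitive T B × AtLeastTr T c' B))
  × (DensityOne T A B ⊎ DensityOne T B A))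

record Member (k : ℕ) : Set where
  field
    H   : Tournament
    f   : Fin (size H) → Fin k
    inj : Injective _≡_ _≡_ f
open Member public

nth : ∀ {A : Set} → List A → ℕ → A → Set
nth [] _ _ = ⊥
nth (x ∷ xs) zero a = x ≡ a
nth (x ∷ xs) (suc i) a = nth xs i a

InLong : ∀ {n k} → List (Block n) → Fin k → Fin n → Set
InLong bs t x = ∃[ S ] (nth (long bs) (toℕ t) S × x ∈ S)

CopyIn : ∀ {k} (T : Tournament) → List (Member k) → List (Block (size T)) → Set
CopyIn T F bs = Any (λ M → Σ (Fin (size (H M)) → Fin (size T)) λ x →
  ( (∀ j → InLong bs (f M j) (x j))
  × (∀ a b → adj T (x a) (x b) ≡ adj (H M) a b))) F

StrongEH : (v : List Bool) (η : List ℕ) → List (Member (kOf v η)) → Set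
StrongEH v η F =
  ∀ (c₁ : ℚ) → 0ℚ < c₁ →
  ∃[ λ₀ ] ∃[ c₂ ] (0ℚ < λ₀ × 0ℚ < c₂ ×
    ∀ (T : Tournament) (λ' : ℚ) → 0ℚ ≤ λ' → λ' ≤ λ₀ → λ' < 1ℚ →
    ∀ (bs : List (Block (size T))) → MSeq T v η c₁ λ' bs →
    CopyIn T F bs ⊎ StrongPair T c₂ bs)

prodAdj⊎ : ∀ {k} (M₁ M₂ : Member k) →
  Fin (size (H M₁)) ⊎ Fin (size (H M₂)) → Fin (size (H M₁)) ⊎ Fin (size (H M₂)) → Bool
prodAdj⊎ M₁ M₂ (inj₁ x) (inj₁ y) = adj (H M₁) x y
prodAdj⊎ M₁ M₂ (inj₂ x) (inj₂ y) = adj (H M₂) x y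
-- no backward edges between the two parts under θ
prodAdj⊎ M₁ M₂ (inj₁ x) (inj₂ y) = toℕ (f M₁ x) <ᵇ toℕ (f M₂ y)
prodAdj⊎ M₁ M₂ (inj₂ x) (inj₁ y) = toℕ (f M₂ x) <ᵇ toℕ (f M₁ y)

prod : ∀ {k} → Member k → Member k → Digraph
prod M₁ M₂ = record
  { dsize = size (H M₁) + size (H M₂)
  ; dadj  = λ x y → prodAdj⊎ M₁ M₂ (splitAt (size (H M₁)) x) (splitAt (size (H M₁)) y) }

asDigraph : ∀ {k} → Member k → Digraph
asDigraph M = record { dsize = size (H M) ; dadj = adj (H M) }

prodFam : ∀ {k} → List (Member k) → List (Member k) → List Digraph
prodFam [] F₂ = map asDigraph F₂
prodFam F₁@(_ ∷ _) [] = map asDigraph F₁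
prodFam F₁@(_ ∷ _) F₂@(_ ∷ _) = concatMap (λ M₁ → map (prod M₁) F₂) F₁

Orthogonal : ∀ {k} → Member k → Member k → Set
Orthogonal M₁ M₂ = ∀ x y → f M₁ x ≢ f M₂ y

Regular : Tournament → Set
Regular T₀ = ∃[ v ] ∃[ η ] (ValidVη v η × ∃[ F₁ ] ∃[ F₂ ]
  ( (F₁ ≡ [] ⊎ StrongEH v η F₁)
  × (F₂ ≡ [] ⊎ StrongEH v η F₂)
  × All (λ M₁ → All (Orthogonal M₁) F₂) F₁
  × (prodFam F₁ F₂ ≢ [])
  × All (λ D → Contains (dadj D) (adj T₀)) (prodFam F₁ F₂)))

ContainsT : Tournament → Tournament → Set
ContainsT T H₀ = Contains (adj T) (adj H₀)

{-# OPTIONS --safe #-}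
module Submission where

-- Let q be large, and let X be a smallest vertex set of an H-free tournament that has more than t^q
-- vertices, where t is the size of its largest transitive subset. Then every subset with at least
-- |X|/L vertices contains a transitive subset of nearly t vertices, so X has no two sets complete to
-- each other whose sizes are proportional to |X| and |X|, or to |X| and t.
--
-- A greedy embedding of H into X gets stuck, which yields two sets of linear size with few arcs from
-- the second to the first; iterating, and passing to transitive subsets where v demands it, gives an
-- m-sequence with λ as small as we like. The strong EH-property wants λ small in terms of c, while
-- the sets found have size δ|X| with δ depending on λ. This is resolved by applying the property not
-- to X but to the subtournament induced on the union X′ of the sets, relative to which c depends on v
-- and η alone. A strong pair in X′ is then excluded by the choice of X, with constants depending on δ.
--
-- Transitive sets are represented by chains, lists in which every vertex has an arc to all later ones.

import Defs
open import Defs using (Tournament; size; adj; irrefl; tour; Arc; Transitive; Regular; Contains; ContainsT; StrongEH; StrongPair; MSeq; BlockOK; DensityAtLeast; DensityOne; AtLeastV; AtLeastTr; edges; Block; blockSet; Shape; Member; nth; CopyIn; kOf; prod; prodFam; prodAdj⊎; dadj; asDigraph; Orthogonal; ℕ→ℚ; Disjoint; long)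
open import Data.Bool as Bool using (Bool; true; false; not; _∧_; if_then_else_)
open import Data.Bool.Properties using (¬-not)
open import Data.Empty using (⊥; ⊥-elim)
open import Data.Fin as Fin using (Fin; splitAt)
open import Data.Fin.Properties as Fin using (toℕ-injective)
open import Data.Fin.Subset using (Subset; ⁅_⁆; ⋃; _∪_; ∣_∣; Nonempty) renaming (_∈_ to _∈ₛ_)
open import Data.Fin.Subset.Properties using (x∈⁅x⁆; x∈⁅y⁆⇒x≡y; x∈p∪q⁺; x∈p∪q⁻; ∉⊥; x∈p∩q⁻; ∪-assoc; ∪-identityˡ)
open import Data.Integer as ℤ using (+[1+_]; -[1+_])
import Data.Integer.Properties as ℤ
open import Data.List using (List; []; _∷_; _++_; length; map; filter; take; drop; concat; concatMap; allFin; tabulate; lookup)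
open import Data.List.Properties using (length-++; length-take; length-map; length-tabulate; length-drop; filter-none; filter-++; map-tabulate; map-++; concat-map)
open import Data.List.Membership.Propositional using (_∈_; find; lose)
open import Data.List.Membership.Propositional.Properties using (∈-filter⁺; ∈-filter⁻; ∈-∃++; ∈-++⁻; ∈-++⁺ˡ; ∈-++⁺ʳ; ∈-allFin; ∈-concat⁺′; ∈-concat⁻′; ∈-concatMap⁺; ∈-map⁺; ∈-map⁻; ∈-length; ∈-lookup; ∈-tabulate⁺; ∈-tabulate⁻)
open import Data.List.Membership.DecPropositional using () renaming (_∈?_ to member?)
open import Data.List.Relation.Binary.Permutation.Propositional.Properties using (map⁺; shift)
open import Data.List.Relation.Unary.All as All using (All; []; _∷_)
open import Data.List.Relation.Unary.All.Properties as All using () renaming (map⁻ to All-map⁻)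
open import Data.List.Relation.Unary.AllPairs as AllPairs using (AllPairs; []; _∷_)
import Data.List.Relation.Unary.AllPairs.Properties as AllPairs
open import Data.List.Relation.Unary.Any as Any using (Any; here; there; any?)
open import Data.List.Relation.Unary.Any.Properties using (lookup-index)
open import Data.List.Relation.Unary.Linked using (Linked; []; [-]; _∷_)
open import Data.List.Relation.Unary.Unique.Propositional using (Unique)
open import Data.List.Relation.Unary.Unique.Propositional.Properties using () renaming (filter⁺ to Unique-filter⁺; take⁺ to Unique-take⁺; ++⁺ to Unique-++⁺; allFin⁺ to Unique-allFin; map⁺ to Unique-map⁺; map⁻ to Unique-map⁻)
open import Data.Nat as ℕ using (ℕ; zero; suc; _+_; _*_; _^_; _≤_; _<_; _≤?_; _<ᵇ_; _/_; _%_; z≤n; s≤s; >-nonZero)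
open import Data.Nat.DivMod using (m/n*n≤m; m≡m%n+[m/n]*n; m%n<n; /-monoˡ-≤; m*n/n≡m)
open import Data.Nat.ListAction using (sum)
open import Data.Nat.ListAction.Properties using (sum-↭)
open import Data.Nat.Properties as ℕ
open import Data.Nat.Tactic.RingSolver using (solve-∀)
open import Data.Product using (_×_; _,_; proj₁; proj₂; ∃-syntax; Σ-syntax)
open import Data.Rational as ℚ using (ℚ; mkℚ; 0ℚ; 1ℚ)
import Data.Rational.Properties as ℚ
open import Data.Rational.Unnormalised as ℚᵘ using (mkℚᵘ)
import Data.Rational.Unnormalised.Properties as ℚᵘ
open import Data.Sum as Sum using (_⊎_; inj₁; inj₂)
open import Data.Unit using (tt)
import Data.Vec as Vec
open import Data.Vec.Properties using ([]=⇒lookup; lookup⇒[]=)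
open import Function using (_∘_; id)
open import Function.Definitions using (Injective)
open import Relation.Binary.Definitions using (DecidableEquality; tri<; tri≈; tri>)
open import Relation.Binary.PropositionalEquality using (_≡_; _≢_; refl; sym; trans; cong; cong₂; subst; subst₂; module ≡-Reasoning)
open import Relation.Nullary using (¬_; Dec; yes; no; does)
open import Relation.Nullary.Decidable using (¬?; _×-dec_; _⊎-dec_; decidable-stable; map′)
open import Relation.Unary using (Decidable)

-- Counting in lists

-- The constants are fixed in an order that avoids circularity: `c` from v and η, then `k` and `K`
-- from the strong EH-property, then `L` from the sparse pairs needed for λ = 1/(k+1), and finally
-- `q` from `K` and `L`. That `c` can come first is due to cutting every set found down to the size
-- s of the innermost one, so that |X′| ≤ (|v|+1)s however small s/|X| is.
--
-- Real exponents are avoided. If q ≥ NL then (1+1/N)^q ≥ L, so passing to a 1/L fraction of X costs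
-- transitive sets only a factor N/(N+1). N = 1 suffices almost everywhere; only a strong pair with
-- a small transitive side forces N to grow with `K`.
--
-- For products, vertices are deleted before the second property is applied. Deletion is controlled
-- on whole pieces, but a transitive piece must keep a fair share of each of its parts. It does: the
-- piece has at most tr(T) vertices and each part a fixed fraction of tr(T), so a small fraction of
-- the piece is a small fraction of every part.

private variable
  Item Item′ : Set

∑ : List Item → (Item → ℕ) → ℕ
∑ xs f = sum (map f xs)

∑-mono : ∀ (xs : List Item) {f g : Item → ℕ} → (∀ {x} → x ∈ xs → f x ≤ g x) → ∑ xs f ≤ ∑ xs g
∑-mono []       h = z≤n
∑-mono (x ∷ xs) h = +-mono-≤ (h (here refl)) (∑-mono xs (h ∘ there))

∑-cong : ∀ (xs : List Item) {f g : Item → ℕ} → (∀ {x} → x ∈ xs → f x ≡ g x) → ∑ xs f ≡ ∑ xs g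
∑-cong []       h = refl
∑-cong (x ∷ xs) h = cong₂ _+_ (h (here refl)) (∑-cong xs (h ∘ there))

∑-const : ∀ (xs : List Item) c → ∑ xs (λ _ → c) ≡ length xs * c
∑-const []       c = refl
∑-const (x ∷ xs) c = cong (c +_) (∑-const xs c)

∑-+ : ∀ (xs : List Item) (f g : Item → ℕ) → ∑ xs (λ x → f x + g x) ≡ ∑ xs f + ∑ xs g
∑-+ []       f g = refl
∑-+ (x ∷ xs) f g = trans (cong (f x + g x +_) (∑-+ xs f g)) (interchange (f x) (g x) (∑ xs f) (∑ xs g))
  where
  interchange : ∀ a b c d → a + b + (c + d) ≡ a + c + (b + d)
  interchange = solve-∀

∑-* : ∀ k (xs : List Item) (f : Item → ℕ) → k * ∑ xs f ≡ ∑ xs (λ x → k * f x)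
∑-* k []       f = *-zeroʳ k
∑-* k (x ∷ xs) f = trans (*-distribˡ-+ k (f x) (∑ xs f)) (cong (k * f x +_) (∑-* k xs f))

∑-swap : ∀ (xs : List Item) (ys : List Item′) (f : Item → Item′ → ℕ) →
  ∑ xs (λ x → ∑ ys (f x)) ≡ ∑ ys (λ y → ∑ xs (λ x → f x y))
∑-swap []       ys f = sym (trans (∑-const ys 0) (*-zeroʳ (length ys)))
∑-swap (x ∷ xs) ys f = trans (cong (∑ ys (f x) +_) (∑-swap xs ys f)) (sym (∑-+ ys (f x) _))

∑-≤ : ∀ (xs : List Item) {f : Item → ℕ} {k a} → (∀ {x} → x ∈ xs → k * f x ≤ a) → k * ∑ xs f ≤ length xs * a
∑-≤ xs {f} {k} {a} h = begin
  k * ∑ xs f            ≡⟨ ∑-* k xs f ⟩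
  ∑ xs (λ x → k * f x)  ≤⟨ ∑-mono xs h ⟩
  ∑ xs (λ _ → a)        ≡⟨ ∑-const xs a ⟩
  length xs * a         ∎
  where open ≤-Reasoning

count : {P : Item → Set} → Decidable P → List Item → ℕ
count P? xs = length (filter P? xs)

𝟙 : Dec Item → ℕ
𝟙 d = if does d then 1 else 0

count-∑ : {P : Item → Set} (P? : Decidable P) (xs : List Item) → count P? xs ≡ ∑ xs (λ x → 𝟙 (P? x))
count-∑ P? []       = refl
count-∑ P? (x ∷ xs) with does (P? x)
... | true  = cong suc (count-∑ P? xs)
... | false = count-∑ P? xs

∑-filter : {P : Item → Set} (P? : Decidable P) (xs : List Item) (f : Item → ℕ) →
  ∑ (filter P? xs) f ≡ ∑ xs (λ x → if does (P? x) then f x else 0)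
∑-filter P? []       f = refl
∑-filter P? (x ∷ xs) f with does (P? x)
... | true  = cong (f x +_) (∑-filter P? xs f)
... | false = ∑-filter P? xs f

module _ {R : Item → Item′ → Set} (R? : ∀ x y → Dec (R x y)) where

  pairs : List Item → List Item′ → ℕ
  pairs xs ys = ∑ xs (λ x → count (R? x) ys)

  pairs-swap : ∀ xs ys → pairs xs ys ≡ ∑ ys (λ y → count (λ x → R? x y) xs)
  pairs-swap xs ys = begin
    ∑ xs (λ x → count (R? x) ys)              ≡⟨ ∑-cong xs (λ {x} _ → count-∑ (R? x) ys) ⟩
    ∑ xs (λ x → ∑ ys (λ y → 𝟙 (R? x y)))      ≡⟨ ∑-swap xs ys _ ⟩
    ∑ ys (λ y → ∑ xs (λ x → 𝟙 (R? x y)))      ≡⟨ ∑-cong ys (λ {y} _ → sym (count-∑ (λ x → R? x y) xs)) ⟩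
    ∑ ys (λ y → count (λ x → R? x y) xs)      ∎
    where open ≡-Reasoning

count-split : {P : Item → Set} (P? : Decidable P) (xs : List Item) → count P? xs + count (¬? ∘ P?) xs ≡ length xs
count-split P? []       = refl
count-split P? (x ∷ xs) with does (P? x)
... | true  = cong suc (count-split P? xs)
... | false = trans (+-suc _ _) (cong suc (count-split P? xs))

count-mono : {P Q : Item → Set} (P? : Decidable P) (Q? : Decidable Q) (xs : List Item) →
  (∀ {x} → x ∈ xs → P x → Q x) → count P? xs ≤ count Q? xs
count-mono P? Q? []       h = z≤n
count-mono P? Q? (x ∷ xs) h with P? x | Q? x
... | yes p | yes q = s≤s (count-mono P? Q? xs (h ∘ there))
... | yes p | no ¬q = ⊥-elim (¬q (h (here refl) p))
... | no ¬p | yes q = m≤n⇒m≤1+n (count-mono P? Q? xs (h ∘ there))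
... | no ¬p | no ¬q = count-mono P? Q? xs (h ∘ there)

markov : {P : Item → Set} (P? : Decidable P) (xs : List Item) {f : Item → ℕ} {a : ℕ} →
  (∀ {x} → x ∈ xs → P x → a ≤ f x) → count P? xs * a ≤ ∑ xs f
markov P? []       h = z≤n
markov P? (x ∷ xs) {f} h with P? x
... | yes p = +-mono-≤ (h (here refl) p) (markov P? xs (h ∘ there))
... | no ¬p = ≤-trans (markov P? xs (h ∘ there)) (m≤n+m _ (f x))

union-bound : ∀ {Q : Item′ → Item → Set} (Q? : ∀ r x → Dec (Q r x)) (rs : List Item′) (xs : List Item) →
  count (λ x → any? (λ r → Q? r x) rs) xs ≤ ∑ rs (λ r → count (Q? r) xs)
union-bound {Q = Q} Q? rs xs = begin
  count anyQ? xs                      ≡⟨ sym (*-identityʳ _) ⟩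
  count anyQ? xs * 1                  ≤⟨ markov anyQ? xs (λ {x} _ → positive x rs) ⟩
  pairs (λ x r → Q? r x) xs rs        ≡⟨ pairs-swap (λ x r → Q? r x) xs rs ⟩
  ∑ rs (λ r → count (Q? r) xs)        ∎
  where
  open ≤-Reasoning
  anyQ? : Decidable (λ x → Any (λ r → Q r x) rs)
  anyQ? x = any? (λ r → Q? r x) rs
  positive : ∀ x rs → Any (λ r → Q r x) rs → 1 ≤ count (λ r → Q? r x) rs
  positive x (r ∷ rs) a with Q? r x
  positive x (r ∷ rs) a         | yes _ = s≤s z≤n
  positive x (r ∷ rs) (here q)  | no ¬q = ⊥-elim (¬q q)
  positive x (r ∷ rs) (there a) | no _  = positive x rs a

∑-⊆ : ∀ {xs ys : List Item} (f : Item → ℕ) → Unique xs → (∀ {x} → x ∈ xs → x ∈ ys) → ∑ xs f ≤ ∑ ys f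
∑-⊆ f [] sub = z≤n
∑-⊆ {xs = x ∷ xs} f (x∉ ∷ u) sub with ∈-∃++ (sub (here refl))
... | as , bs , refl = begin
  f x + ∑ xs f           ≤⟨ +-monoʳ-≤ (f x) (∑-⊆ f u sub′) ⟩
  f x + ∑ (as ++ bs) f   ≡⟨ sum-↭ (map⁺ f (shift x as bs)) ⟨
  ∑ (as ++ x ∷ bs) f     ∎
  where
  open ≤-Reasoning
  sub′ : ∀ {y} → y ∈ xs → y ∈ as ++ bs
  sub′ y∈ with ∈-++⁻ as (sub (there y∈))
  ... | inj₁ p         = ∈-++⁺ˡ p
  ... | inj₂ (here refl) = ⊥-elim (All.lookup x∉ y∈ refl)
  ... | inj₂ (there p) = ∈-++⁺ʳ as p

length-∑ : (xs : List Item) → ∑ xs (λ _ → 1) ≡ length xs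
length-∑ xs = trans (∑-const xs 1) (*-identityʳ _)

length-⊆ : ∀ {xs ys : List Item} → Unique xs → (∀ {x} → x ∈ xs → x ∈ ys) → length xs ≤ length ys
length-⊆ {xs = xs} {ys} u sub = begin
  length xs        ≡⟨ length-∑ xs ⟨
  ∑ xs (λ _ → 1)   ≤⟨ ∑-⊆ _ u sub ⟩
  ∑ ys (λ _ → 1)   ≡⟨ length-∑ ys ⟩
  length ys        ∎
  where open ≤-Reasoning

module _ (_≟_ : DecidableEquality Item) where

  mem? : (x : Item) (xs : List Item) → Dec (x ∈ xs)
  mem? = member? _≟_

  ⊆-length⇒⊇ : ∀ {xs ys : List Item} → Unique xs → (∀ {x} → x ∈ xs → x ∈ ys) → length ys ≤ length xs →
    ∀ {y} → y ∈ ys → y ∈ xs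
  ⊆-length⇒⊇ {xs} {ys} u sub le {y} y∈ with mem? y xs
  ... | yes p = p
  ... | no ¬p = ⊥-elim (<-irrefl refl (≤-trans (length-⊆ {xs = y ∷ xs} {ys} u′ sub′) le))
    where
    u′ : Unique (y ∷ xs)
    u′ = All.tabulate (λ {x} x∈ y≡x → ¬p (subst (_∈ xs) (sym y≡x) x∈)) ∷ u
    sub′ : ∀ {x} → x ∈ y ∷ xs → x ∈ ys
    sub′ (here refl) = y∈
    sub′ (there q)   = sub q

  minus : List Item → List Item → List Item
  minus ys xs = filter (λ y → ¬? (mem? y xs)) ys

  length-minus : ∀ {xs ys : List Item} → Unique ys → length ys ≤ length xs + length (minus ys xs)
  length-minus {xs} {ys} u = begin
    length ys                                   ≡⟨ count-split (λ y → mem? y xs) ys ⟨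
    count (λ y → mem? y xs) ys + length (minus ys xs)        ≤⟨ +-monoˡ-≤ _ (length-⊆ {ys = xs} (Unique-filter⁺ (λ y → mem? y xs) u)
                                                    (proj₂ ∘ ∈-filter⁻ (λ y → mem? y xs) {xs = ys})) ⟩
    length xs + length (minus ys xs)                ∎
    where open ≤-Reasoning

take-length : ∀ k (xs : List Item) → k ≤ length xs → length (take k xs) ≡ k
take-length k xs le = trans (length-take k xs) (m≤n⇒m⊓n≡m le)

∈-take : ∀ k {xs : List Item} {x} → x ∈ take k xs → x ∈ xs
∈-take (suc k) {y ∷ xs} (here p)  = here p
∈-take (suc k) {y ∷ xs} (there p) = there (∈-take k p)

-- Greedy embedding

count-⊆ : ∀ {A : Set} {P Q : A → Set} (P? : Decidable P) (Q? : Decidable Q) {xs ys : List A} →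
  Unique xs → (∀ {x} → x ∈ xs → x ∈ ys) → (∀ {x} → x ∈ xs → P x → Q x) → count P? xs ≤ count Q? ys
count-⊆ P? Q? {xs} {ys} u sub imp = length-⊆ (Unique-filter⁺ P? u) λ x∈ →
  let x∈xs , px = ∈-filter⁻ P? {xs = xs} x∈ in ∈-filter⁺ Q? (sub x∈xs) (imp x∈xs px)

count<length : ∀ {A : Set} {P : A → Set} (P? : Decidable P) (xs : List A) → count P? xs < length xs →
  ∃[ x ] x ∈ xs × ¬ P x
count<length P? (x ∷ xs) lt with P? x
... | no ¬p = x , here refl , ¬p
... | yes p with count<length P? xs (≤-pred lt)
...   | y , y∈ , ¬p = y , there y∈ , ¬p

module _ (T : Tournament) where

  arc? : ∀ x y → Dec (Arc T x y)
  arc? x y = adj T x y Bool.≟ true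

  ¬arc-refl : ∀ {x y} → x ≡ y → ¬ Arc T x y
  ¬arc-refl {x} refl a with trans (sym a) (irrefl T x)
  ... | ()

  arc-asym : ∀ {x y} → Arc T x y → adj T y x ≡ false
  arc-asym {x} {y} a with tour T y x (λ e → ¬arc-refl (sym e) a)
  ... | e rewrite a = e

  arc-total : ∀ {x y} → x ≢ y → adj T x y ≡ false → Arc T y x
  arc-total {x} {y} ne e with tour T y x (ne ∘ sym)
  ... | e′ rewrite e = e′

-- Two vertices of `H` with a common image would have no arc in either direction, because `G` is
-- loopless; in a tournament this forces them to be equal.
adj-hom⇒injective : ∀ {n} (G : Fin n → Fin n → Bool) → (∀ x → G x x ≡ false) →
  (H : Tournament) (φ : Fin (size H) → Fin n) →
  (∀ a b → G (φ a) (φ b) ≡ adj H a b) → Injective _≡_ _≡_ φ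
adj-hom⇒injective G loopless H φ hom {a} {b} eq with a Fin.≟ b
... | yes a≡b = a≡b
... | no a≢b = ⊥-elim (false≢true (trans (sym (loop (sym eq))) (trans (tour H b a (a≢b ∘ sym)) (cong not (loop eq)))))
  where
  loop : ∀ {c d} → φ c ≡ φ d → adj H c d ≡ false
  loop {c} {d} e = trans (sym (hom c d)) (trans (cong (λ z → G z (φ d)) e) (loopless (φ d)))
  false≢true : false ≢ true
  false≢true ()

module Embedding (H T : Tournament) (x₀ : Fin (size T)) (X : List (Fin (size T))) (g w d : ℕ) (h<g : size H < g) (1≤w : 1 ≤ w) (1≤d : 1 ≤ d) where

  private
    V  = Fin (size T)
    VH = Fin (size H)

  Matches : VH → VH → V → V → Set
  Matches r r′ x y = adj T x y ≡ adj H r r′ × adj T y x ≡ adj H r′ r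

  matches? : ∀ r r′ x y → Dec (Matches r r′ x y)
  matches? r r′ x y = (adj T x y Bool.≟ adj H r r′) ×-dec (adj T y x Bool.≟ adj H r′ r)

  -- The outcome of a failed step of the greedy embedding: r has been tried, and too many of its
  -- candidates leave too few candidates for r′.
  record Unbalanced : Set where
    field
      r r′ : VH
      r≢r′ : r ≢ r′
      s N  : ℕ
      A Y  : List V
      w≤s  : w ≤ s
      dN≡  : d * N ≡ 4 * g * s
      A-unique : Unique A
      Y-unique : Unique Y
      A⊆X  : ∀ {x} → x ∈ A → x ∈ X
      Y⊆X  : ∀ {x} → x ∈ Y → x ∈ X
      A-large  : 4 * s ≤ length A
      Y-length : length Y ≡ 4 * g * s
      few  : ∀ {x} → x ∈ A → count (matches? r r′ x) Y ≤ N

  -- Here `k` counts the vertices of `H` still to be embedded. Fixing the length exactly, one factor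
  -- `d` per level, lets all later estimates depend on the level alone.
  record Candidates (k : ℕ) (Y : List V) : Set where
    field
      length≡ : length Y ≡ 4 * g * (w * d ^ k)
      unique  : Unique Y
      ⊆X      : ∀ {x} → x ∈ Y → x ∈ X
  open Candidates

  1≤d^ : ∀ k → 1 ≤ d ^ k
  1≤d^ k = subst (_≤ d ^ k) (^-zeroˡ k) (^-monoˡ-≤ k 1≤d)

  private
    width : ℕ → ℕ
    width k = w * d ^ k

    1≤width : ∀ k → 1 ≤ width k
    1≤width k = *-mono-≤ 1≤w (1≤d^ k)

    -- This is the candidate length of level `k`: a vertex with at least so many matches for `r′`
    -- allows the list of `r′` to be cut to that length for the next round.
    threshold : ℕ → ℕ
    threshold k = width k * (4 * g)

    few? : (cand : VH → List V) (k : ℕ) (r r′ : VH) (x : V) → Dec (count (matches? r r′ x) (cand r′) ≤ threshold k)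
    few? cand k r r′ x = count (matches? r r′ x) (cand r′) ≤? threshold k

    shuffle₁ : ∀ d w e g → d * (w * e * (4 * g)) ≡ 4 * g * (w * (d * e))
    shuffle₁ = solve-∀
    shuffle₂ : ∀ g s → g * (4 * s) ≡ 4 * g * s
    shuffle₂ = solve-∀

  unbalanced : ∀ r r′ k (cand : VH → List V) → r ≢ r′ → Candidates (suc k) (cand r) → Candidates (suc k) (cand r′) →
    4 * width (suc k) ≤ count (few? cand k r r′) (cand r) → Unbalanced
  unbalanced r r′ k cand r≢r′ Cr Cr′ large = record
    { r = r ; r′ = r′ ; r≢r′ = r≢r′
    ; s = width (suc k) ; N = threshold k
    ; A = filter (few? cand k r r′) (cand r) ; Y = cand r′
    ; w≤s = ≤-trans (≤-reflexive (sym (*-identityʳ w))) (*-monoʳ-≤ w (1≤d^ (suc k)))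
    ; dN≡ = shuffle₁ d w (d ^ k) g
    ; A-unique = Unique-filter⁺ (few? cand k r r′) (unique Cr)
    ; Y-unique = unique Cr′
    ; A⊆X = λ x∈ → ⊆X Cr (proj₁ (∈-filter⁻ (few? cand k r r′) {xs = cand r} x∈))
    ; Y⊆X = ⊆X Cr′
    ; A-large = large
    ; Y-length = length≡ Cr′
    ; few = λ x∈ → proj₂ (∈-filter⁻ (few? cand k r r′) {xs = cand r} x∈)
    }

  -- A union bound over `rs`: at most |rs| · 4s candidates of `r` are excluded, and |rs| < g makes
  -- this less than the 4gs candidates available.
  good-vertex : ∀ r rs (cand : VH → List V) → length rs ≤ size H → Candidates (suc (length rs)) (cand r) →
    (∀ {r′} → r′ ∈ rs → count (few? cand (length rs) r r′) (cand r) ≤ 4 * width (suc (length rs))) →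
    ∃[ x ] x ∈ cand r × (∀ {r′} → r′ ∈ rs → threshold (length rs) ≤ count (matches? r r′ x) (cand r′))
  good-vertex r rs cand le Cr bound =
    let x , x∈ , ¬few = count<length anyFew? (cand r) fewer
    in  x , x∈ , λ r′∈ → <⇒≤ (≰⇒> (λ f → ¬few (lose r′∈ f)))
    where
    anyFew? : ∀ x → Dec (Any (λ r′ → count (matches? r r′ x) (cand r′) ≤ threshold (length rs)) rs)
    anyFew? x = any? (λ r′ → few? cand (length rs) r r′ x) rs
    s = width (suc (length rs))
    fewer : count anyFew? (cand r) < length (cand r)
    fewer = begin-strict
      count anyFew? (cand r)                                         ≤⟨ union-bound (few? cand (length rs) r) rs (cand r) ⟩
      ∑ rs (λ r′ → count (few? cand (length rs) r r′) (cand r))      ≡⟨ *-identityˡ (∑ rs (λ r′ → count (few? cand (length rs) r r′) (cand r))) ⟨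
      1 * ∑ rs (λ r′ → count (few? cand (length rs) r r′) (cand r))
        ≤⟨ ∑-≤ rs {k = 1} (λ {r′} r′∈ → ≤-trans (≤-reflexive (*-identityˡ (count (few? cand (length rs) r r′) (cand r)))) (bound r′∈)) ⟩
      length rs * (4 * s)   <⟨ *-monoˡ-< (4 * s) {{>-nonZero (*-mono-≤ {1} {4} (s≤s z≤n) (1≤width (suc (length rs))))}}
                                 (≤-<-trans le h<g) ⟩
      g * (4 * s)           ≡⟨ shuffle₂ g s ⟩
      4 * g * s             ≡⟨ length≡ Cr ⟨
      length (cand r)       ∎
      where open ≤-Reasoning

  PartialHom : (VH → List V) → List VH → Set
  PartialHom cand rs = Σ[ φ ∈ (VH → V) ] (∀ {r} → r ∈ rs → φ r ∈ cand r) ×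
    (∀ {r r′} → r ∈ rs → r′ ∈ rs → adj T (φ r) (φ r′) ≡ adj H r r′)

  extend : ∀ {r rs x} {cand cand′ : VH → List V} → x ∈ cand r →
    (∀ {r′ y} → y ∈ cand′ r′ → y ∈ cand r′ × Matches r r′ x y) → PartialHom cand′ rs → PartialHom cand (r ∷ rs)
  extend {r} {rs} {x} {cand} x∈ matched (φ , φ∈ , hom) = φ′ , φ′∈ , hom′
    where
    φ′ : VH → V
    φ′ a with a Fin.≟ r
    ... | yes _ = x
    ... | no  _ = φ a
    φ′∈ : ∀ {a} → a ∈ r ∷ rs → φ′ a ∈ cand a
    φ′∈ {a} a∈ with a Fin.≟ r
    φ′∈ a∈         | yes refl = x∈
    φ′∈ (here e)   | no ne = ⊥-elim (ne e)
    φ′∈ (there a∈) | no ne = proj₁ (matched (φ∈ a∈))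
    hom′ : ∀ {a b} → a ∈ r ∷ rs → b ∈ r ∷ rs → adj T (φ′ a) (φ′ b) ≡ adj H a b
    hom′ {a} {b} a∈ b∈ with a Fin.≟ r | b Fin.≟ r
    hom′ a∈ b∈                 | yes refl | yes refl = trans (irrefl T x) (sym (irrefl H r))
    hom′ a∈ (here e)           | yes refl | no ne = ⊥-elim (ne e)
    hom′ a∈ (there b∈)         | yes refl | no ne = proj₁ (proj₂ (matched (φ∈ b∈)))
    hom′ (here e) b∈           | no ne | yes refl = ⊥-elim (ne e)
    hom′ (there a∈) b∈         | no ne | yes refl = proj₂ (proj₂ (matched (φ∈ a∈)))
    hom′ (here e) b∈           | no ne | no _ = ⊥-elim (ne e)
    hom′ (there a∈) (here e)   | no _  | no ne = ⊥-elim (ne e)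
    hom′ (there a∈) (there b∈) | no _  | no _ = hom a∈ b∈

  restrict : ∀ {r r′ x k Y} → Candidates (suc k) Y → threshold k ≤ count (matches? r r′ x) Y →
    Candidates k (take (4 * g * width k) (filter (matches? r r′ x) Y))
  restrict {r} {r′} {x} {k} {Y} C many = record
    { length≡ = take-length (4 * g * width k) (filter (matches? r r′ x) Y)
                  (≤-trans (≤-reflexive (*-comm (4 * g) (width k))) many)
    ; unique = Unique-take⁺ (4 * g * width k) (Unique-filter⁺ (matches? r r′ x) (unique C))
    ; ⊆X = λ y∈ → ⊆X C (proj₁ (∈-filter⁻ (matches? r r′ x) {xs = Y} (∈-take (4 * g * width k) y∈))) }

  embed : ∀ rs → Unique rs → length rs ≤ size H → (cand : VH → List V) →
    (∀ {r} → r ∈ rs → Candidates (length rs) (cand r)) → PartialHom cand rs ⊎ Unbalanced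
  -- A partial homomorphism is encoded as a total function; `x₀` is a dummy value for the vertices
  -- not yet embedded.
  embed [] _ _ _ _ = inj₁ ((λ _ → x₀) , (λ ()) , (λ ()))
  embed (r ∷ rs) (r∉rs ∷ rs-unique) le cand cs = decide (any? large? rs)
    where
    k = length rs
    Large : VH → Set
    Large r′ = 4 * width (suc k) ≤ count (few? cand k r r′) (cand r)
    large? : ∀ r′ → Dec (Large r′)
    large? r′ = 4 * width (suc k) ≤? count (few? cand k r r′) (cand r)
    proceed : ∃[ x ] x ∈ cand r × (∀ {r′} → r′ ∈ rs → threshold k ≤ count (matches? r r′ x) (cand r′)) →
      PartialHom cand (r ∷ rs) ⊎ Unbalanced
    proceed (x , x∈ , many) = Sum.map₁ (extend x∈ matched) (embed rs rs-unique (≤-trans (n≤1+n _) le) cand′ (λ r′∈ → restrict (cs (there r′∈)) (many r′∈)))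
      where
      cand′ : VH → List V
      cand′ r′ = take (4 * g * width k) (filter (matches? r r′ x) (cand r′))
      matched : ∀ {r′ y} → y ∈ cand′ r′ → y ∈ cand r′ × Matches r r′ x y
      matched {r′} y∈ = ∈-filter⁻ (matches? r r′ x) {xs = cand r′} (∈-take (4 * g * width k) y∈)
    decide : Dec (Any Large rs) → PartialHom cand (r ∷ rs) ⊎ Unbalanced
    decide (yes found) =
      let r′ , r′∈ , large = find found
      in  inj₂ (unbalanced r r′ k cand (All.lookup r∉rs r′∈) (cs (here refl)) (cs (there r′∈)) large)
    decide (no none) = proceed
      (good-vertex r rs cand (≤-trans (n≤1+n _) le) (cs (here refl)) (λ r′∈ → <⇒≤ (≰⇒> (λ l → none (lose r′∈ l)))))

-- `A` is to precede `B`, so the arcs from `B` to `A` are the backward ones. They are bounded at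
-- each vertex of `B`, hence also on every subset of `B`, which is where the later pieces are
-- sought. `A` has 2s vertices because up to s of them are discarded in `Prepend`.
record SparsePair (T : Tournament) (X : List (Fin (size T))) (d L : ℕ) : Set where
  field
    s        : ℕ
    A B      : List (Fin (size T))
    A-length : length A ≡ 2 * s
    B-length : length B ≡ s
    A-unique : Unique A
    B-unique : Unique B
    A⊆X      : ∀ {x} → x ∈ A → x ∈ X
    B⊆X      : ∀ {x} → x ∈ B → x ∈ X
    disjoint : ∀ {x} → x ∈ A → x ∈ B → ⊥
    X≤       : length X ≤ L * s
    sparse   : ∀ {y} → y ∈ B → d * count (arc? T y) A ≤ s

module _ (H T : Tournament) (x₀ : Fin (size T)) (X : List (Fin (size T)))
  (g w d : ℕ) (h<g : size H < g) (1≤w : 1 ≤ w) (1≤d : 1 ≤ d) where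

  private
    1≤8gd : 1 ≤ 8 * g * d
    1≤8gd = *-mono-≤ {1} {8 * g} (*-mono-≤ {1} {8} (s≤s z≤n) (≤-trans (s≤s z≤n) h<g)) 1≤d

  -- With this loss factor the bound on matches becomes 2d · count ≤ s, see `few′`. The spare factor
  -- 2 pays for the averaging in one of the two orientations.
  open Embedding H T x₀ X g w (8 * g * d) h<g 1≤w 1≤8gd using (Unbalanced; Matches; matches?)

  module _ (un : Unbalanced) where
    open Embedding.Unbalanced un
    private
      V = Fin (size T)
      1≤s : 1 ≤ s
      1≤s = ≤-trans 1≤w w≤s
      1≤g : 1 ≤ g
      1≤g = ≤-trans (s≤s z≤n) h<g

      sum-bound : ∀ a → a * s + 2 * s ≤ 4 * s → 2 * s ≤ length (minus Fin._≟_ Y (take (a * s) A))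
      sum-bound a le = +-cancelˡ-≤ (a * s) (2 * s) _ (begin
        a * s + 2 * s                                     ≤⟨ le ⟩
        4 * s                                             ≤⟨ *-monoˡ-≤ s (*-monoʳ-≤ 4 1≤g) ⟩
        4 * g * s                                         ≡⟨ Y-length ⟨
        length Y                                          ≤⟨ length-minus Fin._≟_ {xs = take (a * s) A} Y-unique ⟩
        length (take (a * s) A) + length (minus Fin._≟_ Y (take (a * s) A)) ≡⟨ cong (_+ length (minus Fin._≟_ Y (take (a * s) A))) (take-length (a * s) A
                                                               (≤-trans (≤-trans (m≤m+n (a * s) (2 * s)) le) A-large)) ⟩
        a * s + length (minus Fin._≟_ Y (take (a * s) A))              ∎)
        where
        open ≤-Reasoning

      -- `a` is 1 if `A′` is to be the smaller, second set of the sparse pair, and 2 if it is the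
      -- first. `Y′` has 2s vertices either way: it is the first set in the one case, and loses half
      -- of itself to averaging in the other.
      module Sides (a : ℕ) (le : a * s + 2 * s ≤ 4 * s) where
        A′ Y′ : List V
        A′ = take (a * s) A
        Y′ = take (2 * s) (minus Fin._≟_ Y A′)
        ¬∈A′? : ∀ y → Dec (¬ (y ∈ A′))
        ¬∈A′? y = ¬? (mem? Fin._≟_ y A′)
        A′-length : length A′ ≡ a * s
        A′-length = take-length (a * s) A (≤-trans (≤-trans (m≤m+n (a * s) (2 * s)) le) A-large)
        Y′-length : length Y′ ≡ 2 * s
        Y′-length = take-length (2 * s) _ (sum-bound a le)
        A′-unique : Unique A′
        A′-unique = Unique-take⁺ (a * s) A-unique
        Y′-unique : Unique Y′
        Y′-unique = Unique-take⁺ (2 * s) (Unique-filter⁺ ¬∈A′? Y-unique)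
        A′⊆A : ∀ {x} → x ∈ A′ → x ∈ A
        A′⊆A = ∈-take (a * s)
        Y′⊆ : ∀ {x} → x ∈ Y′ → x ∈ Y × ¬ (x ∈ A′)
        Y′⊆ x∈ = ∈-filter⁻ ¬∈A′? {xs = Y} (∈-take (2 * s) x∈)
        disjoint′ : ∀ {x} → x ∈ Y′ → x ∈ A′ → ⊥
        disjoint′ p q = proj₂ (Y′⊆ p) q

        few′ : ∀ {P : V → Set} (P? : Decidable P) {x} → x ∈ A′ → (∀ {y} → y ∈ Y′ → P y → Matches r r′ x y) →
          2 * d * count P? Y′ ≤ s
        few′ P? {x} x∈ imp = *-cancelˡ-≤ (4 * g) {{>-nonZero (*-mono-≤ {1} {4} (s≤s z≤n) 1≤g)}} (begin
          4 * g * (2 * d * count P? Y′)   ≡⟨ shuffle g d (count P? Y′) ⟩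
          8 * g * d * count P? Y′         ≤⟨ *-monoʳ-≤ (8 * g * d) (≤-trans (count-⊆ P? (matches? r r′ x) Y′-unique (λ y∈ → proj₁ (Y′⊆ y∈)) imp) (few (A′⊆A x∈))) ⟩
          8 * g * d * N                   ≡⟨ dN≡ ⟩
          4 * g * s                       ∎)
          where
          open ≤-Reasoning
          shuffle : ∀ g d c → 4 * g * (2 * d * c) ≡ 8 * g * d * c
          shuffle = solve-∀

    -- If the arcs avoided by A go from A to Y, then Y comes first and nothing has to be done. Otherwise
    -- the degrees are bounded on the wrong side, and averaging over Y keeps half of it.
    toSparsePair : ∀ {L} → length X ≤ L * w → SparsePair T X d L
    toSparsePair {L} X≤L = orient (adj H r r′) refl
      where
      X≤Ls : length X ≤ L * s
      X≤Ls = ≤-trans X≤L (*-monoʳ-≤ L w≤s)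
      orient : ∀ b → adj H r r′ ≡ b → SparsePair T X d L
      orient true rr′ = record
        { s = s ; A = Y′ ; B = A′ ; A-length = Y′-length ; B-length = trans A′-length (*-identityˡ s)
        ; A-unique = Y′-unique ; B-unique = A′-unique
        ; A⊆X = λ x∈ → Y⊆X (proj₁ (Y′⊆ x∈)) ; B⊆X = λ x∈ → A⊆X (A′⊆A x∈)
        ; disjoint = disjoint′ ; X≤ = X≤Ls
        ; sparse = λ {x} x∈ → ≤-trans (*-monoˡ-≤ (count (arc? T x) Y′) (m≤n*m d 2))
            (few′ (arc? T x) x∈ (λ _ a → trans a (sym rr′) , trans (arc-asym T a) (sym (arc-asym H rr′)))) }
        where
        three : ∀ s → 1 * s + 2 * s ≡ 3 * s
        three = solve-∀
        open Sides 1 (≤-trans (≤-reflexive (three s)) (*-monoˡ-≤ s {3} {4} (n≤1+n 3)))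
      orient false rr′ = record
        { s = s ; A = A′ ; B = take s good ; A-length = A′-length ; B-length = take-length s good many-good
        ; A-unique = A′-unique ; B-unique = Unique-take⁺ s (Unique-filter⁺ good? Y′-unique)
        ; A⊆X = λ x∈ → A⊆X (A′⊆A x∈) ; B⊆X = λ x∈ → Y⊆X (proj₁ (Y′⊆ (proj₁ (good∈ x∈))))
        ; disjoint = λ p q → disjoint′ (proj₁ (good∈ q)) p ; X≤ = X≤Ls
        ; sparse = λ y∈ → proj₂ (good∈ y∈) }
        where
        four : ∀ s → 2 * s + 2 * s ≡ 4 * s
        four = solve-∀
        open Sides 2 (≤-reflexive (four s))
        r′r : adj H r′ r ≡ true
        r′r = arc-total H r≢r′ rr′
        good? : ∀ y → Dec (d * count (arc? T y) A′ ≤ s)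
        good? y = d * count (arc? T y) A′ ≤? s
        good = filter good? Y′
        good∈ : ∀ {y} → y ∈ take s good → y ∈ Y′ × d * count (arc? T y) A′ ≤ s
        good∈ y∈ = ∈-filter⁻ good? {xs = Y′} (∈-take s y∈)
        bad = count (λ y → ¬? (good? y)) Y′
        bad≤ : bad ≤ s
        bad≤ = *-cancelʳ-≤ bad s s {{>-nonZero 1≤s}} (begin
          bad * s                                           ≤⟨ markov (λ y → ¬? (good? y)) Y′ (λ _ ¬g → <⇒≤ (≰⇒> ¬g)) ⟩
          ∑ Y′ (λ y → d * count (arc? T y) A′)              ≡⟨ ∑-* d Y′ _ ⟨
          d * pairs (arc? T) Y′ A′                          ≡⟨ cong (d *_) (pairs-swap (arc? T) Y′ A′) ⟩
          d * ∑ A′ (λ x → count (λ y → arc? T y x) Y′)      ≤⟨ halve ⟩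
          s * s                                             ∎)
          where
          open ≤-Reasoning
          halve : d * ∑ A′ (λ x → count (λ y → arc? T y x) Y′) ≤ s * s
          halve = *-cancelˡ-≤ 2 (begin
            2 * (d * ∑ A′ (λ x → count (λ y → arc? T y x) Y′))  ≡⟨ *-assoc 2 d _ ⟨
            2 * d * ∑ A′ (λ x → count (λ y → arc? T y x) Y′)    ≤⟨ ∑-≤ A′ {k = 2 * d} (λ {x} x∈ →
               few′ (λ y → arc? T y x) x∈ (λ y∈ a → trans (arc-asym T a) (sym rr′) , trans a (sym r′r))) ⟩
            length A′ * s                                       ≡⟨ cong (_* s) A′-length ⟩
            2 * s * s                                           ≡⟨ *-assoc 2 s s ⟩
            2 * (s * s)                                         ∎)
        many-good : s ≤ length good
        many-good = +-cancelʳ-≤ bad s (length good) (begin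
          s + bad            ≤⟨ +-monoʳ-≤ s bad≤ ⟩
          s + s              ≡⟨ cong (s +_) (sym (+-identityʳ s)) ⟩
          2 * s              ≡⟨ Y′-length ⟨
          length Y′          ≡⟨ count-split good? Y′ ⟨
          length good + bad  ∎)
          where open ≤-Reasoning

sparse-pair : (H : Tournament) (d : ℕ) → 1 ≤ d → ∃[ L ] (1 ≤ L × (∀ (T : Tournament) → ¬ ContainsT T H →
  ∀ X → Unique X → L ≤ length X → SparsePair T X d L))
sparse-pair H d 1≤d = 2 * W , *-mono-≤ {1} {2} (s≤s z≤n) 1≤W , find-pair
  where
  g D W : ℕ
  g = suc (size H)
  D = 8 * g * d
  W = 4 * g * D ^ size H
  1≤D : 1 ≤ D
  1≤D = *-mono-≤ {1} {8 * g} (s≤s z≤n) 1≤d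
  1≤W : 1 ≤ W
  1≤W = *-mono-≤ {1} {4 * g} (s≤s z≤n) (subst (_≤ D ^ size H) (^-zeroˡ (size H)) (^-monoˡ-≤ (size H) 1≤D))
  find-pair : ∀ (T : Tournament) → ¬ ContainsT T H → ∀ X → Unique X → 2 * W ≤ length X → SparsePair T X d (2 * W)
  find-pair T free [] _ le = ⊥-elim (n≮0 (≤-trans (*-mono-≤ {1} {2} (s≤s z≤n) 1≤W) le))
  -- All vertices of `H` start from the same list `X₀`. The candidate lists need not be disjoint,
  -- since a homomorphism is automatically injective.
  find-pair T free X@(x₀ ∷ _) X-unique le = conclude (embed (allFin (size H)) (Unique-allFin (size H)) (≤-reflexive h≡) (λ _ → X₀) (λ _ → start))
    where
    instance _ = >-nonZero 1≤W
    -- The initial lists then have wW ≤ |X| vertices. Rounding down costs at most a factor 2, whence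
    -- L = 2W.
    w = length X / W
    1≤w : 1 ≤ w
    1≤w = ≤-trans (≤-reflexive (sym (m*n/n≡m 1 W))) (/-monoˡ-≤ W (≤-trans (*-monoˡ-≤ W {1} {2} (s≤s z≤n)) le))
    X≤ : length X ≤ 2 * W * w
    X≤ = begin
      length X                       ≡⟨ m≡m%n+[m/n]*n (length X) W ⟩
      length X % W + w * W           ≤⟨ +-monoˡ-≤ (w * W) (≤-trans (<⇒≤ (m%n<n (length X) W)) (m≤n*m W w {{>-nonZero 1≤w}})) ⟩
      w * W + w * W                  ≡⟨ double w W ⟩
      2 * W * w                      ∎
      where
      open ≤-Reasoning
      double : ∀ w W → w * W + w * W ≡ 2 * W * w
      double = solve-∀
    open Embedding H T x₀ X g w D (n<1+n (size H)) 1≤w 1≤D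
    h≡ : length (allFin (size H)) ≡ size H
    h≡ = length-tabulate id
    m = 4 * g * (w * D ^ length (allFin (size H)))
    X₀ = take m X
    m≤ : m ≤ length X
    m≤ = begin
      m                                ≡⟨ cong (λ h → 4 * g * (w * D ^ h)) h≡ ⟩
      4 * g * (w * D ^ size H)         ≡⟨ rearrange g w (D ^ size H) ⟩
      w * W                            ≤⟨ m/n*n≤m (length X) W ⟩
      length X                         ∎
      where
      open ≤-Reasoning
      rearrange : ∀ g w e → 4 * g * (w * e) ≡ w * (4 * g * e)
      rearrange = solve-∀
    start : Candidates (length (allFin (size H))) X₀
    start = record { length≡ = take-length m X m≤ ; unique = Unique-take⁺ m X-unique ; ⊆X = ∈-take m }
    conclude : PartialHom (λ _ → X₀) (allFin (size H)) ⊎ Unbalanced → SparsePair T X d (2 * W)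
    conclude (inj₁ (φ , _ , hom)) = ⊥-elim (free (φ , adj-hom⇒injective (adj T) (irrefl T) H φ hom′ , hom′))
      where
      hom′ : ∀ a b → adj T (φ a) (φ b) ≡ adj H a b
      hom′ a b = hom (∈-allFin a) (∈-allFin b)
    conclude (inj₂ un) = toSparsePair H T x₀ X g w d (n<1+n (size H)) 1≤w 1≤d un X≤

-- Layouts

data Piece (V : Set) : Set where
  bulk  : List V → Piece V
  stack : List (List V) → Piece V

parts : ∀ {V} → Piece V → List (List V)
parts (bulk xs)  = xs ∷ []
parts (stack pss) = pss

vertices : ∀ {V} → Piece V → List V
vertices (bulk xs)  = xs
vertices (stack pss) = concat pss

data Shaped {V : Set} : List Bool → List ℕ → List (Piece V) → Set where
  []    : Shaped [] [] []
  bulk  : ∀ {v η ps xs} → Shaped v η ps → Shaped (false ∷ v) η (bulk xs ∷ ps)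
  stack : ∀ {v r η ps pss} → length pss ≡ r → Shaped v η ps → Shaped (true ∷ v) (r ∷ η) (stack pss ∷ ps)

Shaped-length : ∀ {V v η} {ps : List (Piece V)} → Shaped v η ps → length ps ≡ length v
Shaped-length []          = refl
Shaped-length (bulk sh)  = cong suc (Shaped-length sh)
Shaped-length (stack _ sh) = cong suc (Shaped-length sh)

Chain : (T : Tournament) → List (Fin (size T)) → Set
Chain T = AllPairs (Arc T)

PieceOK : (T : Tournament) (n τ C : ℕ) → Piece (Fin (size T)) → Set
PieceOK T n τ C (bulk xs)  = Unique xs × n ≤ C * length xs
PieceOK T n τ C (stack pss) = Chain T (concat pss) × All (λ P → τ ≤ C * length P) pss

-- An m-sequence with c = 1/C and λ = 1/M, where n and τ stand for |T| and tr(T). Bad contains the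
-- backward pairs; being symmetric and defined without reference to the order of the pieces, it can
-- be counted between any two of them.
record Layout (T : Tournament) (v : List Bool) (η : List ℕ) (n τ C M : ℕ) (ps : List (Piece (Fin (size T)))) : Set₁ where
  field
    Bad     : Fin (size T) → Fin (size T) → Set
    bad?    : ∀ x y → Dec (Bad x y)
    bad-sym : ∀ {x y} → Bad x y → Bad y x
    shaped  : Shaped v η ps
    ok      : ∀ {p} → p ∈ ps → PieceOK T n τ C p
    forward : AllPairs (λ P Q → ∀ {x y} → x ∈ P → y ∈ Q → x ≢ y × (¬ Bad x y → Arc T x y)) (concatMap parts ps)
    sparse  : ∀ {p q} → p ∈ ps → q ∈ ps →
      M * pairs bad? (vertices p) (vertices q) ≤ length (vertices p) * length (vertices q)

∈-parts⇒∈-vertices : ∀ {V} (p : Piece V) {P x} → P ∈ parts p → x ∈ P → x ∈ vertices p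
∈-parts⇒∈-vertices (bulk xs)  (here refl) x∈ = x∈
∈-parts⇒∈-vertices (stack pss) P∈ x∈ = ∈-concat⁺′ x∈ P∈

count-none : ∀ {A : Set} {P : A → Set} (P? : Decidable P) (xs : List A) → (∀ {x} → x ∈ xs → ¬ P x) → count P? xs ≡ 0
count-none P? xs none = cong length (filter-none P? (All.tabulate none))

chunks : ∀ {A : Set} r u (xs : List A) → r * u ≤ length xs →
  ∃[ pss ] length pss ≡ r × (∀ {x} → x ∈ concat pss → x ∈ xs) × concat pss ≡ take (r * u) xs × All (λ P → length P ≡ u) pss
chunks zero    u xs le = [] , refl , (λ ()) , refl , []
chunks (suc r) u xs le =
  let pss , len , sub , eq , all = chunks r u (drop u xs) (≤-trans (m+n≤o⇒m≤o∸n (r * u) (≤-trans (≤-reflexive (+-comm (r * u) u)) le)) (≤-reflexive (sym (length-drop u xs))))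
      eq′ = trans (cong (take u xs ++_) eq) (take-+ u (r * u) xs)
  in take u xs ∷ pss , cong suc len , (λ x∈ → ∈-take (u + r * u) (subst (_ ∈_) eq′ x∈))
     , eq′ , take-length u xs (≤-trans (m≤m+n u (r * u)) le) ∷ all
  where
  take-+ : ∀ {A : Set} a b (xs : List A) → take a xs ++ take b (drop a xs) ≡ take (a + b) xs
  take-+ zero    b xs       = refl
  take-+ (suc a) zero    []       = refl
  take-+ (suc a) (suc b) []       = refl
  take-+ (suc a) b (x ∷ xs) = cong (x ∷_) (take-+ a b xs)

module _ {A : Set} {R : A → A → Set} where

  ++-AllPairs⁻ : ∀ P {ys} → AllPairs R (P ++ ys) → AllPairs R P × AllPairs R ys × (∀ {x y} → x ∈ P → y ∈ ys → R x y)
  ++-AllPairs⁻ []      rs       = [] , rs , λ ()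
  ++-AllPairs⁻ (x ∷ P) (r ∷ rs) =
    let P-rs , ys-rs , cross = ++-AllPairs⁻ P rs
    in All.tabulate (λ y∈ → All.lookup r (∈-++⁺ˡ y∈)) ∷ P-rs , ys-rs
       , λ { (here refl) y∈ → All.lookup r (∈-++⁺ʳ P y∈) ; (there x∈) y∈ → cross x∈ y∈ }

  concat-AllPairs⁻ : ∀ pss → AllPairs R (concat pss) →
    All (AllPairs R) pss × AllPairs (λ P Q → ∀ {x y} → x ∈ P → y ∈ Q → R x y) pss
  concat-AllPairs⁻ []         _  = [] , []
  concat-AllPairs⁻ (P ∷ pss) rs =
    let P-rs , rest , cross = ++-AllPairs⁻ P rs
        within , between = concat-AllPairs⁻ pss rest
    in P-rs ∷ within , All.tabulate (λ Q∈ x∈ y∈ → cross x∈ (∈-concat⁺′ y∈ Q∈)) ∷ between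

AllPairs-map-∈ : ∀ {A : Set} {R S : A → A → Set} {xs} → (∀ {x y} → x ∈ xs → y ∈ xs → R x y → S x y) → AllPairs R xs → AllPairs S xs
AllPairs-map-∈ f []       = []
AllPairs-map-∈ f (r ∷ rs) =
  All.tabulate (λ y∈ → f (here refl) (there y∈) (All.lookup r y∈)) ∷ AllPairs-map-∈ (λ x∈ y∈ → f (there x∈) (there y∈)) rs

-- Each entry of v contributes s vertices to `X′`, also where only a chain inside them is kept as a
-- piece. A further s vertices come from the base case and belong to no piece; they give `s≤X′` even
-- if v has no zeros. Bulk pieces are measured against `s` and parts of stacks against `u`, so the
-- constant C is 1 throughout the construction.
record Structure (T : Tournament) (X : List (Fin (size T))) (v : List Bool) (η : List ℕ) (L u M : ℕ) : Set₁ where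
  field
    s         : ℕ
    X′        : List (Fin (size T))
    X′-unique : Unique X′
    X′⊆X      : ∀ {x} → x ∈ X′ → x ∈ X
    X′≤       : length X′ ≤ suc (length v) * s
    s≤X′      : s ≤ length X′
    X≤        : length X ≤ L * s
    pieces    : List (Piece (Fin (size T)))
    pieces⊆X′ : ∀ {p x} → p ∈ pieces → x ∈ vertices p → x ∈ X′
    layout    : Layout T v η s u 1 M pieces

-- The new piece is taken from A and precedes those found in B. These may be much smaller than B, so
-- the sparseness of the pair says something about them only through the degrees of their vertices.
module Prepend (T : Tournament) (X : List (Fin (size T))) (v : List Bool) (η : List ℕ) (L₁ L₂ u M : ℕ) (1≤M : 1 ≤ M)
  (pair : SparsePair T X (M * suc (length v)) L₁)
  (rest : Structure T (SparsePair.B pair) v η L₂ u M) where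

  open SparsePair pair renaming (s to s₀; X≤ to X≤s₀; sparse to few-backward)
  open Structure rest renaming (X′ to X₂)
  open Layout layout

  private
    V = Fin (size T)
    m = length v
    back : V → Piece V → ℕ
    back x p = count (λ y → arc? T y x) (vertices p)

  Heavy : Piece V → V → Set
  Heavy p x = ¬ (M * back x p ≤ length (vertices p))

  heavy? : ∀ p x → Dec (Heavy p x)
  heavy? p x = ¬? (M * back x p ≤? length (vertices p))

  anyHeavy? : ∀ x → Dec (Any (λ p → Heavy p x) pieces)
  anyHeavy? x = any? (λ p → heavy? p x) pieces

  -- Double counting of the arcs from `p` to `A`: every vertex of `p` sends at most s₀/(M(m+1)) of
  -- them, and every heavy vertex receives more than |p|/M. The factor m+1 prepares for the union
  -- bound over the m pieces. Strictness in the definition of heavy gives `suc k`, which can be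
  -- cancelled even if the piece is empty.
  few-heavy : ∀ {p} → p ∈ pieces → suc m * count (heavy? p) A ≤ s₀
  few-heavy {p} p∈ = *-cancelˡ-≤ (suc k) (*-cancelˡ-≤ M {{>-nonZero 1≤M}} (begin
    M * (suc k * (suc m * h))                                   ≡⟨ shuffle M (suc k) (suc m) h ⟩
    M * suc m * (h * suc k)                                     ≤⟨ *-monoʳ-≤ (M * suc m) (markov (heavy? p) A (λ _ → ≰⇒>)) ⟩
    M * suc m * ∑ A (λ x → M * back x p)                        ≡⟨ cong (M * suc m *_) (∑-* M A _) ⟨
    M * suc m * (M * ∑ A (λ x → back x p))                      ≡⟨ cong (λ e → M * suc m * (M * e)) (pairs-swap (λ x y → arc? T y x) A S) ⟩
    M * suc m * (M * ∑ S (λ y → count (arc? T y) A))            ≡⟨ *-comm-mid (M * suc m) M _ ⟩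
    M * (M * suc m * ∑ S (λ y → count (arc? T y) A))            ≤⟨ *-monoʳ-≤ M (∑-≤ S {k = M * suc m} (λ y∈ → few-backward (X′⊆X (pieces⊆X′ p∈ y∈)))) ⟩
    M * (k * s₀)                                                ≤⟨ *-monoʳ-≤ M (*-monoˡ-≤ s₀ (n≤1+n k)) ⟩
    M * (suc k * s₀)                                            ∎))
    where
    open ≤-Reasoning
    S = vertices p
    k = length S
    h = count (heavy? p) A
    shuffle : ∀ a b c h → a * (b * (c * h)) ≡ a * c * (h * b)
    shuffle = solve-∀
    *-comm-mid : ∀ a b c → a * (b * c) ≡ b * (a * c)
    *-comm-mid = solve-∀

  light : List V
  light = filter (λ x → ¬? (anyHeavy? x)) A

  light-length : s₀ ≤ length light
  light-length = +-cancelˡ-≤ (count anyHeavy? A) s₀ (length light) (begin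
    count anyHeavy? A + s₀           ≤⟨ +-monoˡ-≤ s₀ any-heavy≤ ⟩
    s₀ + s₀                          ≡⟨ cong (s₀ +_) (+-identityʳ s₀) ⟨
    2 * s₀                           ≡⟨ A-length ⟨
    length A                         ≡⟨ count-split anyHeavy? A ⟨
    count anyHeavy? A + length light ∎)
    where
    open ≤-Reasoning
    any-heavy≤ : count anyHeavy? A ≤ s₀
    any-heavy≤ = *-cancelˡ-≤ (suc m) (begin
      suc m * count anyHeavy? A                         ≤⟨ *-monoʳ-≤ (suc m) (union-bound heavy? pieces A) ⟩
      suc m * ∑ pieces (λ p → count (heavy? p) A)       ≤⟨ ∑-≤ pieces {k = suc m} few-heavy ⟩
      length pieces * s₀                                ≡⟨ cong (_* s₀) (Shaped-length shaped) ⟩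
      m * s₀                                            ≤⟨ *-monoˡ-≤ s₀ (n≤1+n m) ⟩
      suc m * s₀                                        ∎)

  A′ : List V
  -- The cut is to the `s` of the structure inside `B`, not to s₀. Thus |X′| stays within a factor
  -- |v|+1 of `s`, whatever the ratio of s to s₀.
  A′ = take s light

  s≤s₀ : s ≤ s₀
  s≤s₀ = ≤-trans s≤X′ (≤-trans (length-⊆ X′-unique X′⊆X) (≤-reflexive B-length))

  A′-length : length A′ ≡ s
  A′-length = take-length s light (≤-trans s≤s₀ light-length)

  A′-unique : Unique A′
  A′-unique = Unique-take⁺ s (Unique-filter⁺ (λ x → ¬? (anyHeavy? x)) A-unique)

  A′⊆ : ∀ {x} → x ∈ A′ → x ∈ A × ¬ Any (λ p → Heavy p x) pieces
  A′⊆ x∈ = ∈-filter⁻ (λ x → ¬? (anyHeavy? x)) {xs = A} (∈-take s x∈)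

  A′⊆X : ∀ {x} → x ∈ A′ → x ∈ X
  A′⊆X x∈ = A⊆X (proj₁ (A′⊆ x∈))

  A′-X₂ : ∀ {x} → x ∈ A′ → x ∈ X₂ → ⊥
  A′-X₂ p q = disjoint (proj₁ (A′⊆ p)) (X′⊆X q)

  A′-light : ∀ {x p} → x ∈ A′ → p ∈ pieces → M * back x p ≤ length (vertices p)
  A′-light {x} {p} x∈ p∈ = ≮⇒≥ (λ gt → proj₂ (A′⊆ x∈) (lose p∈ (<⇒≱ gt)))

  X≤L₁L₂s : length X ≤ L₁ * L₂ * s
  X≤L₁L₂s = ≤-trans X≤s₀ (≤-trans (*-monoʳ-≤ L₁ (≤-trans (≤-reflexive (sym B-length)) X≤)) (≤-reflexive (sym (*-assoc L₁ L₂ s))))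

  -- Between `A′` and its complement the bad pairs are the arcs into `A′`; outside `A′` nothing
  -- changes. Inside `A′` there are none, which makes the new piece trivially sparse to itself, as a
  -- layout demands.
  Bad′ : V → V → Set
  Bad′ x y = (x ∈ A′ × ¬ (y ∈ A′) × Arc T y x) ⊎ (¬ (x ∈ A′) × y ∈ A′ × Arc T x y) ⊎ (¬ (x ∈ A′) × ¬ (y ∈ A′) × Bad x y)

  bad′? : ∀ x y → Dec (Bad′ x y)
  bad′? x y = (x∈ ×-dec ¬? y∈ ×-dec arc? T y x) ⊎-dec (¬? x∈ ×-dec y∈ ×-dec arc? T x y) ⊎-dec (¬? x∈ ×-dec ¬? y∈ ×-dec bad? x y)
    where
    x∈ = mem? Fin._≟_ x A′
    y∈ = mem? Fin._≟_ y A′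

  module _ {v′ η′} (p : Piece V) (p⊆A′ : ∀ {x} → x ∈ vertices p → x ∈ A′) (p-ok : PieceOK T s u 1 p)
    (p-forward : AllPairs (λ P Q → ∀ {x y} → x ∈ P → y ∈ Q → Arc T x y) (parts p))
    (shaped′ : Shaped v′ η′ (p ∷ pieces)) where

    private
      old : ∀ {q x} → q ∈ pieces → x ∈ vertices q → ¬ (x ∈ A′)
      old q∈ x∈ a = A′-X₂ a (pieces⊆X′ q∈ x∈)

      ok′ : ∀ {q} → q ∈ p ∷ pieces → PieceOK T s u 1 q
      ok′ (here refl) = p-ok
      ok′ (there q∈)  = ok q∈

      inside : ∀ {x y} → x ∈ A′ → y ∈ A′ → ¬ Bad′ x y
      inside x∈ y∈ (inj₁ (_ , y∉ , _))        = y∉ y∈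
      inside x∈ y∈ (inj₂ (inj₁ (x∉ , _)))     = x∉ x∈
      inside x∈ y∈ (inj₂ (inj₂ (x∉ , _)))     = x∉ x∈

      long⊆X₂ : ∀ {P x} → P ∈ concatMap parts pieces → x ∈ P → x ∈ X₂
      long⊆X₂ P∈ x∈ with ∈-concat⁻′ (map parts pieces) P∈
      ... | _ , P∈q , q∈ with ∈-map⁻ parts q∈
      ...   | q , q∈′ , refl = pieces⊆X′ q∈′ (∈-parts⇒∈-vertices q P∈q x∈)

      forward′ : AllPairs (λ P Q → ∀ {x y} → x ∈ P → y ∈ Q → x ≢ y × (¬ Bad′ x y → Arc T x y)) (concatMap parts (p ∷ pieces))
      forward′ = AllPairs.++⁺
        (AllPairs.map (λ a {x} {y} x∈ y∈ → (λ e → ¬arc-refl T e (a x∈ y∈)) , (λ _ → a x∈ y∈)) p-forward)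
        (AllPairs-map-∈ keep forward)
        (All.tabulate λ P∈ → All.tabulate λ Q∈ x∈ y∈ →
          new-old (p⊆A′ (∈-parts⇒∈-vertices p P∈ x∈)) (λ a → A′-X₂ a (long⊆X₂ Q∈ y∈)))
        where
        keep : ∀ {P Q} → P ∈ concatMap parts pieces → Q ∈ concatMap parts pieces →
          (∀ {x y} → x ∈ P → y ∈ Q → x ≢ y × (¬ Bad x y → Arc T x y)) →
          ∀ {x y} → x ∈ P → y ∈ Q → x ≢ y × (¬ Bad′ x y → Arc T x y)
        keep P∈ Q∈ f x∈ y∈ = proj₁ (f x∈ y∈) , λ ¬bad → proj₂ (f x∈ y∈) (λ b → ¬bad (inj₂ (inj₂
          ((λ a → A′-X₂ a (long⊆X₂ P∈ x∈)) , (λ a → A′-X₂ a (long⊆X₂ Q∈ y∈)) , b))))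
        new-old : ∀ {x y} → x ∈ A′ → ¬ (y ∈ A′) → x ≢ y × (¬ Bad′ x y → Arc T x y)
        new-old {x} {y} x∈ y∉ = x≢y , λ ¬bad → arc-total T (λ e → x≢y (sym e)) (¬-not (λ a → ¬bad (inj₁ (x∈ , y∉ , a))))
          where
          x≢y : x ≢ y
          x≢y e = y∉ (subst (_∈ A′) e x∈)

      bad′-sym : ∀ {x y} → Bad′ x y → Bad′ y x
      bad′-sym (inj₁ (a , b , c))        = inj₂ (inj₁ (b , a , c))
      bad′-sym (inj₂ (inj₁ (a , b , c))) = inj₁ (b , a , c)
      bad′-sym (inj₂ (inj₂ (a , b , c))) = inj₂ (inj₂ (b , a , bad-sym c))

      few-bad : ∀ {q x} → q ∈ p ∷ pieces → x ∈ A′ → M * count (bad′? x) (vertices q) ≤ length (vertices q)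
      few-bad {x = x} (here refl) x∈ = ≤-trans (≤-reflexive (trans (cong (M *_) (count-none (bad′? x) (vertices p) (λ y∈ → inside x∈ (p⊆A′ y∈))))
        (*-zeroʳ M))) z≤n
      few-bad {q} {x} (there q∈) x∈ = ≤-trans (*-monoʳ-≤ M (count-mono (bad′? x) (λ y → arc? T y x) (vertices q) (λ _ → toArc))) (A′-light x∈ q∈)
        where
        toArc : ∀ {y} → Bad′ x y → Arc T y x
        toArc (inj₁ (_ , _ , a))       = a
        toArc (inj₂ (inj₁ (x∉ , _)))   = ⊥-elim (x∉ x∈)
        toArc (inj₂ (inj₂ (x∉ , _)))   = ⊥-elim (x∉ x∈)

      sparse-new : ∀ {q} → q ∈ p ∷ pieces → M * pairs bad′? (vertices p) (vertices q) ≤ length (vertices p) * length (vertices q)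
      sparse-new q∈ = ∑-≤ (vertices p) {k = M} (λ x∈ → few-bad q∈ (p⊆A′ x∈))

      sparse′ : ∀ {q r} → q ∈ p ∷ pieces → r ∈ p ∷ pieces →
        M * pairs bad′? (vertices q) (vertices r) ≤ length (vertices q) * length (vertices r)
      sparse′ (here refl) r∈ = sparse-new r∈
      sparse′ {q} (there q∈) (here refl) = begin
        M * pairs bad′? (vertices q) (vertices p)                            ≡⟨ cong (M *_) (pairs-swap bad′? (vertices q) (vertices p)) ⟩
        M * ∑ (vertices p) (λ y → count (λ x → bad′? x y) (vertices q))      ≤⟨ *-monoʳ-≤ M (∑-mono (vertices p)
             (λ {y} _ → count-mono (λ x → bad′? x y) (bad′? y) (vertices q) (λ _ → bad′-sym))) ⟩
        M * pairs bad′? (vertices p) (vertices q)                            ≤⟨ sparse-new (there q∈) ⟩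
        length (vertices p) * length (vertices q)                            ≡⟨ *-comm (length (vertices p)) _ ⟩
        length (vertices q) * length (vertices p)                            ∎
        where open ≤-Reasoning
      sparse′ {q} {r} (there q∈) (there r∈) = ≤-trans (*-monoʳ-≤ M (∑-mono (vertices q) (λ {x} x∈ →
        count-mono (bad′? x) (bad? x) (vertices r) (λ y∈ → toBad (old q∈ x∈) (old r∈ y∈))))) (sparse q∈ r∈)
        where
        toBad : ∀ {x y} → ¬ (x ∈ A′) → ¬ (y ∈ A′) → Bad′ x y → Bad x y
        toBad x∉ y∉ (inj₁ (x∈ , _))            = ⊥-elim (x∉ x∈)
        toBad x∉ y∉ (inj₂ (inj₁ (_ , y∈ , _))) = ⊥-elim (y∉ y∈)
        toBad x∉ y∉ (inj₂ (inj₂ (_ , _ , b)))  = b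

    prepend : length v′ ≡ suc m → Structure T X v′ η′ (L₁ * L₂) u M
    prepend v′-length = record
      { s = s
      ; X′ = A′ ++ X₂
      ; X′-unique = Unique-++⁺ A′-unique X′-unique (λ (a , b) → A′-X₂ a b)
      ; X′⊆X = λ x∈ → Sum.[ A′⊆X , (λ x∈₂ → B⊆X (X′⊆X x∈₂)) ] (∈-++⁻ A′ x∈)
      ; X′≤ = begin
          length (A′ ++ X₂)         ≡⟨ length-++ A′ ⟩
          length A′ + length X₂     ≤⟨ +-mono-≤ (≤-reflexive A′-length) X′≤ ⟩
          s + suc m * s             ≡⟨ cong (λ k → suc k * s) v′-length ⟨
          suc (length v′) * s       ∎
      ; s≤X′ = ≤-trans s≤X′ (≤-trans (m≤n+m (length X₂) (length A′)) (≤-reflexive (sym (length-++ A′))))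
      ; X≤ = X≤L₁L₂s
      ; pieces = p ∷ pieces
      ; pieces⊆X′ = pieces⊆X′′
      ; layout = record { Bad = Bad′ ; bad? = bad′? ; bad-sym = bad′-sym ; shaped = shaped′ ; ok = ok′ ; forward = forward′ ; sparse = sparse′ }
      }
      where
      open ≤-Reasoning
      pieces⊆X′′ : ∀ {q x} → q ∈ p ∷ pieces → x ∈ vertices q → x ∈ A′ ++ X₂
      pieces⊆X′′ (here refl) x∈ = ∈-++⁺ˡ (p⊆A′ x∈)
      pieces⊆X′′ (there q∈)  x∈ = ∈-++⁺ʳ A′ (pieces⊆X′ q∈ x∈)

-- Criticality of `X` enters the construction through this interface alone: a subset with at least
-- |X|/L vertices contains a chain of length `z`.
Oracle : (T : Tournament) → List (Fin (size T)) → ℕ → ℕ → Set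
Oracle T X L z = ∀ Y → Unique Y → (∀ {x} → x ∈ Y → x ∈ X) → length X ≤ L * length Y →
  ∃[ U ] Chain T U × (∀ {x} → x ∈ U → x ∈ Y) × z ≤ length U

-- `L` is fixed before `T`, `X` and `u`: the exponent q is chosen from it, and only q makes the
-- oracle available. `R` bounds the entries of η, so that a chain of length Ru yields every required
-- number of parts of length u.
structure : (H : Tournament) (R M : ℕ) → 1 ≤ M → ∀ v η → length η ≡ Defs.count true v → All (_≤ R) η →
  ∃[ L ] (1 ≤ L × (∀ (T : Tournament) → ¬ ContainsT T H → ∀ X → Unique X → L ≤ length X → ∀ u →
    Oracle T X L (R * u) → Structure T X v η L u M))
structure H R M 1≤M [] [] _ _ = 1 , ≤-refl , λ T free X X-unique _ u _ → record
  { s = length X ; X′ = X ; X′-unique = X-unique ; X′⊆X = id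
  ; X′≤ = ≤-reflexive (sym (*-identityˡ (length X))) ; s≤X′ = ≤-refl ; X≤ = ≤-reflexive (sym (*-identityˡ (length X)))
  ; pieces = [] ; pieces⊆X′ = λ ()
  ; layout = record { Bad = λ _ _ → ⊥ ; bad? = λ _ _ → no id ; bad-sym = id ; shaped = [] ; ok = λ () ; forward = [] ; sparse = λ () } }
structure H R M 1≤M [] (_ ∷ _) () _
structure H R M 1≤M (b ∷ v) η len bounded = cases b η len bounded
  where
  m = length v
  Goal : List Bool → List ℕ → ℕ → Set₁
  Goal v η L = ∀ (T : Tournament) → ¬ ContainsT T H → ∀ X → Unique X → L ≤ length X → ∀ u →
    Oracle T X L (R * u) → Structure T X v η L u M
  L₁ = proj₁ (sparse-pair H (M * suc m) (*-mono-≤ 1≤M (s≤s z≤n)))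
  1≤L₁ = proj₁ (proj₂ (sparse-pair H (M * suc m) (*-mono-≤ 1≤M (s≤s z≤n))))
  find-pair = proj₂ (proj₂ (sparse-pair H (M * suc m) (*-mono-≤ 1≤M (s≤s z≤n))))

  module Step {η′ L₂} (1≤L₂ : 1 ≤ L₂) (build : Goal v η′ L₂)
    (T : Tournament) (free : ¬ ContainsT T H) (X : List (Fin (size T))) (X-unique : Unique X) (le : L₁ * L₂ ≤ length X)
    (u : ℕ) (oracle : Oracle T X (L₁ * L₂) (R * u)) where
    pair : SparsePair T X (M * suc m) L₁
    pair = find-pair T free X X-unique (≤-trans (m≤m*n L₁ L₂ {{>-nonZero 1≤L₂}}) le)
    open SparsePair pair renaming (X≤ to X≤s₀)
    rest : Structure T B v η′ L₂ u M
    rest = build T free B B-unique L₂≤B u λ Y Y-unique Y⊆B B≤ → oracle Y Y-unique (λ y∈ → B⊆X (Y⊆B y∈)) (begin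
      length X               ≤⟨ X≤s₀ ⟩
      L₁ * s                 ≡⟨ cong (L₁ *_) B-length ⟨
      L₁ * length B          ≤⟨ *-monoʳ-≤ L₁ B≤ ⟩
      L₁ * (L₂ * length Y)   ≡⟨ *-assoc L₁ L₂ (length Y) ⟨
      L₁ * L₂ * length Y     ∎)
      where
      open ≤-Reasoning
      L₂≤B : L₂ ≤ length B
      L₂≤B = *-cancelˡ-≤ L₁ {{>-nonZero 1≤L₁}} (≤-trans le (≤-trans X≤s₀ (≤-reflexive (cong (L₁ *_) (sym B-length)))))
    open Prepend T X v η′ L₁ L₂ u M 1≤M pair rest public

  cases : ∀ b η → length η ≡ Defs.count true (b ∷ v) → All (_≤ R) η → ∃[ L ] (1 ≤ L × Goal (b ∷ v) η L)
  cases false η len bounded =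
    let L₂ , 1≤L₂ , build = structure H R M 1≤M v η len bounded
    in  L₁ * L₂ , *-mono-≤ 1≤L₁ 1≤L₂ , λ T free X X-unique le u oracle →
        let open Step 1≤L₂ build T free X X-unique le u oracle
        in prepend (bulk A′) id (A′-unique , ≤-reflexive (sym (trans (*-identityˡ _) A′-length))) ([] ∷ [])
             (bulk (Layout.shaped (Structure.layout rest))) refl
  cases true (r ∷ η) len (r≤R ∷ bounded) =
    let L₂ , 1≤L₂ , build = structure H R M 1≤M v η (suc-injective len) bounded
    in  L₁ * L₂ , *-mono-≤ 1≤L₁ 1≤L₂ , λ T free X X-unique le u oracle →
        let open Step 1≤L₂ build T free X X-unique le u oracle
            -- The chain is taken from `A′`, so its vertices are light, and the degree bounds
            -- towards the later pieces hold for it although it may be far smaller than `A′`.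
            U , U-chain , U⊆ , Ru≤U = oracle A′ A′-unique A′⊆X (≤-trans X≤L₁L₂s (≤-reflexive (cong (L₁ * L₂ *_) (sym A′-length))))
            pss , pss-length , pss⊆U , pss-concat , lengths = chunks r u U (≤-trans (*-monoˡ-≤ u r≤R) Ru≤U)
            pss-chain = subst (Chain T) (sym pss-concat) (AllPairs.take⁺ (r * u) U-chain)
        in prepend (stack pss) (λ x∈ → U⊆ (pss⊆U x∈))
             (pss-chain , All.map (λ e → ≤-reflexive (sym (trans (*-identityˡ _) e))) lengths)
             (proj₂ (concat-AllPairs⁻ pss pss-chain)) (stack pss-length (Layout.shaped (Structure.layout rest))) refl

-- Scaling by unit fractions

ℕ→ℚᵘ : ∀ n → ℚ.toℚᵘ (ℕ→ℚ n) ℚᵘ.≃ mkℚᵘ (ℤ.+ n) 0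
ℕ→ℚᵘ n = ℚ.toℚᵘ-fromℚᵘ (mkℚᵘ (ℤ.+ n) 0)

ℕ→ℚ-mono : ∀ {a b} → a ℕ.≤ b → ℕ→ℚ a ℚ.≤ ℕ→ℚ b
ℕ→ℚ-mono {a} {b} le = ℚ.toℚᵘ-cancel-≤ (ℚᵘ.≤-respˡ-≃ (ℚᵘ.≃-sym (ℕ→ℚᵘ a)) (ℚᵘ.≤-respʳ-≃ (ℚᵘ.≃-sym (ℕ→ℚᵘ b))
  (ℚᵘ.*≤* (ℤ.*-monoʳ-≤-nonNeg (ℤ.+ 1) (ℤ.+≤+ le)))))

ℕ→ℚ-cancel : ∀ {a b} → ℕ→ℚ a ℚ.≤ ℕ→ℚ b → a ℕ.≤ b
ℕ→ℚ-cancel {a} {b} le with ℚᵘ.≤-respˡ-≃ (ℕ→ℚᵘ a) (ℚᵘ.≤-respʳ-≃ (ℕ→ℚᵘ b) (ℚ.toℚᵘ-mono-≤ le))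
... | ℚᵘ.*≤* p = ℤ.drop‿+≤+ (ℤ.*-cancelʳ-≤-pos (ℤ.+ a) (ℤ.+ b) (ℤ.+ 1) p)

ℕ→ℚ-+ : ∀ a b → ℕ→ℚ (a ℕ.+ b) ≡ ℕ→ℚ a ℚ.+ ℕ→ℚ b
ℕ→ℚ-+ a b = ℚ.toℚᵘ-injective (begin
  ℚ.toℚᵘ (ℕ→ℚ (a ℕ.+ b))                 ≈⟨ ℕ→ℚᵘ (a ℕ.+ b) ⟩
  mkℚᵘ (ℤ.+ (a ℕ.+ b)) 0                   ≈⟨ ℚᵘ.*≡* (cong (ℤ._* (ℤ.+ 1)) (trans (ℤ.pos-+ a b) (cong₂ ℤ._+_ (sym (ℤ.*-identityʳ (ℤ.+ a))) (sym (ℤ.*-identityʳ (ℤ.+ b)))))) ⟩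
  mkℚᵘ (ℤ.+ a) 0 ℚᵘ.+ mkℚᵘ (ℤ.+ b) 0         ≈⟨ ℚᵘ.+-cong (ℕ→ℚᵘ a) (ℕ→ℚᵘ b) ⟨
  ℚ.toℚᵘ (ℕ→ℚ a) ℚᵘ.+ ℚ.toℚᵘ (ℕ→ℚ b)     ≈⟨ ℚ.toℚᵘ-homo-+ (ℕ→ℚ a) (ℕ→ℚ b) ⟨
  ℚ.toℚᵘ (ℕ→ℚ a ℚ.+ ℕ→ℚ b)               ∎)
  where open ℚᵘ.≃-Reasoning

unit : ℕ → ℚ
unit k = ℤ.+ 1 ℚ./ suc k

unit-* : ∀ k b → unit k ℚ.* ℕ→ℚ (suc k ℕ.* b) ≡ ℕ→ℚ b
unit-* k b = ℚ.toℚᵘ-injective (begin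
  ℚ.toℚᵘ (unit k ℚ.* ℕ→ℚ (suc k ℕ.* b))              ≈⟨ ℚ.toℚᵘ-homo-* (unit k) _ ⟩
  ℚ.toℚᵘ (unit k) ℚᵘ.* ℚ.toℚᵘ (ℕ→ℚ (suc k ℕ.* b))    ≈⟨ ℚᵘ.*-cong (ℚ.toℚᵘ-fromℚᵘ (mkℚᵘ (ℤ.+ 1) k)) (ℕ→ℚᵘ (suc k ℕ.* b)) ⟩
  mkℚᵘ (ℤ.+ 1) k ℚᵘ.* mkℚᵘ (ℤ.+ (suc k ℕ.* b)) 0         ≈⟨ ℚᵘ.*≡* cross ⟩
  mkℚᵘ (ℤ.+ b) 0                                       ≈⟨ ℕ→ℚᵘ b ⟨
  ℚ.toℚᵘ (ℕ→ℚ b)                                     ∎)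
  where
  open ℚᵘ.≃-Reasoning
  cross : (ℤ.+ 1 ℤ.* ℤ.+ (suc k ℕ.* b)) ℤ.* ℤ.+ 1 ≡ ℤ.+ b ℤ.* ℤ.+ suc (k ℕ.* 1)
  cross = trans (ℤ.*-identityʳ _) (trans (ℤ.*-identityˡ _) (trans (cong ℤ.+_ (ℕ.*-comm (suc k) b))
    (trans (ℤ.pos-* b (suc k)) (cong (λ z → ℤ.+ b ℤ.* ℤ.+ suc z) (sym (ℕ.*-identityʳ k))))))

unit-nonNegative : ∀ k → ℚ.NonNegative (unit k)
unit-nonNegative k = ℚ.normalize-nonNeg 1 (suc k)

unit-≤ : ∀ {k a b} → a ℕ.≤ suc k ℕ.* b → unit k ℚ.* ℕ→ℚ a ℚ.≤ ℕ→ℚ b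
unit-≤ {k} {a} {b} le = ℚ.≤-trans (ℚ.*-monoˡ-≤-nonNeg (unit k) {{unit-nonNegative k}} (ℕ→ℚ-mono le)) (ℚ.≤-reflexive (unit-* k b))

unit-≥ : ∀ {k a b} → suc k ℕ.* b ℕ.≤ a → ℕ→ℚ b ℚ.≤ unit k ℚ.* ℕ→ℚ a
unit-≥ {k} {a} {b} le = ℚ.≤-trans (ℚ.≤-reflexive (sym (unit-* k b))) (ℚ.*-monoˡ-≤-nonNeg (unit k) {{unit-nonNegative k}} (ℕ→ℚ-mono le))

0<unit : ∀ k → 0ℚ ℚ.< unit k
0<unit k = ℚ.positive⁻¹ (unit k) {{ℚ.normalize-pos 1 (suc k)}}

-- A positive fraction is at least the reciprocal of its own denominator.
unit-archimedean : ∀ c → 0ℚ ℚ.< c → ∃[ k ] unit k ℚ.≤ c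
unit-archimedean (mkℚ +[1+ n ] d cop) _ = d , ℚ.toℚᵘ-cancel-≤ (ℚᵘ.≤-respˡ-≃ (ℚᵘ.≃-sym (ℚ.toℚᵘ-fromℚᵘ (mkℚᵘ (ℤ.+ 1) d)))
  (ℚᵘ.*≤* (ℤ.*-monoʳ-≤-nonNeg (ℤ.+ suc d) {ℤ.+ 1} {+[1+ n ]} (ℤ.+≤+ (ℕ.s≤s ℕ.z≤n)))))
unit-archimedean (mkℚ (ℤ.+ 0) d cop) (ℚ.*<* (ℤ.+<+ ()))
unit-archimedean (mkℚ -[1+ n ] d cop) (ℚ.*<* ())

unit-antitone : ∀ {j k} → j ℕ.≤ k → unit k ℚ.≤ unit j
unit-antitone {j} {k} le = ℚ.toℚᵘ-cancel-≤ (ℚᵘ.≤-respˡ-≃ (ℚᵘ.≃-sym (ℚ.toℚᵘ-fromℚᵘ (mkℚᵘ (ℤ.+ 1) k)))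
  (ℚᵘ.≤-respʳ-≃ (ℚᵘ.≃-sym (ℚ.toℚᵘ-fromℚᵘ (mkℚᵘ (ℤ.+ 1) j))) (ℚᵘ.*≤* (ℤ.*-monoˡ-≤-nonNeg (ℤ.+ 1) (ℤ.+≤+ (ℕ.s≤s le))))))

unit<1 : ∀ k → unit (suc k) ℚ.< 1ℚ
unit<1 k = ℚ.≤-<-trans (unit-antitone {1} {suc k} (ℕ.s≤s ℕ.z≤n)) (ℚ.*<* (ℤ.+<+ (ℕ.s≤s (ℕ.s≤s ℕ.z≤n))))

≤-from-scaled : ∀ {c k a b} → unit k ℚ.≤ c → c ℚ.* ℕ→ℚ a ℚ.≤ ℕ→ℚ b → a ℕ.≤ suc k ℕ.* b
≤-from-scaled {c} {k} {a} {b} uc le = ℕ→ℚ-cancel (begin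
  ℕ→ℚ a                                 ≡⟨ unit-* k a ⟨
  unit k ℚ.* ℕ→ℚ (suc k ℕ.* a)          ≡⟨ cong (unit k ℚ.*_) (ℕ→ℚ-* (suc k) a) ⟩
  unit k ℚ.* (ℕ→ℚ (suc k) ℚ.* ℕ→ℚ a)    ≡⟨ x∙yz≈y∙xz (unit k) (ℕ→ℚ (suc k)) (ℕ→ℚ a) ⟩
  ℕ→ℚ (suc k) ℚ.* (unit k ℚ.* ℕ→ℚ a)    ≤⟨ ℚ.*-monoˡ-≤-nonNeg (ℕ→ℚ (suc k)) {{nn (suc k)}} (ℚ.≤-trans (ℚ.*-monoʳ-≤-nonNeg (ℕ→ℚ a) {{nn a}} uc) le) ⟩
  ℕ→ℚ (suc k) ℚ.* ℕ→ℚ b                 ≡⟨ ℕ→ℚ-* (suc k) b ⟨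
  ℕ→ℚ (suc k ℕ.* b)                     ∎)
  where
  open ℚ.≤-Reasoning
  x∙yz≈y∙xz : ∀ x y z → x ℚ.* (y ℚ.* z) ≡ y ℚ.* (x ℚ.* z)
  x∙yz≈y∙xz x y z = trans (sym (ℚ.*-assoc x y z)) (trans (cong (ℚ._* z) (ℚ.*-comm x y)) (ℚ.*-assoc y x z))
  nn : ∀ n → ℚ.NonNegative (ℕ→ℚ n)
  nn n = ℚ.normalize-nonNeg n 1
  ℕ→ℚ-* : ∀ a b → ℕ→ℚ (a ℕ.* b) ≡ ℕ→ℚ a ℚ.* ℕ→ℚ b
  ℕ→ℚ-* a b = ℚ.toℚᵘ-injective (ℚᵘ.≃-trans (ℕ→ℚᵘ (a ℕ.* b)) (ℚᵘ.≃-trans (ℚᵘ.*≡* (cong (ℤ._* (ℤ.+ 1)) (ℤ.pos-* a b)))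
    (ℚᵘ.≃-trans (ℚᵘ.≃-sym (ℚᵘ.*-cong (ℕ→ℚᵘ a) (ℕ→ℚᵘ b))) (ℚᵘ.≃-sym (ℚ.toℚᵘ-homo-* (ℕ→ℚ a) (ℕ→ℚ b))))))

-- With `b` bad pairs among `N`: e ≥ N - b ≥ N - N/(k+1).
density-bound : ∀ {k N e b} → N ℕ.≤ e ℕ.+ b → suc k ℕ.* b ℕ.≤ N → (1ℚ ℚ.- unit k) ℚ.* ℕ→ℚ N ℚ.≤ ℕ→ℚ e
density-bound {k} {N} {e} {b} N≤ kb≤N = begin
  (1ℚ ℚ.- unit k) ℚ.* n               ≡⟨ ℚ.*-distribʳ-+ n 1ℚ (ℚ.- unit k) ⟩
  1ℚ ℚ.* n ℚ.+ (ℚ.- unit k) ℚ.* n     ≡⟨ cong₂ ℚ._+_ (ℚ.*-identityˡ n) (sym (ℚ.neg-distribˡ-* (unit k) n)) ⟩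
  n ℚ.- un                            ≤⟨ ℚ.+-monoˡ-≤ (ℚ.- un) (ℚ.≤-trans (ℕ→ℚ-mono N≤) (ℚ.≤-reflexive (ℕ→ℚ-+ e b))) ⟩
  ℕ→ℚ e ℚ.+ ℕ→ℚ b ℚ.- un              ≤⟨ ℚ.+-monoˡ-≤ (ℚ.- un) (ℚ.+-monoʳ-≤ (ℕ→ℚ e) (unit-≥ {k} kb≤N)) ⟩
  ℕ→ℚ e ℚ.+ un ℚ.- un                 ≡⟨ ℚ.+-assoc (ℕ→ℚ e) un (ℚ.- un) ⟩
  ℕ→ℚ e ℚ.+ (un ℚ.- un)               ≡⟨ cong (ℕ→ℚ e ℚ.+_) (ℚ.+-inverseʳ un) ⟩
  ℕ→ℚ e ℚ.+ 0ℚ                        ≡⟨ ℚ.+-identityʳ (ℕ→ℚ e) ⟩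
  ℕ→ℚ e                               ∎
  where
  open ℚ.≤-Reasoning
  n = ℕ→ℚ N
  un = unit k ℚ.* n

-- Lists as subsets

toSubset : ∀ {n} → List (Fin n) → Subset n
toSubset xs = ⋃ (map ⁅_⁆ xs)

∈-toSubset⁺ : ∀ {n} {xs : List (Fin n)} {x} → x ∈ xs → x ∈ₛ toSubset xs
∈-toSubset⁺ {x = x} (here refl) = x∈p∪q⁺ (inj₁ (x∈⁅x⁆ x))
∈-toSubset⁺ (there x∈)          = x∈p∪q⁺ (inj₂ (∈-toSubset⁺ x∈))

∈-toSubset⁻ : ∀ {n} (xs : List (Fin n)) {x} → x ∈ₛ toSubset xs → x ∈ xs
∈-toSubset⁻ []       x∈ = ⊥-elim (∉⊥ x∈)
∈-toSubset⁻ (y ∷ xs) x∈ = Sum.[ (λ p → here (x∈⁅y⁆⇒x≡y y p)) , (λ p → there (∈-toSubset⁻ xs p)) ] (x∈p∪q⁻ ⁅ y ⁆ (toSubset xs) x∈)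

toSubset-++ : ∀ {n} (xs ys : List (Fin n)) → toSubset (xs ++ ys) ≡ toSubset xs ∪ toSubset ys
toSubset-++ []       ys = sym (∪-identityˡ _)
toSubset-++ (x ∷ xs) ys = trans (cong (⁅ x ⁆ ∪_) (toSubset-++ xs ys)) (sym (∪-assoc ⁅ x ⁆ (toSubset xs) (toSubset ys)))

toSubset-concat : ∀ {n} (xss : List (List (Fin n))) → toSubset (concat xss) ≡ ⋃ (map toSubset xss)
toSubset-concat []         = refl
toSubset-concat (xs ∷ xss) = trans (toSubset-++ xs (concat xss)) (cong (toSubset xs ∪_) (toSubset-concat xss))

inside? : ∀ {n} (S : Subset n) (x : Fin n) → Dec (Vec.lookup S x ≡ true)
inside? S x = Vec.lookup S x Bool.≟ true

elements : ∀ {n} → Subset n → List (Fin n)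
elements {n} S = filter (inside? S) (allFin n)

∈-elements⁺ : ∀ {n} {S : Subset n} {x} → x ∈ₛ S → x ∈ elements S
∈-elements⁺ {S = S} {x} x∈ = ∈-filter⁺ (inside? S) (∈-allFin x) ([]=⇒lookup x∈)

∈-elements⁻ : ∀ {n} {S : Subset n} {x} → x ∈ elements S → x ∈ₛ S
∈-elements⁻ {n} {S} {x} x∈ = lookup⇒[]= x S (proj₂ (∈-filter⁻ (inside? S) {xs = allFin n} x∈))

elements-unique : ∀ {n} (S : Subset n) → Unique (elements S)
elements-unique {n} S = Unique-filter⁺ (inside? S) (Unique-allFin n)

count-map : ∀ {A B : Set} {P : B → Set} (P? : Decidable P) (f : A → B) xs → count P? (map f xs) ≡ count (λ x → P? (f x)) xs
count-map P? f []       = refl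
count-map P? f (x ∷ xs) with does (P? (f x))
... | true  = cong suc (count-map P? f xs)
... | false = count-map P? f xs

∣∣≡length-elements : ∀ {n} (S : Subset n) → ∣ S ∣ ≡ length (elements S)
∣∣≡length-elements Vec.[] = refl
∣∣≡length-elements {suc n} (b Vec.∷ S) = add b (trans (∣∣≡length-elements S) (sym (trans (cong (count (inside? (b Vec.∷ S))) (sym (map-tabulate id Fin.suc)))
  (count-map (inside? (b Vec.∷ S)) Fin.suc (allFin n)))))
  where
  add : ∀ b → ∣ S ∣ ≡ count (inside? (b Vec.∷ S)) (tabulate Fin.suc) → ∣ b Vec.∷ S ∣ ≡ length (elements (b Vec.∷ S))
  add true  e = cong suc e
  add false e = e

∑-⊆⊇ : ∀ {A : Set} {xs ys : List A} (f : A → ℕ) → Unique xs → Unique ys → (∀ {x} → x ∈ xs → x ∈ ys) → (∀ {x} → x ∈ ys → x ∈ xs) →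
  ∑ xs f ≡ ∑ ys f
∑-⊆⊇ f u v p q = ≤-antisym (∑-⊆ f u p) (∑-⊆ f v q)

∑-elements : ∀ {n} {xs : List (Fin n)} (f : Fin n → ℕ) → Unique xs → ∑ (elements (toSubset xs)) f ≡ ∑ xs f
∑-elements {xs = xs} f u = ∑-⊆⊇ f (elements-unique (toSubset xs)) u (∈-toSubset⁻ xs ∘ ∈-elements⁻) (∈-elements⁺ ∘ ∈-toSubset⁺)

∣toSubset∣ : ∀ {n} {xs : List (Fin n)} → Unique xs → ∣ toSubset xs ∣ ≡ length xs
∣toSubset∣ {xs = xs} u = trans (∣∣≡length-elements (toSubset xs)) (trans (sym (length-∑ (elements (toSubset xs)))) (trans (∑-elements (λ _ → 1) u) (length-∑ xs)))

module _ (T : Tournament) where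
  private
    V = Fin (size T)
    n = size T

  edges-elements : ∀ X Y → edges T X Y ≡ pairs (arc? T) (elements X) (elements Y)
  edges-elements X Y = sym (begin
    ∑ (elements X) (λ x → count (arc? T x) (elements Y))                                     ≡⟨ ∑-filter (inside? X) (allFin n) _ ⟩
    ∑ (allFin n) (λ x → if does (inside? X x) then count (arc? T x) (elements Y) else 0)     ≡⟨ ∑-cong (allFin n) (λ {x} _ → row x) ⟩
    edges T X Y                                                                         ∎)
    where
    open ≡-Reasoning
    cell : ∀ b c → (if does (b Bool.≟ true) then 𝟙 (c Bool.≟ true) else 0) ≡ (if b ∧ c then 1 else 0)
    cell true  true  = refl
    cell true  false = refl
    cell false c     = refl
    row : ∀ x → (if does (inside? X x) then count (arc? T x) (elements Y) else 0)
      ≡ ∑ (allFin n) (λ y → if Vec.lookup X x ∧ Vec.lookup Y y ∧ adj T x y then 1 else 0)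
    row x with Vec.lookup X x
    ... | false = sym (trans (∑-const (allFin n) 0) (*-zeroʳ (length (allFin n))))
    ... | true  = trans (count-∑ (arc? T x) (elements Y)) (trans (∑-filter (inside? Y) (allFin n) _)
                    (∑-cong (allFin n) (λ {y} _ → cell (Vec.lookup Y y) (adj T x y))))

  edges-toSubset : ∀ {xs ys} → Unique xs → Unique ys → edges T (toSubset xs) (toSubset ys) ≡ pairs (arc? T) xs ys
  edges-toSubset {xs} {ys} u v = begin
    edges T (toSubset xs) (toSubset ys)                                        ≡⟨ edges-elements (toSubset xs) (toSubset ys) ⟩
    pairs (arc? T) (elements (toSubset xs)) (elements (toSubset ys))                ≡⟨ ∑-elements _ u ⟩
    ∑ xs (λ x → count (arc? T x) (elements (toSubset ys)))                          ≡⟨ ∑-cong xs (λ {x} _ → row x) ⟩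
    pairs (arc? T) xs ys                                                            ∎
    where
    open ≡-Reasoning
    row : ∀ x → count (arc? T x) (elements (toSubset ys)) ≡ count (arc? T x) ys
    row x = trans (count-∑ (arc? T x) (elements (toSubset ys))) (trans (∑-elements _ v) (sym (count-∑ (arc? T x) ys)))

  -- Every vertex of a cycle has a predecessor on it, whereas the first vertex of a chain has none in the chain.
  Chain-noPredecessors : ∀ {xs} → Chain T xs → ∀ C {c} → c ∈ C → (∀ {z} → z ∈ C → z ∈ xs) →
    (∀ {z} → z ∈ C → ∃[ w ] w ∈ C × Arc T w z) → ⊥
  Chain-noPredecessors []           C c∈ C⊆ pred with C⊆ c∈
  ... | ()
  Chain-noPredecessors {x ∷ xs} (x→ ∷ ch) C c∈ C⊆ pred = Chain-noPredecessors ch C c∈ (λ z∈ → later z∈ (C⊆ z∈)) pred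
    where
    later : ∀ {z} → z ∈ C → z ∈ x ∷ xs → z ∈ xs
    later z∈ (there p) = p
    later z∈ (here refl) with pred z∈
    ... | w , w∈ , w→z with C⊆ w∈
    ...   | here refl = ⊥-elim (¬arc-refl T refl w→z)
    ...   | there w∈xs with trans (sym (All.lookup x→ w∈xs)) (arc-asym T w→z)
    ...     | ()

  Linked-predecessor : ∀ x ys {z} → Linked (Arc T) (x ∷ ys) → z ∈ ys → ∃[ w ] w ∈ x ∷ ys × Arc T w z
  Linked-predecessor x (y ∷ ys) (a ∷ l) (here refl) = x , here refl , a
  Linked-predecessor x (y ∷ ys) (a ∷ l) (there z∈)  =
    let w , w∈ , b = Linked-predecessor y ys l z∈ in w , there w∈ , b

  Chain⇒Transitive : ∀ {xs} → Chain T xs → ∀ {S} → (∀ {x} → x ∈ₛ S → x ∈ xs) → Transitive T S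
  Chain⇒Transitive ch S⊆ (x , ys , inS , l) =
    Chain-noPredecessors ch (x ∷ ys ++ x ∷ []) (here refl) (λ z∈ → S⊆ (All.lookup inS (close z∈)))
      (λ z∈ → Linked-predecessor x (ys ++ x ∷ []) l (reenter z∈))
    where
    close : ∀ {z} → z ∈ x ∷ ys ++ x ∷ [] → z ∈ x ∷ ys
    close (here p)   = here p
    close (there z∈) = Sum.[ there , (λ { (here p) → here p }) ] (∈-++⁻ ys z∈)
    reenter : ∀ {z} → z ∈ x ∷ ys ++ x ∷ [] → z ∈ ys ++ x ∷ []
    reenter (here refl) = ∈-++⁺ʳ ys (here refl)
    reenter (there z∈)  = z∈

  -- One step of insertion sort. If x has an arc to the first vertex y, it has one to every later z,
  -- for otherwise x, y, z would form a cyclic triangle.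
  insert : ∀ {S} → Transitive T S → ∀ x ys → x ∈ₛ S → (∀ {y} → y ∈ ys → y ∈ₛ S) → ¬ (x ∈ ys) → Chain T ys →
    ∃[ zs ] Chain T zs × (∀ {z} → z ∈ zs → z ∈ x ∷ ys) × length zs ≡ suc (length ys)
  insert tr x [] x∈ ys⊆ x∉ _ = x ∷ [] , [] ∷ [] , id , refl
  insert {S} tr x (y ∷ ys) x∈ ys⊆ x∉ (y→ ∷ ch) = place (adj T x y) refl
    where
    place : ∀ b → adj T x y ≡ b → ∃[ zs ] Chain T zs × (∀ {z} → z ∈ zs → z ∈ x ∷ y ∷ ys) × length zs ≡ suc (suc (length ys))
    place true x→y = x ∷ y ∷ ys , (x→y ∷ All.tabulate x→z) ∷ y→ ∷ ch , id , refl
      where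
      x→z : ∀ {z} → z ∈ ys → Arc T x z
      x→z {z} z∈ = Bool-elim (adj T x z) refl
        where
        Bool-elim : ∀ b → adj T x z ≡ b → Arc T x z
        Bool-elim true  e = e
        Bool-elim false e = ⊥-elim (tr (x , y ∷ z ∷ [] , x∈ ∷ ys⊆ (here refl) ∷ ys⊆ (there z∈) ∷ [] ,
          x→y ∷ All.lookup y→ z∈ ∷ arc-total T (λ { refl → x∉ (there z∈) }) e ∷ [-]))
    place false e =
      let zs , ch′ , sub , len = insert tr x ys x∈ (λ p → ys⊆ (there p)) (λ p → x∉ (there p)) ch
          y→x = arc-total T (λ { refl → x∉ (here refl) }) e
          reorder : ∀ {z} → z ∈ x ∷ ys → z ∈ x ∷ y ∷ ys
          reorder = λ { (here p) → here p ; (there p) → there (there p) }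
      in y ∷ zs , All.tabulate (λ z∈ → All.lookup (y→x ∷ y→) (sub z∈)) ∷ ch′
         , (λ { (here p) → there (here p) ; (there p) → reorder (sub p) }) , cong suc len

  Transitive⇒Chain : ∀ {S} → Transitive T S → ∃[ zs ] Chain T zs × (∀ {z} → z ∈ zs → z ∈ₛ S) × length zs ≡ ∣ S ∣
  Transitive⇒Chain {S} tr =
    let zs , ch , sub , len = sort (elements S) (elements-unique S) ∈-elements⁻
    in zs , ch , (λ z∈ → ∈-elements⁻ (sub z∈)) , trans len (sym (∣∣≡length-elements S))
    where
    sort : ∀ xs → Unique xs → (∀ {x} → x ∈ xs → x ∈ₛ S) → ∃[ zs ] Chain T zs × (∀ {z} → z ∈ zs → z ∈ xs) × length zs ≡ length xs
    sort [] _ _ = [] , [] , id , refl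
    sort (x ∷ xs) (x∉ ∷ u) xs⊆ =
      let ys , ch , sub , len = sort xs u (λ p → xs⊆ (there p))
          zs , ch′ , sub′ , len′ = insert tr x ys (xs⊆ (here refl)) (λ y∈ → xs⊆ (there (sub y∈))) (λ x∈ → All.lookup x∉ (sub x∈) refl) ch
          up : ∀ {z} → z ∈ x ∷ ys → z ∈ x ∷ xs
          up = λ { (here p) → here p ; (there p) → there (sub p) }
      in zs , ch′ , (λ z∈ → up (sub′ z∈)) , trans len′ (cong suc len)

  Chain⇒Unique : ∀ {xs} → Chain T xs → Unique xs
  Chain⇒Unique = AllPairs.map (λ a e → ¬arc-refl T e a)

-- From layouts to m-sequences

toBlock : ∀ {n} → Piece (Fin n) → Block n
toBlock (bulk xs)   = Defs.dense (toSubset xs)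
toBlock (stack pss) = Defs.trans (map toSubset pss)

blockSet-toBlock : ∀ {n} (p : Piece (Fin n)) → blockSet (toBlock p) ≡ toSubset (vertices p)
blockSet-toBlock (bulk xs)   = refl
blockSet-toBlock (stack pss) = sym (toSubset-concat pss)

long-toBlock : ∀ {n} (ps : List (Piece (Fin n))) → long (map toBlock ps) ≡ map toSubset (concatMap parts ps)
long-toBlock []               = refl
long-toBlock (bulk xs ∷ ps)   = cong (toSubset xs ∷_) (long-toBlock ps)
long-toBlock (stack pss ∷ ps) = trans (cong (map toSubset pss ++_) (long-toBlock ps)) (sym (map-++ toSubset pss (concatMap parts ps)))

Shaped⇒Shape : ∀ {n v η} {ps : List (Piece (Fin n))} → Shaped v η ps → Shape v η (map toBlock ps)
Shaped⇒Shape []              = tt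
Shaped⇒Shape (bulk sh)       = Shaped⇒Shape sh
Shaped⇒Shape (stack {pss = pss} len sh) = trans (length-map toSubset pss) len , Shaped⇒Shape sh

pairs-split : ∀ {A B : Set} {R : A → B → Set} (R? : ∀ x y → Dec (R x y)) xs ys →
  pairs R? xs ys + pairs (λ x y → ¬? (R? x y)) xs ys ≡ length xs * length ys
pairs-split R? xs ys = trans (sym (∑-+ xs _ _)) (trans (∑-cong xs (λ {x} _ → count-split (R? x) ys)) (∑-const xs (length ys)))

part-of-vertex : ∀ {V} (p : Piece V) {x} → x ∈ vertices p → ∃[ P ] x ∈ P × P ∈ parts p
part-of-vertex (bulk xs)   x∈ = xs , x∈ , here refl
part-of-vertex (stack pss) x∈ = ∈-concat⁻′ pss x∈

1≤⇒∃∈ : ∀ {A : Set} {xs : List A} → 1 ≤ length xs → ∃[ x ] x ∈ xs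
1≤⇒∃∈ {xs = x ∷ xs} _ = x , here refl

1≤C*⇒1≤ : ∀ {n C k} → 1 ≤ n → n ≤ C * k → 1 ≤ k
1≤C*⇒1≤ {n} {C} {zero}  1≤n le = ⊥-elim (<-irrefl refl (≤-trans 1≤n (≤-trans le (≤-reflexive (*-zeroʳ C)))))
1≤C*⇒1≤ {n} {C} {suc k} _   _  = s≤s z≤n

-- `τ` is an upper bound for tr(T), so being large relative to `τ` implies being large relative to
-- tr(T). This lets an induced subtournament inherit the bound of the whole tournament.
module ToMSeq (T : Tournament) (v : List Bool) (η : List ℕ) (τ c k : ℕ) (ps : List (Piece (Fin (size T))))
  (1≤n : 1 ≤ size T) (1≤τ : 1 ≤ τ) (τ-max : ∀ {U} → Chain T U → length U ≤ τ)
  (layout : Layout T v η (size T) τ (suc c) (suc k) ps) where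

  open Layout layout
  private V = Fin (size T)

  vertices-unique : ∀ p → PieceOK T (size T) τ (suc c) p → Unique (vertices p)
  vertices-unique (bulk xs)   (u , _)  = u
  vertices-unique (stack pss) (ch , _) = Chain⇒Unique T ch

  part-nonempty : ∀ p → PieceOK T (size T) τ (suc c) p → ∀ {P} → P ∈ parts p → Nonempty (toSubset P)
  part-nonempty (bulk xs) (_ , le) (here refl) =
    let x , x∈ = 1≤⇒∃∈ {xs = xs} (1≤C*⇒1≤ {C = suc c} 1≤n le) in x , ∈-toSubset⁺ {xs = xs} x∈
  part-nonempty (stack pss) (_ , les) {P} P∈ =
    let x , x∈ = 1≤⇒∃∈ {xs = P} (1≤C*⇒1≤ {C = suc c} 1≤τ (All.lookup les P∈)) in x , ∈-toSubset⁺ {xs = P} x∈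

  all-nonempty : All Nonempty (map toSubset (concatMap parts ps))
  all-nonempty = All.map⁺ (All.tabulate λ P∈ →
    let Ps , P∈Ps , Ps∈ = ∈-concat⁻′ (map parts ps) P∈
        p , p∈ , eq = ∈-map⁻ parts Ps∈
    in part-nonempty p (ok p∈) (subst (_ ∈_) eq P∈Ps))

  all-disjoint : AllPairs (Disjoint T) (map toSubset (concatMap parts ps))
  all-disjoint = AllPairs.map⁺ (AllPairs.map (λ {P} {Q} f → λ (x , x∈) →
    let x∈P , x∈Q = x∈p∩q⁻ (toSubset P) (toSubset Q) x∈
    in proj₁ (f (∈-toSubset⁻ P x∈P) (∈-toSubset⁻ Q x∈Q)) refl) forward)

  piece-ok : ∀ p → PieceOK T (size T) τ (suc c) p → BlockOK T (unit c) (toBlock p)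
  piece-ok (bulk xs) (u , le) = unit-≤ {c} (≤-trans le (≤-reflexive (cong (suc c *_) (sym (∣toSubset∣ u)))))
  piece-ok (stack pss) (ch , les) =
      Chain⇒Transitive T ch (λ x∈ → ∈-toSubset⁻ (concat pss) (subst (_ ∈ₛ_) (sym (toSubset-concat pss)) x∈))
    , AllPairs.map⁺ (AllPairs.map (λ {P} {Q} f x y x∈ y∈ → f (∈-toSubset⁻ P x∈) (∈-toSubset⁻ Q y∈)) (proj₂ (concat-AllPairs⁻ pss ch)))
    , All.map⁺ (All.tabulate large)
    where
    large : ∀ {P} → P ∈ pss → AtLeastTr T (unit c) (toSubset P)
    large {P} P∈ S S-tr =
      let zs , zs-chain , _ , len = Transitive⇒Chain T S-tr
      in unit-≤ {c} (begin
           ∣ S ∣                       ≡⟨ len ⟨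
           length zs                   ≤⟨ τ-max zs-chain ⟩
           τ                           ≤⟨ All.lookup les P∈ ⟩
           suc c * length P            ≡⟨ cong (suc c *_) (∣toSubset∣ (Chain⇒Unique T (All.lookup (proj₁ (concat-AllPairs⁻ pss ch)) P∈))) ⟨
           suc c * ∣ toSubset P ∣      ∎)
      where open ≤-Reasoning

  Forward : Piece V → Piece V → Set
  Forward p q = ∀ {x y} → x ∈ vertices p → y ∈ vertices q → x ≢ y × (¬ Bad x y → Arc T x y)

  pieces-forward : AllPairs Forward ps
  pieces-forward = AllPairs.map (λ {p} {q} f {x} {y} x∈ y∈ →
    let P , x∈P , P∈ = part-of-vertex p x∈
        Q , y∈Q , Q∈ = part-of-vertex q y∈
    in f P∈ Q∈ x∈P y∈Q) (AllPairs.map⁻ (proj₂ (concat-AllPairs⁻ (map parts ps) forward)))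

  -- Every arc missing between a forward pair of pieces is a bad pair, and the layout bounds these.
  density : ∀ {p q} → p ∈ ps → q ∈ ps →
    Forward p q →
    DensityAtLeast T (ℚ.1ℚ ℚ.- unit k) (blockSet (toBlock p)) (blockSet (toBlock q))
  density {p} {q} p∈ q∈ f =
    subst₂ (DensityAtLeast T (ℚ.1ℚ ℚ.- unit k)) (sym (blockSet-toBlock p)) (sym (blockSet-toBlock q))
      (subst₂ (λ N e → (ℚ.1ℚ ℚ.- unit k) ℚ.* ℕ→ℚ N ℚ.≤ ℕ→ℚ e)
        (sym (cong₂ _*_ (∣toSubset∣ p-unique) (∣toSubset∣ q-unique))) (sym (edges-toSubset T p-unique q-unique)) bound)
    where
    open ≤-Reasoning
    p-unique = vertices-unique p (ok p∈)
    q-unique = vertices-unique q (ok q∈)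
    arcs = pairs (arc? T) (vertices p) (vertices q)
    bound : (ℚ.1ℚ ℚ.- unit k) ℚ.* ℕ→ℚ (length (vertices p) * length (vertices q)) ℚ.≤ ℕ→ℚ arcs
    bound = density-bound {k} (begin
      length (vertices p) * length (vertices q)                                          ≡⟨ pairs-split (arc? T) (vertices p) (vertices q) ⟨
      arcs + pairs (λ x y → ¬? (arc? T x y)) (vertices p) (vertices q)                   ≤⟨ +-monoʳ-≤ arcs (∑-mono (vertices p) (λ {x} x∈ →
         count-mono (λ y → ¬? (arc? T x y)) (bad? x) (vertices q)
           (λ {y} y∈ ¬arc → decidable-stable (bad? x y) (λ ¬bad → ¬arc (proj₂ (f x∈ y∈) ¬bad))))) ⟩
      arcs + pairs bad? (vertices p) (vertices q)                                        ∎) (sparse p∈ q∈)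

  mseq : MSeq T v η (unit c) (unit k) (map toBlock ps)
  mseq = Shaped⇒Shape shaped
    , subst (All Nonempty) (sym (long-toBlock ps)) all-nonempty
    , subst (AllPairs (Disjoint T)) (sym (long-toBlock ps)) all-disjoint
    , All.map⁺ (All.tabulate (λ {p} p∈ → piece-ok p (ok p∈)))
    , AllPairs.map⁺ (AllPairs-map-∈ {R = Forward} (λ p∈ q∈ f → density p∈ q∈ f) pieces-forward)

-- Strong pairs and copies in terms of lists

record CompletePair (T : Tournament) (K : ℕ) : Set where
  field
    A B      : List (Fin (size T))
    A-unique : Unique A
    B-unique : Unique B
    A-large  : size T ≤ K * length A
    B-large  : size T ≤ K * length B ⊎ (Chain T B × (∀ {U} → Chain T U → length U ≤ K * length B))
    complete : (∀ {x y} → x ∈ A → y ∈ B → Arc T x y) ⊎ (∀ {x y} → x ∈ A → y ∈ B → Arc T y x)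

∑≡0 : ∀ {A : Set} (xs : List A) (f : A → ℕ) → ∑ xs f ≡ 0 → ∀ {x} → x ∈ xs → f x ≡ 0
∑≡0 (x ∷ xs) f e (here refl) = m+n≡0⇒m≡0 (f x) e
∑≡0 (x ∷ xs) f e (there x∈)  = ∑≡0 xs f (m+n≡0⇒n≡0 (f x) e) x∈

-- Arcs and non-arcs together number |X||Y|, so density one leaves no non-arcs.
DensityOne⇒complete : (T : Tournament) (X Y : Subset (size T)) → DensityOne T X Y →
  ∀ {x y} → x ∈ₛ X → y ∈ₛ Y → Arc T x y
DensityOne⇒complete T X Y one {x} {y} x∈ y∈ = decidable-stable (arc? T x y) (λ ¬arc →
  n≮0 (subst (1 ≤_) (∑≡0 xs _ none (∈-elements⁺ x∈)) (∈-length (∈-filter⁺ (λ y → ¬? (arc? T x y)) (∈-elements⁺ y∈) ¬arc))))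
  where
  xs = elements X
  ys = elements Y
  none : pairs (λ x y → ¬? (arc? T x y)) xs ys ≡ 0
  none = +-cancelˡ-≡ (pairs (arc? T) xs ys) _ 0 (trans (pairs-split (arc? T) xs ys) (trans
    (sym (cong₂ _*_ (∣∣≡length-elements X) (∣∣≡length-elements Y))) (trans (sym one) (trans (edges-elements T X Y) (sym (+-identityʳ _))))))

StrongPair⇒CompletePair : ∀ (T : Tournament) {c k bs} → unit k ℚ.≤ c → StrongPair T c bs → CompletePair T (suc k)
StrongPair⇒CompletePair T {c} {k} uc (X , Y , _ , _ , _ , _ , _ , X-large , Y-large , one) = result Y-large
  where
  size≤ : ∀ S → AtLeastV T c S → size T ≤ suc k * length (elements S)
  size≤ S le = ≤-trans (≤-from-scaled {c} {k} uc le) (≤-reflexive (cong (suc k *_) (∣∣≡length-elements S)))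
  complete′ : ∀ {ys} → (∀ {y} → y ∈ ys → y ∈ₛ Y) →
    (∀ {x y} → x ∈ elements X → y ∈ ys → Arc T x y) ⊎ (∀ {x y} → x ∈ elements X → y ∈ ys → Arc T y x)
  complete′ ys⊆ = Sum.map (λ d x∈ y∈ → DensityOne⇒complete T X Y d (∈-elements⁻ x∈) (ys⊆ y∈))
    (λ d x∈ y∈ → DensityOne⇒complete T Y X d (ys⊆ y∈) (∈-elements⁻ x∈)) one
  result : AtLeastV T c Y ⊎ (Transitive T Y × AtLeastTr T c Y) → CompletePair T (suc k)
  result (inj₁ le) = record { A = elements X ; B = elements Y ; A-unique = elements-unique X ; B-unique = elements-unique Y
    ; A-large = size≤ X X-large ; B-large = inj₁ (size≤ Y le) ; complete = complete′ ∈-elements⁻ }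
  result (inj₂ (tr , le)) =
    let zs , zs-chain , zs⊆ , zs-length = Transitive⇒Chain T tr
    in record { A = elements X ; B = zs ; A-unique = elements-unique X ; B-unique = Chain⇒Unique T zs-chain
    ; A-large = size≤ X X-large
    ; B-large = inj₂ (zs-chain , λ {U} U-chain → ≤-trans (≤-reflexive (sym (∣toSubset∣ (Chain⇒Unique T U-chain))))
        (≤-trans (≤-from-scaled {c} {k} uc (le (toSubset U) (Chain⇒Transitive T U-chain (∈-toSubset⁻ U)))) (≤-reflexive (cong (suc k *_) (sym zs-length)))))
    ; complete = complete′ zs⊆ }

ListCopy : ∀ {k} (T : Tournament) → List (Member k) → List (Piece (Fin (size T))) → Set
ListCopy T F ps = Any (λ M → Σ[ x ∈ (Fin (size (Defs.H M)) → Fin (size T)) ]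
  (∀ j → ∃[ P ] nth (concatMap parts ps) (Fin.toℕ (Defs.f M j)) P × x j ∈ P) ×
  (∀ a b → adj T (x a) (x b) ≡ adj (Defs.H M) a b)) F

nth-map : ∀ {A B : Set} (g : A → B) (xs : List A) i {b} → nth (map g xs) i b → ∃[ a ] nth xs i a × b ≡ g a
nth-map g (x ∷ xs) zero    refl = x , refl , refl
nth-map g (x ∷ xs) (suc i) h    = nth-map g xs i h

CopyIn⇒ListCopy : ∀ {k} (T : Tournament) (F : List (Member k)) ps → CopyIn T F (map toBlock ps) → ListCopy T F ps
CopyIn⇒ListCopy T F ps = Any.map λ {M} → λ (x , inLong , hom) → x , (λ j → located (Fin.toℕ (Defs.f M j)) (x j) (inLong j)) , hom
  where
  located : ∀ i y → ∃[ S ] nth (long (map toBlock ps)) i S × y ∈ₛ S → ∃[ P ] nth (concatMap parts ps) i P × y ∈ P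
  located i y (S , at , y∈) =
    let P , at′ , eq = nth-map toSubset (concatMap parts ps) i (subst (λ L → nth L i S) (long-toBlock ps) at)
    in P , at′ , ∈-toSubset⁻ P (subst (y ∈ₛ_) eq y∈)

-- λ is 1/(j+1) for any j ≥ k, so that two properties can be applied with a common j. `Good` is a
-- parameter because for the factors of a product the place of the copy matters, and in the end only
-- the presence of `H`.
EHBound : (v : List Bool) (η : List ℕ) (c k K : ℕ) (Good : (T : Tournament) → List (Piece (Fin (size T))) → Set) → Set₁
EHBound v η c k K Good = ∀ (T : Tournament) τ ps j → k ≤ j → 1 ≤ size T → 1 ≤ τ → (∀ {U} → Chain T U → length U ≤ τ) →
  Layout T v η (size T) τ (suc c) (suc j) ps → Good T ps ⊎ CompletePair T (suc K)

strongEH-lists : ∀ {v η F} → StrongEH v η F → ∀ c → ∃[ k ] ∃[ K ] EHBound v η c k K (λ T → ListCopy T F)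
strongEH-lists {v} {η} {F} eh c =
  let λ₀ , c₂ , 0<λ₀ , 0<c₂ , prop = eh (unit c) (0<unit c)
      k , k≤ = unit-archimedean λ₀ 0<λ₀
      K , K≤ = unit-archimedean c₂ 0<c₂
  -- The shift by one excludes λ = 1, since `unit 0` is not below 1.
  in suc k , K , λ { T τ ps (suc j) (s≤s k≤j) 1≤n 1≤τ τ-max layout →
       Sum.map (CopyIn⇒ListCopy T F ps) (StrongPair⇒CompletePair T {bs = map toBlock ps} K≤)
         (prop T (unit (suc j)) (ℚ.<⇒≤ (0<unit (suc j))) (ℚ.≤-trans (unit-antitone {k} {suc j} (m≤n⇒m≤1+n k≤j)) k≤) (unit<1 j)
           (map toBlock ps) (ToMSeq.mseq T v η τ c (suc j) ps 1≤n 1≤τ τ-max layout)) }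

-- Products

<ᵇ-true : ∀ {m n} → m < n → (m <ᵇ n) ≡ true
<ᵇ-true {m} {n} lt with m <ᵇ n | <⇒<ᵇ lt
... | true | _ = refl

<ᵇ-false : ∀ {m n} → ¬ (m < n) → (m <ᵇ n) ≡ false
<ᵇ-false {m} {n} nlt with m <ᵇ n | <ᵇ⇒< m n
... | true  | lt = ⊥-elim (nlt (lt tt))
... | false | _  = refl

filterPiece : ∀ {V} {K : V → Set} → Decidable K → Piece V → Piece V
filterPiece K? (bulk xs)   = bulk (filter K? xs)
filterPiece K? (stack pss) = stack (map (filter K?) pss)

module _ {V : Set} {K : V → Set} (K? : Decidable K) where

  parts-filter : ∀ p → parts (filterPiece K? p) ≡ map (filter K?) (parts p)
  parts-filter (bulk xs)   = refl
  parts-filter (stack pss) = refl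

  long-filter : ∀ ps → concatMap parts (map (filterPiece K?) ps) ≡ map (filter K?) (concatMap parts ps)
  long-filter []       = refl
  long-filter (p ∷ ps) = trans (cong₂ _++_ (parts-filter p) (long-filter ps)) (sym (map-++ (filter K?) (parts p) (concatMap parts ps)))

  concat-filter : ∀ pss → concat (map (filter K?) pss) ≡ filter K? (concat pss)
  concat-filter []         = refl
  concat-filter (P ∷ pss) = trans (cong (filter K? P ++_) (concat-filter pss)) (sym (filter-++ K? P (concat pss)))

  vertices-filter : ∀ p → vertices (filterPiece K? p) ≡ filter K? (vertices p)
  vertices-filter (bulk xs)   = refl
  vertices-filter (stack pss) = concat-filter pss

  Shaped-filter : ∀ {v η ps} → Shaped v η ps → Shaped v η (map (filterPiece K?) ps)
  Shaped-filter []             = []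
  Shaped-filter (bulk sh)      = bulk (Shaped-filter sh)
  Shaped-filter (stack {pss = pss} len sh) = stack (trans (length-map (filter K?) pss) len) (Shaped-filter sh)

  count-concat : ∀ {pss P} → P ∈ pss → count K? P ≤ count K? (concat pss)
  count-concat {P ∷ pss} (here refl) = ≤-trans (m≤m+n _ _) (≤-reflexive (sym (trans (cong length (filter-++ K? P (concat pss))) (length-++ (filter K? P)))))
  count-concat {Q ∷ pss} (there P∈)  = ≤-trans (count-concat P∈) (≤-trans (m≤n+m _ _)
    (≤-reflexive (sym (trans (cong length (filter-++ K? Q (concat pss))) (length-++ (filter K? Q))))))

  ∑-filter-≤ : ∀ xs (f : V → ℕ) → ∑ (filter K? xs) f ≤ ∑ xs f
  ∑-filter-≤ xs f = ≤-trans (≤-reflexive (∑-filter K? xs f)) (∑-mono xs (λ {x} _ → if-≤ (does (K? x)) (f x)))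
    where
    if-≤ : ∀ b m → (if b then m else 0) ≤ m
    if-≤ true  m = ≤-refl
    if-≤ false m = z≤n

  count-filter-≤ : ∀ {Q : V → Set} (Q? : Decidable Q) xs → count Q? (filter K? xs) ≤ count Q? xs
  count-filter-≤ Q? xs = ≤-trans (≤-reflexive (count-∑ Q? (filter K? xs))) (≤-trans (∑-filter-≤ xs _) (≤-reflexive (sym (count-∑ Q? xs))))

  pairs-filter-≤ : ∀ {R : V → V → Set} (R? : ∀ x y → Dec (R x y)) xs ys → pairs R? (filter K? xs) (filter K? ys) ≤ pairs R? xs ys
  pairs-filter-≤ R? xs ys = ≤-trans (∑-filter-≤ xs _) (∑-mono xs (λ {x} _ → count-filter-≤ (R? x) ys))

  majority : ∀ xs → 2 * count (λ x → ¬? (K? x)) xs ≤ length xs → length xs ≤ 2 * count K? xs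
  majority xs le = begin
    length xs     ≡⟨ count-split K? xs ⟨
    a + b         ≤⟨ +-monoʳ-≤ a (+-cancelʳ-≤ b b a (≤-trans (≤-reflexive (cong (b +_) (sym (+-identityʳ b)))) (≤-trans le (≤-reflexive (sym (count-split K? xs)))))) ⟩
    a + a         ≡⟨ cong (a +_) (+-identityʳ a) ⟨
    2 * a         ∎
    where
    open ≤-Reasoning
    a = count K? xs
    b = count (λ x → ¬? (K? x)) xs

-- Losing a fraction 1/(2(c+1)) of each piece leaves at least half of it, and also half of each part
-- of a stack: the whole stack, being a chain, has at most `τ` ≤ (c+1)|P| vertices, so the loss is
-- at most |P|/2. Since both sides of a pair of pieces may be halved, the sparseness drops by a
-- factor 4.
shrink : ∀ {T v η n τ c j ps} j′ {K : Fin (size T) → Set} (K? : Decidable K) (layout : Layout T v η n τ (suc c) (suc j) ps) →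
  4 * suc j′ ≤ suc j → (∀ {U} → Chain T U → length U ≤ τ) →
  (∀ {p} → p ∈ ps → 2 * suc c * count (λ x → ¬? (K? x)) (vertices p) ≤ length (vertices p)) →
  Layout T v η n τ (2 * suc c) (suc j′) (map (filterPiece K?) ps)
shrink {T} {v} {η} {n} {τ} {c} {j} {ps} j′ {K} K? layout 4j′≤j τ-max few-lost = record
  { Bad = Bad ; bad? = bad? ; bad-sym = bad-sym ; shaped = Shaped-filter K? shaped
  ; ok = ok′
  ; forward = subst (AllPairs _) (sym (long-filter K? ps)) (AllPairs.map⁺ (AllPairs.map (λ {P} {Q} f {x} {y} x∈ y∈ →
      f (proj₁ (∈-filter⁻ K? {xs = P} x∈)) (proj₁ (∈-filter⁻ K? {xs = Q} y∈))) forward))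
  ; sparse = sparse′ }
  where
  open Layout layout
  open ≤-Reasoning
  lost : List (Fin (size T)) → ℕ
  lost = count (λ x → ¬? (K? x))
  half : ∀ {p} → p ∈ ps → length (vertices p) ≤ 2 * count K? (vertices p)
  half {p} p∈ = majority K? (vertices p) (≤-trans (*-monoˡ-≤ (lost (vertices p)) (m≤m*n 2 (suc c))) (few-lost p∈))

  piece-ok : ∀ {p} → p ∈ ps → PieceOK T n τ (suc c) p → PieceOK T n τ (2 * suc c) (filterPiece K? p)
  piece-ok {bulk xs} p∈ (u , le) = Unique-filter⁺ K? u , ≤-trans le (≤-trans (*-monoʳ-≤ (suc c) (half p∈)) (≤-reflexive (shuffle (suc c) (count K? xs))))
    where
    shuffle : ∀ a b → a * (2 * b) ≡ 2 * a * b
    shuffle = solve-∀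
  piece-ok {stack pss} p∈ (ch , les) = subst (Chain T) (sym (concat-filter K? pss)) (AllPairs.filter⁺ K? ch) , All.map⁺ (All.tabulate part-ok)
    where
    shuffle : ∀ a b → a * (2 * b) ≡ 2 * a * b
    shuffle = solve-∀
    part-ok : ∀ {P} → P ∈ pss → τ ≤ 2 * suc c * length (filter K? P)
    part-ok {P} P∈ = begin
      τ                                     ≤⟨ All.lookup les P∈ ⟩
      suc c * length P                      ≤⟨ *-monoʳ-≤ (suc c) (majority K? P (*-cancelˡ-≤ (suc c) (begin
         suc c * (2 * lost P)                 ≡⟨ shuffle (suc c) (lost P) ⟩
         2 * suc c * lost P                   ≤⟨ *-monoʳ-≤ (2 * suc c) (count-concat (λ x → ¬? (K? x)) P∈) ⟩
         2 * suc c * lost (concat pss)        ≤⟨ few-lost p∈ ⟩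
         length (concat pss)                  ≤⟨ τ-max ch ⟩
         τ                                    ≤⟨ All.lookup les P∈ ⟩
         suc c * length P                     ∎))) ⟩
      suc c * (2 * count K? P)              ≡⟨ shuffle (suc c) (count K? P) ⟩
      2 * suc c * length (filter K? P)      ∎

  ok′ : ∀ {q} → q ∈ map (filterPiece K?) ps → PieceOK T n τ (2 * suc c) q
  ok′ q∈ with ∈-map⁻ (filterPiece K?) q∈
  ... | p , p∈ , refl = piece-ok p∈ (ok p∈)

  sparse-filter : ∀ {p q} → p ∈ ps → q ∈ ps → suc j′ * pairs bad? (filter K? (vertices p)) (filter K? (vertices q))
    ≤ count K? (vertices p) * count K? (vertices q)
  sparse-filter {p} {q} p∈ q∈ = *-cancelˡ-≤ 4 (begin
    4 * (suc j′ * pairs bad? (filter K? S) (filter K? S′))        ≡⟨ *-assoc 4 (suc j′) _ ⟨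
    4 * suc j′ * pairs bad? (filter K? S) (filter K? S′)          ≤⟨ *-mono-≤ 4j′≤j (pairs-filter-≤ K? bad? S S′) ⟩
    suc j * pairs bad? S S′                                       ≤⟨ sparse p∈ q∈ ⟩
    length S * length S′                                          ≤⟨ *-mono-≤ (half p∈) (half q∈) ⟩
    2 * count K? S * (2 * count K? S′)                            ≡⟨ shuffle (count K? S) (count K? S′) ⟩
    4 * (count K? S * count K? S′)                                ∎)
    where
    S = vertices p
    S′ = vertices q
    shuffle : ∀ a b → 2 * a * (2 * b) ≡ 4 * (a * b)
    shuffle = solve-∀

  sparse′ : ∀ {q r} → q ∈ map (filterPiece K?) ps → r ∈ map (filterPiece K?) ps →
    suc j′ * pairs bad? (vertices q) (vertices r) ≤ length (vertices q) * length (vertices r)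
  sparse′ q∈ r∈ with ∈-map⁻ (filterPiece K?) q∈ | ∈-map⁻ (filterPiece K?) r∈
  ... | p , p∈ , refl | p′ , p′∈ , refl = subst₂ (λ S S′ → suc j′ * pairs bad? S S′ ≤ length S * length S′)
    (sym (vertices-filter K? p)) (sym (vertices-filter K? p′)) (sparse-filter p∈ p′∈)

nth-AllPairs : ∀ {A : Set} {R : A → A → Set} {xs i j x y} → AllPairs R xs → i < j → nth xs i x → nth xs j y → R x y
nth-AllPairs {xs = x ∷ xs} {zero}  {suc j} (r ∷ rs) lt refl at = All.lookup r (nth∈ xs j at)
  where
  nth∈ : ∀ xs j {y} → nth xs j y → y ∈ xs
  nth∈ (x ∷ xs) zero    refl = here refl
  nth∈ (x ∷ xs) (suc j) at   = there (nth∈ xs j at)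
nth-AllPairs {xs = x ∷ xs} {suc i} {suc j} (r ∷ rs) (s≤s lt) at at′ = nth-AllPairs rs lt at at′

contains-via-hom : ∀ (T H : Tournament) {d} (D : Fin d → Fin d → Bool) → Contains D (adj H) →
  (φ : Fin d → Fin (size T)) → (∀ a b → adj T (φ a) (φ b) ≡ D a b) → ContainsT T H
contains-via-hom T H D (ψ , _ , ψ-hom) φ φ-hom = φ ∘ ψ , adj-hom⇒injective (adj T) (irrefl T) H (φ ∘ ψ) hom , hom
  where
  hom : ∀ a b → adj T (φ (ψ a)) (φ (ψ b)) ≡ adj H a b
  hom a b = trans (φ-hom (ψ a) (ψ b)) (ψ-hom a b)

-- A copy of a member of F₁ is chosen among vertices with few bad pairs to every piece; deleting all
-- vertices in bad pairs with it leaves a layout, in which a member of F₂ is found.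
module Product {v η} (H : Tournament) (F₁ F₂ : List (Member (kOf v η)))
  (orthogonal : All (λ M₁ → All (Orthogonal M₁) F₂) F₁)
  (contain : ∀ {M₁ M₂} → M₁ ∈ F₁ → M₂ ∈ F₂ → Contains (dadj (prod M₁ M₂)) (adj H))
  (c k₁ K₁ k₂ K₂ : ℕ)
  (eh₁ : EHBound v η (c + suc (c + 0)) k₁ K₁ (λ T → ListCopy T F₁))
  (eh₂ : EHBound v η (c + suc (c + 0)) k₂ K₂ (λ T → ListCopy T F₂)) where

  private
    C h D E : ℕ
    -- `h` bounds the order of every member of `F₁`. A light vertex is bad to at most 1/D of any
    -- piece, so a copy of at most h light vertices spoils at most h/D = 1/C of it, the loss
    -- `shrink` allows. Markov's inequality and a union bound over the pieces give at most E/(j+1)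
    -- as the fraction of non-light vertices, again at most 1/C once j+1 ≥ CE.
    C = 2 * suc c
    h = suc (∑ F₁ (λ M → size (Defs.H M)))
    D = C * h
    E = suc (length v) * D

  j′ : ℕ
  j′ = k₁ + k₂ + C * E

  k : ℕ
  k = 4 * suc j′

  module _ (T : Tournament) (τ : ℕ) (ps : List (Piece (Fin (size T)))) (j : ℕ) (k≤j : k ≤ j)
    (1≤n : 1 ≤ size T) (1≤τ : 1 ≤ τ) (τ-max : ∀ {U} → Chain T U → length U ≤ τ)
    (layout : Layout T v η (size T) τ (suc c) (suc j) ps) where

    open Layout layout
    private V = Fin (size T)

    Heavy : Piece V → V → Set
    Heavy q x = ¬ (D * count (bad? x) (vertices q) ≤ length (vertices q))

    heavy? : ∀ q x → Dec (Heavy q x)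
    heavy? q x = ¬? (D * count (bad? x) (vertices q) ≤? length (vertices q))

    anyHeavy? : ∀ x → Dec (Any (λ q → Heavy q x) ps)
    anyHeavy? x = any? (λ q → heavy? q x) ps

    few-heavy : ∀ {p q} → p ∈ ps → q ∈ ps → suc j * count (heavy? q) (vertices p) ≤ D * length (vertices p)
    few-heavy {p} {q} p∈ q∈ = *-cancelʳ-≤ _ _ (suc ℓ) (begin
      suc j * h′ * suc ℓ                                            ≡⟨ *-assoc (suc j) h′ (suc ℓ) ⟩
      suc j * (h′ * suc ℓ)                                          ≤⟨ *-monoʳ-≤ (suc j) (markov (heavy? q) S (λ _ → ≰⇒>)) ⟩
      suc j * ∑ S (λ x → D * count (bad? x) (vertices q))           ≡⟨ cong (suc j *_) (∑-* D S _) ⟨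
      suc j * (D * pairs bad? S (vertices q))                       ≡⟨ swap (suc j) D _ ⟩
      D * (suc j * pairs bad? S (vertices q))                       ≤⟨ *-monoʳ-≤ D (≤-trans (sparse p∈ q∈) (*-monoʳ-≤ (length S) (n≤1+n ℓ))) ⟩
      D * (length S * suc ℓ)                                        ≡⟨ *-assoc D (length S) (suc ℓ) ⟨
      D * length S * suc ℓ                                          ∎)
      where
      open ≤-Reasoning
      S = vertices p
      ℓ = length (vertices q)
      h′ = count (heavy? q) S
      swap : ∀ a b c → a * (b * c) ≡ b * (a * c)
      swap = solve-∀

    Light : V → Set
    Light x = ¬ Any (λ q → Heavy q x) ps

    light? : ∀ x → Dec (Light x)
    light? x = ¬? (anyHeavy? x)

    light⇒ : ∀ {x q} → Light x → q ∈ ps → D * count (bad? x) (vertices q) ≤ length (vertices q)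
    light⇒ l q∈ = ≮⇒≥ (λ gt → l (lose q∈ (<⇒≱ gt)))

    1≤E : 1 ≤ E
    1≤E = *-mono-≤ {1} {suc (length v)} (s≤s z≤n) (*-mono-≤ {1} {C} {1} {h} (s≤s z≤n) (s≤s z≤n))

    CE≤j : C * E ≤ suc j
    CE≤j = ≤-trans (m≤n+m (C * E) (k₁ + k₂)) (≤-trans (n≤1+n j′) (≤-trans (m≤n*m (suc j′) 4) (≤-trans k≤j (n≤1+n j))))

    few-not-light : ∀ {p} → p ∈ ps → C * count (λ x → ¬? (light? x)) (vertices p) ≤ length (vertices p)
    few-not-light {p} p∈ = *-cancelˡ-≤ E {{>-nonZero 1≤E}} (begin
      E * (C * count (λ x → ¬? (light? x)) S)             ≤⟨ *-monoʳ-≤ E (*-monoʳ-≤ C (count-mono (λ x → ¬? (light? x)) anyHeavy? S (λ {x} _ → decidable-stable (anyHeavy? x)))) ⟩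
      E * (C * count anyHeavy? S)                         ≡⟨ swap E C _ ⟩
      C * E * count anyHeavy? S                           ≤⟨ *-mono-≤ CE≤j (union-bound heavy? ps S) ⟩
      suc j * ∑ ps (λ q → count (heavy? q) S)             ≤⟨ ∑-≤ ps {k = suc j} (few-heavy p∈) ⟩
      length ps * (D * length S)                          ≡⟨ cong (_* (D * length S)) (Shaped-length shaped) ⟩
      length v * (D * length S)                           ≤⟨ *-monoˡ-≤ (D * length S) (n≤1+n (length v)) ⟩
      suc (length v) * (D * length S)                     ≡⟨ *-assoc (suc (length v)) D (length S) ⟨
      E * length S                                        ∎)
      where
      open ≤-Reasoning
      S = vertices p
      swap : ∀ a b c → a * (b * c) ≡ b * a * c
      swap = solve-∀

    4j′≤j : 4 * suc j′ ≤ suc j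
    4j′≤j = ≤-trans k≤j (n≤1+n j)

    located : ∀ {K : V → Set} (K? : Decidable K) {i x} → ∃[ P ] nth (concatMap parts (map (filterPiece K?) ps)) i P × x ∈ P →
      ∃[ P ] nth (concatMap parts ps) i P × x ∈ P × K x
    located K? {i} {x} (P , at , x∈) =
      let P₀ , at₀ , eq = nth-map (filter K?) (concatMap parts ps) i (subst (λ L → nth L i P) (long-filter K? ps) at)
          x∈P₀ , kx = ∈-filter⁻ K? {xs = P₀} (subst (x ∈_) eq x∈)
      in P₀ , at₀ , x∈P₀ , kx

    Outcome : Set
    Outcome = ContainsT T H ⊎ CompletePair T (suc (K₁ + K₂))

    CompletePair-mono : ∀ {K K′} → K ≤ K′ → CompletePair T K → CompletePair T K′
    CompletePair-mono le cp = record { A = A ; B = B ; A-unique = A-unique ; B-unique = B-unique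
      ; A-large = ≤-trans A-large (*-monoˡ-≤ (length A) le)
      ; B-large = Sum.map (λ l → ≤-trans l (*-monoˡ-≤ (length B) le)) (λ (ch , f) → ch , λ {U} u → ≤-trans (f u) (*-monoˡ-≤ (length B) le)) B-large
      ; complete = complete }
      where open CompletePair cp

    module _ {M₁} (M₁∈ : M₁ ∈ F₁) (x : Fin (size (Defs.H M₁)) → V)
      (x-located : ∀ a → ∃[ P ] nth (concatMap parts ps) (Fin.toℕ (Defs.f M₁ a)) P × x a ∈ P × Light (x a))
      (x-hom : ∀ a b → adj T (x a) (x b) ≡ adj (Defs.H M₁) a b) where

      Q : List V
      Q = tabulate x

      Compatible : V → Set
      Compatible y = ¬ Any (λ x → Bad x y) Q

      badAny? : ∀ y → Dec (Any (λ x → Bad x y) Q)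
      badAny? y = any? (λ x → bad? x y) Q

      compatible? : ∀ y → Dec (Compatible y)
      compatible? y = ¬? (badAny? y)

      Q≤h : length Q ≤ h
      Q≤h = ≤-trans (≤-reflexive (length-tabulate x)) (≤-trans (size≤∑ M₁∈) (n≤1+n _))
        where
        size≤∑ : ∀ {F M} → M ∈ F → size (Defs.H M) ≤ ∑ F (λ M → size (Defs.H M))
        size≤∑ {M ∷ F} (here refl) = m≤m+n _ _
        size≤∑ {N ∷ F} (there M∈)  = ≤-trans (size≤∑ M∈) (m≤n+m _ (size (Defs.H N)))

      Q-light : ∀ {z} → z ∈ Q → Light z
      Q-light z∈ with ∈-tabulate⁻ z∈
      ... | a , refl = proj₂ (proj₂ (proj₂ (x-located a)))

      few-incompatible : ∀ {p} → p ∈ ps → C * count (λ y → ¬? (compatible? y)) (vertices p) ≤ length (vertices p)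
      few-incompatible {p} p∈ = *-cancelˡ-≤ h (begin
        h * (C * count (λ y → ¬? (compatible? y)) S)      ≤⟨ *-monoʳ-≤ h (*-monoʳ-≤ C (count-mono (λ y → ¬? (compatible? y)) badAny? S (λ {y} _ → decidable-stable (badAny? y)))) ⟩
        h * (C * count badAny? S)                         ≡⟨ swap h C _ ⟩
        D * count badAny? S                               ≤⟨ *-monoʳ-≤ D (union-bound bad? Q S) ⟩
        D * ∑ Q (λ z → count (bad? z) S)                  ≤⟨ ∑-≤ Q {k = D} (λ z∈ → light⇒ (Q-light z∈) p∈) ⟩
        length Q * length S                               ≤⟨ *-monoˡ-≤ (length S) Q≤h ⟩
        h * length S                                      ∎)
        where
        open ≤-Reasoning
        S = vertices p
        swap : ∀ a b c → a * (b * c) ≡ b * a * c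
        swap = solve-∀

      -- Compatibility excludes bad pairs between the two copies, so all arcs between them follow
      -- the order of the positions, as in the product. Orthogonality excludes equal positions.
      combine : ∀ {M₂} → M₂ ∈ F₂ → (y : Fin (size (Defs.H M₂)) → V) →
        (∀ b → ∃[ P ] nth (concatMap parts ps) (Fin.toℕ (Defs.f M₂ b)) P × y b ∈ P × Compatible (y b)) →
        (∀ a b → adj T (y a) (y b) ≡ adj (Defs.H M₂) a b) → ContainsT T H
      combine {M₂} M₂∈ y y-located y-hom = contains-via-hom T H (dadj (prod M₁ M₂)) (contain M₁∈ M₂∈)
        (λ z → place (splitAt (size (Defs.H M₁)) z)) (λ a b → hom (splitAt (size (Defs.H M₁)) a) (splitAt (size (Defs.H M₁)) b))
        where
        place : Fin (size (Defs.H M₁)) ⊎ Fin (size (Defs.H M₂)) → V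
        place = Sum.[ x , y ]
        cross : ∀ a b → (adj T (x a) (y b) ≡ (Fin.toℕ (Defs.f M₁ a) <ᵇ Fin.toℕ (Defs.f M₂ b)))
                      × (adj T (y b) (x a) ≡ (Fin.toℕ (Defs.f M₂ b) <ᵇ Fin.toℕ (Defs.f M₁ a)))
        cross a b with x-located a | y-located b
        ... | P , P-at , x∈ , _ | P′ , P′-at , y∈ , compatible = order (<-cmp i₁ i₂)
          where
          i₁ = Fin.toℕ (Defs.f M₁ a)
          i₂ = Fin.toℕ (Defs.f M₂ b)
          ¬bad : ¬ Bad (x a) (y b)
          ¬bad bad = compatible (lose (∈-tabulate⁺ a) bad)
          order : _ → (adj T (x a) (y b) ≡ (i₁ <ᵇ i₂)) × (adj T (y b) (x a) ≡ (i₂ <ᵇ i₁))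
          order (tri≈ _ eq _) = ⊥-elim (All.lookup (All.lookup orthogonal M₁∈) M₂∈ a b (toℕ-injective eq))
          order (tri< i₁<i₂ _ i₂≮i₁) =
            let arc = proj₂ (nth-AllPairs forward i₁<i₂ P-at P′-at x∈ y∈) ¬bad
            in trans arc (sym (<ᵇ-true i₁<i₂)) , trans (arc-asym T arc) (sym (<ᵇ-false i₂≮i₁))
          order (tri> i₁≮i₂ _ i₂<i₁) =
            let arc = proj₂ (nth-AllPairs forward i₂<i₁ P′-at P-at y∈ x∈) (λ bad → ¬bad (bad-sym bad))
            in trans (arc-asym T arc) (sym (<ᵇ-false i₁≮i₂)) , trans arc (sym (<ᵇ-true i₂<i₁))
        hom : ∀ s t → adj T (place s) (place t) ≡ prodAdj⊎ M₁ M₂ s t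
        hom (inj₁ a) (inj₁ b) = x-hom a b
        hom (inj₂ a) (inj₂ b) = y-hom a b
        hom (inj₁ a) (inj₂ b) = proj₁ (cross a b)
        hom (inj₂ b) (inj₁ a) = proj₂ (cross a b)

      second : Outcome
      second = Sum.map copy (CompletePair-mono (s≤s (m≤n+m K₂ K₁)))
        -- The filter acts on the original pieces, not on their light vertices, so the losses of the
        -- two applications do not accumulate.
        (eh₂ T τ (map (filterPiece compatible?) ps) j′ (≤-trans (m≤n+m k₂ k₁) (m≤m+n (k₁ + k₂) (C * E))) 1≤n 1≤τ τ-max
          (shrink j′ compatible? layout 4j′≤j τ-max few-incompatible))
        where
        copy : ListCopy T F₂ (map (filterPiece compatible?) ps) → ContainsT T H
        copy found = let M₂ , M₂∈ , y , loc , y-hom = find found in combine M₂∈ y (λ b → located compatible? (loc b)) y-hom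

    outcome : Outcome
    outcome = Sum.[ first , (λ cp → inj₂ (CompletePair-mono (s≤s (m≤m+n K₁ K₂)) cp)) ]
        (eh₁ T τ (map (filterPiece light?) ps) j′ (≤-trans (m≤m+n k₁ k₂) (m≤m+n (k₁ + k₂) (C * E))) 1≤n 1≤τ τ-max
          (shrink j′ light? layout 4j′≤j τ-max few-not-light))
      where
      first : ListCopy T F₁ (map (filterPiece light?) ps) → Outcome
      first found = let M₁ , M₁∈ , x , loc , x-hom = find found in second M₁∈ x (λ a → located light? (loc a)) x-hom

single-bound : ∀ {v η} (H : Tournament) (F : List (Member (kOf v η))) → StrongEH v η F →
  All (λ D → Contains (dadj D) (adj H)) (map asDigraph F) → ∀ c → ∃[ k ] ∃[ K ] EHBound v η c k K (λ T _ → ContainsT T H)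
single-bound H F eh contain c =
  let k , K , bound = strongEH-lists eh c
  in k , K , λ T τ ps j k≤j 1≤n 1≤τ τ-max layout → Sum.map₁ (copy T ps) (bound T τ ps j k≤j 1≤n 1≤τ τ-max layout)
  where
  copy : ∀ T ps → ListCopy T F ps → ContainsT T H
  copy T ps found = let M , M∈ , x , _ , hom = find found in contains-via-hom T H (adj (Defs.H M)) (All.lookup (All-map⁻ contain) M∈) x hom

product-bound : ∀ {v η} (H : Tournament) (F₁ F₂ : List (Member (kOf v η))) → StrongEH v η F₁ → StrongEH v η F₂ →
  All (λ M₁ → All (Orthogonal M₁) F₂) F₁ →
  (∀ {M₁ M₂} → M₁ ∈ F₁ → M₂ ∈ F₂ → Contains (dadj (prod M₁ M₂)) (adj H)) →
  ∀ c → ∃[ k ] ∃[ K ] EHBound v η c k K (λ T _ → ContainsT T H)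
product-bound {v} {η} H F₁ F₂ eh₁ eh₂ orthogonal contain c =
  -- The successor of this argument reduces to `2 * suc c`, the constant of a layout after `shrink`.
  let k₁ , K₁ , bound₁ = strongEH-lists eh₁ (c + suc (c + 0))
      k₂ , K₂ , bound₂ = strongEH-lists eh₂ (c + suc (c + 0))
      open Product {v} {η} H F₁ F₂ orthogonal contain c k₁ K₁ k₂ K₂ bound₁ bound₂
  in k , K₁ + K₂ , outcome

regular-bound : ∀ H → Regular H → ∃[ v ] ∃[ η ] (length η ≡ Defs.count true v) ×
  (∀ c → ∃[ k ] ∃[ K ] EHBound v η c k K (λ T _ → ContainsT T H))
regular-bound H (v , η , (len , _) , F₁ , F₂ , eh₁ , eh₂ , orth , nonempty , contain) = v , η , len , families F₁ F₂ eh₁ eh₂ orth nonempty contain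
  where
  families : ∀ F₁ F₂ → F₁ ≡ [] ⊎ StrongEH v η F₁ → F₂ ≡ [] ⊎ StrongEH v η F₂ →
    All (λ M₁ → All (Orthogonal M₁) F₂) F₁ → prodFam F₁ F₂ ≢ [] →
    All (λ D → Contains (dadj D) (adj H)) (prodFam F₁ F₂) →
    ∀ c → ∃[ k ] ∃[ K ] EHBound v η c k K (λ T _ → ContainsT T H)
  families [] []         _ _          _ ne _ c = ⊥-elim (ne refl)
  families [] (_ ∷ _)    _ (inj₁ ())  _ _ _ c
  families [] F₂@(_ ∷ _) _ (inj₂ eh₂) _ _ contain c = single-bound H F₂ eh₂ contain c
  families (_ ∷ _) _ (inj₁ ()) _ _ _ _ c
  families F₁@(_ ∷ _) [] (inj₂ eh₁) _ _ _ contain c = single-bound H F₁ eh₁ contain c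
  families (_ ∷ _) (_ ∷ _) (inj₂ _) (inj₁ ()) _ _ _ c
  families F₁@(_ ∷ _) F₂@(_ ∷ _) (inj₂ eh₁) (inj₂ eh₂) orthogonal _ contain c =
    product-bound H F₁ F₂ eh₁ eh₂ orthogonal factor c
    where
    factor : ∀ {M₁ M₂} → M₁ ∈ F₁ → M₂ ∈ F₂ → Contains (dadj (prod M₁ M₂)) (adj H)
    factor {M₁} M₁∈ M₂∈ = All.lookup contain (∈-concatMap⁺ (λ M → map (prod M) F₂)
      (Any.map (λ { refl → ∈-map⁺ (prod M₁) M₂∈ }) M₁∈))

-- Induced subtournaments

Unique-lookup-injective : ∀ {A : Set} {xs : List A} → Unique xs → ∀ {i j} → lookup xs i ≡ lookup xs j → i ≡ j
Unique-lookup-injective {xs = _ ∷ _}  _         {Fin.zero}  {Fin.zero}  _ = refl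
Unique-lookup-injective {xs = _ ∷ xs} (x∉ ∷ _)  {Fin.zero}  {Fin.suc j} e = ⊥-elim (All.lookup x∉ (∈-lookup j) e)
Unique-lookup-injective {xs = _ ∷ xs} (x∉ ∷ _)  {Fin.suc i} {Fin.zero}  e = ⊥-elim (All.lookup x∉ (∈-lookup i) (sym e))
Unique-lookup-injective {xs = _ ∷ _}  (_ ∷ u)   {Fin.suc i} {Fin.suc j} e = cong Fin.suc (Unique-lookup-injective u e)

induced : (T : Tournament) (X : List (Fin (size T))) → Unique X → Tournament
induced T X u = record
  { size   = length X
  ; adj    = λ i j → adj T (lookup X i) (lookup X j)
  ; irrefl = λ i → irrefl T (lookup X i)
  ; tour   = λ i j i≢j → tour T (lookup X i) (lookup X j) (λ e → i≢j (Unique-lookup-injective u e)) }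

mapPiece : ∀ {V W : Set} → (V → W) → Piece V → Piece W
mapPiece ι (bulk xs)   = bulk (map ι xs)
mapPiece ι (stack pss) = stack (map (map ι) pss)

module _ {V W : Set} (ι : V → W) where

  parts-map : ∀ p → parts (mapPiece ι p) ≡ map (map ι) (parts p)
  parts-map (bulk xs)   = refl
  parts-map (stack pss) = refl

  long-map : ∀ ps → concatMap parts (map (mapPiece ι) ps) ≡ map (map ι) (concatMap parts ps)
  long-map []       = refl
  long-map (p ∷ ps) = trans (cong₂ _++_ (parts-map p) (long-map ps)) (sym (map-++ (map ι) (parts p) (concatMap parts ps)))

  vertices-map : ∀ p → vertices (mapPiece ι p) ≡ map ι (vertices p)
  vertices-map (bulk xs)   = refl
  vertices-map (stack pss) = concat-map pss

  Shaped-map⁻ : ∀ {v η} ps → Shaped v η (map (mapPiece ι) ps) → Shaped v η ps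
  Shaped-map⁻ []              []             = []
  Shaped-map⁻ (bulk xs ∷ ps)   (bulk sh)      = bulk (Shaped-map⁻ ps sh)
  Shaped-map⁻ (stack pss ∷ ps) (stack len sh) = stack (trans (sym (length-map (map ι) pss)) len) (Shaped-map⁻ ps sh)

  pairs-map : ∀ {R : W → W → Set} (R? : ∀ x y → Dec (R x y)) xs ys →
    pairs R? (map ι xs) (map ι ys) ≡ pairs (λ x y → R? (ι x) (ι y)) xs ys
  pairs-map R? []       ys = refl
  pairs-map R? (x ∷ xs) ys = cong₂ _+_ (count-map (R? (ι x)) ι ys) (pairs-map R? xs ys)

  preimages : ∀ {X : List W} → (∀ {y} → y ∈ X → ∃[ x ] ι x ≡ y) → ∀ ys → (∀ {y} → y ∈ ys → y ∈ X) → ∃[ xs ] map ι xs ≡ ys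
  preimages pre []       sub = [] , refl
  preimages pre (y ∷ ys) sub =
    let x , eq = pre (sub (here refl))
        xs , eqs = preimages pre ys (λ y∈ → sub (there y∈))
    in x ∷ xs , cong₂ _∷_ eq eqs

  module _ {X : List W} (pre : ∀ {y} → y ∈ X → ∃[ x ] ι x ≡ y) where

    part-preimages : ∀ pss → (∀ {y} → y ∈ concat pss → y ∈ X) → ∃[ qss ] map (map ι) qss ≡ pss
    part-preimages []         sub = [] , refl
    part-preimages (P ∷ pss) sub =
      let Q , eq = preimages pre P (λ y∈ → sub (∈-++⁺ˡ y∈))
          qss , eqs = part-preimages pss (λ y∈ → sub (∈-++⁺ʳ P y∈))
      in Q ∷ qss , cong₂ _∷_ eq eqs

    piece-preimage : ∀ p → (∀ {y} → y ∈ vertices p → y ∈ X) → ∃[ q ] mapPiece ι q ≡ p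
    piece-preimage (bulk xs)   sub = let ys , eq = preimages pre xs sub in bulk ys , cong bulk eq
    piece-preimage (stack pss) sub = let qss , eq = part-preimages pss sub in stack qss , cong stack eq

    piece-preimages : ∀ ps → (∀ {p y} → p ∈ ps → y ∈ vertices p → y ∈ X) → ∃[ qs ] map (mapPiece ι) qs ≡ ps
    piece-preimages []       sub = [] , refl
    piece-preimages (p ∷ ps) sub =
      let q , eq = piece-preimage p (sub (here refl))
          qs , eqs = piece-preimages ps (λ p∈ → sub (there p∈))
      in q ∷ qs , cong₂ _∷_ eq eqs

-- The last two hypotheses change the yardsticks along with the tournament: pieces measured against
-- `n₀` and `τ₀` are from now on measured against `n` and `τ`.
induced-layout : ∀ (T : Tournament) X (u : Unique X) {v η n₀ τ₀ C₀ n τ C M} qs →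
  Layout T v η n₀ τ₀ C₀ M (map (mapPiece (lookup X)) qs) →
  (∀ {ℓ} → n₀ ≤ C₀ * ℓ → n ≤ C * ℓ) → (∀ {ℓ} → τ₀ ≤ C₀ * ℓ → τ ≤ C * ℓ) →
  Layout (induced T X u) v η n τ C M qs
induced-layout T X u {v} {η} {n₀} {τ₀} {C₀} {n} {τ} {C} {M} qs layout n-scale τ-scale = record
  { Bad = λ i j → Bad (ι i) (ι j) ; bad? = λ i j → bad? (ι i) (ι j) ; bad-sym = bad-sym
  ; shaped = Shaped-map⁻ ι qs shaped
  ; ok = λ {q} q∈ → piece-ok q (ok (∈-map⁺ (mapPiece ι) q∈))
  ; forward = AllPairs.map (λ {P} {Q} f {x} {y} x∈ y∈ →
      (λ e → proj₁ (f (∈-map⁺ ι x∈) (∈-map⁺ ι y∈)) (cong ι e)) , proj₂ (f (∈-map⁺ ι x∈) (∈-map⁺ ι y∈)))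
      (AllPairs.map⁻ (subst (AllPairs Forward) (long-map ι qs) forward))
  ; sparse = λ {p} {q} p∈ q∈ → sparse′ p q (sparse (∈-map⁺ (mapPiece ι) p∈) (∈-map⁺ (mapPiece ι) q∈)) }
  where
  open Layout layout
  ι = lookup X
  Forward : List (Fin (size T)) → List (Fin (size T)) → Set
  Forward P Q = ∀ {x y} → x ∈ P → y ∈ Q → x ≢ y × (¬ Bad x y → Arc T x y)
  piece-ok : ∀ q → PieceOK T n₀ τ₀ C₀ (mapPiece ι q) → PieceOK (induced T X u) n τ C q
  piece-ok (bulk xs)   (un , le)  = Unique-map⁻ un , n-scale (subst (λ ℓ → n₀ ≤ C₀ * ℓ) (length-map ι xs) le)
  piece-ok (stack pss) (ch , les) = AllPairs.map⁻ (subst (Chain T) (concat-map pss) ch)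
    , All.map (λ {P} le → τ-scale (subst (λ ℓ → τ₀ ≤ C₀ * ℓ) (length-map ι P) le)) (All-map⁻ les)
  sparse′ : ∀ p q → M * pairs bad? (vertices (mapPiece ι p)) (vertices (mapPiece ι q)) ≤ length (vertices (mapPiece ι p)) * length (vertices (mapPiece ι q)) →
    M * pairs (λ i j → bad? (ι i) (ι j)) (vertices p) (vertices q) ≤ length (vertices p) * length (vertices q)
  sparse′ p q le = begin
    M * pairs (λ i j → bad? (ι i) (ι j)) (vertices p) (vertices q)                ≡⟨ cong (M *_) (pairs-map ι bad? (vertices p) (vertices q)) ⟨
    M * pairs bad? (map ι (vertices p)) (map ι (vertices q))                      ≡⟨ cong₂ (λ S S′ → M * pairs bad? S S′) (vertices-map ι p) (vertices-map ι q) ⟨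
    M * pairs bad? (vertices (mapPiece ι p)) (vertices (mapPiece ι q))            ≤⟨ le ⟩
    length (vertices (mapPiece ι p)) * length (vertices (mapPiece ι q))           ≡⟨ cong₂ _*_ (trans (cong length (vertices-map ι p)) (length-map ι (vertices p)))
                                                                                         (trans (cong length (vertices-map ι q)) (length-map ι (vertices q))) ⟩
    length (vertices p) * length (vertices q)                                     ∎
    where open ≤-Reasoning

-- Longest chains

module _ (T : Tournament) where
  private V = Fin (size T)

  ChainIn : List V → List V → Set
  ChainIn X U = Chain T U × (∀ {x} → x ∈ U → x ∈ X)

  ChainIn-length : ∀ {X U} → ChainIn X U → length U ≤ length X
  ChainIn-length (ch , sub) = length-⊆ (Chain⇒Unique T ch) sub

  -- The predicate varies so that the recursion can confine the tail to the out-neighbours of the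
  -- first vertex.
  chain-of-length? : ∀ m {P : V → Set} → Decidable P → Dec (∃[ U ] length U ≡ m × All P U × Chain T U)
  chain-of-length? zero    P? = yes ([] , refl , [] , [])
  chain-of-length? (suc m) {P} P? = map′ build split (Fin.any? (λ x → P? x ×-dec chain-of-length? m (λ y → P? y ×-dec arc? T x y)))
    where
    build : ∃[ x ] P x × (∃[ U ] length U ≡ m × All (λ y → P y × Arc T x y) U × Chain T U) → ∃[ U ] length U ≡ suc m × All P U × Chain T U
    build (x , px , U , len , all , ch) = x ∷ U , cong suc len , px ∷ All.map proj₁ all , All.map proj₂ all ∷ ch
    split : ∃[ U ] length U ≡ suc m × All P U × Chain T U → ∃[ x ] P x × (∃[ U ] length U ≡ m × All (λ y → P y × Arc T x y) U × Chain T U)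
    split (x ∷ U , len , px ∷ all , r ∷ ch) = x , px , U , suc-injective len , All.zip (all , r) , ch

  longest-chain : ∀ X → ∃[ U ] ChainIn X U × (∀ {U′} → ChainIn X U′ → length U′ ≤ length U)
  longest-chain X = search (length X) ChainIn-length
    where
    search : ∀ m → (∀ {U} → ChainIn X U → length U ≤ m) → ∃[ U ] ChainIn X U × (∀ {U′} → ChainIn X U′ → length U′ ≤ length U)
    search zero    bound = [] , ([] , (λ ())) , bound
    search (suc m) bound = decide (chain-of-length? (suc m) (λ x → mem? Fin._≟_ x X))
      where
      decide : Dec (∃[ U ] length U ≡ suc m × All (_∈ X) U × Chain T U) → ∃[ U ] ChainIn X U × (∀ {U′} → ChainIn X U′ → length U′ ≤ length U)
      decide (yes (U , len , sub , ch)) = U , (ch , All.lookup sub) , λ c → ≤-trans (bound c) (≤-reflexive (sym len))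
      decide (no none) = search m (λ {U} c → ≤-pred (≤∧≢⇒< (bound c) (λ len → none (U , len , All.tabulate (proj₂ c) , proj₁ c))))

-- The critical tournament

-- This is (1+1/N)^q ≥ 1+q/N, cleared of denominators.
bernoulli : ∀ N q → N ^ q * (N + q) ≤ N * suc N ^ q
bernoulli N zero    = ≤-reflexive (trans (*-identityˡ (N + 0)) (trans (+-identityʳ N) (sym (*-identityʳ N))))
bernoulli N (suc q) = begin
  N * N ^ q * (N + suc q)            ≡⟨ shuffle₁ N (N ^ q) (N + suc q) ⟩
  N ^ q * (N * (N + suc q))          ≤⟨ *-monoʳ-≤ (N ^ q) (≤-trans (m≤m+n _ q) (≤-reflexive (shuffle₂ N q))) ⟩
  N ^ q * (suc N * (N + q))          ≡⟨ shuffle₃ (N ^ q) (suc N) (N + q) ⟩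
  suc N * (N ^ q * (N + q))          ≤⟨ *-monoʳ-≤ (suc N) (bernoulli N q) ⟩
  suc N * (N * suc N ^ q)            ≡⟨ shuffle₃ (suc N) N (suc N ^ q) ⟩
  N * (suc N * suc N ^ q)            ∎
  where
  open ≤-Reasoning
  shuffle₁ : ∀ a b c → a * b * c ≡ b * (a * c)
  shuffle₁ = solve-∀
  shuffle₂ : ∀ N q → N * (N + (1 + q)) + q ≡ (1 + N) * (N + q)
  shuffle₂ = solve-∀
  shuffle₃ : ∀ a b c → a * (b * c) ≡ b * (a * c)
  shuffle₃ = solve-∀

-- From Bernoulli's inequality: L ≤ q/N ≤ (1+1/N)^q.
exponential-growth : ∀ N q L → 1 ≤ q → N * L ≤ q → L * N ^ q ≤ suc N ^ q
exponential-growth zero    (suc q) L _ _  = ≤-trans (≤-reflexive (*-zeroʳ L)) z≤n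
exponential-growth (suc N) q       L _ le = *-cancelˡ-≤ (suc N) (begin
  suc N * (L * suc N ^ q)           ≡⟨ shuffle (suc N) L (suc N ^ q) ⟩
  suc N ^ q * (suc N * L)           ≤⟨ *-monoʳ-≤ (suc N ^ q) (≤-trans le (m≤n+m q (suc N))) ⟩
  suc N ^ q * (suc N + q)           ≤⟨ bernoulli (suc N) q ⟩
  suc N * suc (suc N) ^ q           ∎)
  where
  open ≤-Reasoning
  shuffle : ∀ a b c → a * (b * c) ≡ c * (a * b)
  shuffle = solve-∀

^-distribʳ-* : ∀ a b q → (a * b) ^ q ≡ a ^ q * b ^ q
^-distribʳ-* a b zero    = refl
^-distribʳ-* a b (suc q) = trans (cong (a * b *_) (^-distribʳ-* a b q)) (shuffle a b (a ^ q) (b ^ q))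
  where
  shuffle : ∀ a b c d → a * b * (c * d) ≡ a * c * (b * d)
  shuffle = solve-∀

∈-map-lookup : ∀ {A : Set} (X : List A) zs {x} → x ∈ map (lookup X) zs → x ∈ X
∈-map-lookup X (z ∷ zs) (here refl) = ∈-lookup z
∈-map-lookup X (z ∷ zs) (there x∈)  = ∈-map-lookup X zs x∈

map-relate : ∀ {A B : Set} {R : B → B → Set} (f : A → B) {xs ys} → (∀ {x y} → x ∈ xs → y ∈ ys → R (f x) (f y)) →
  ∀ {x y} → x ∈ map f xs → y ∈ map f ys → R x y
map-relate f h x∈ y∈ with ∈-map⁻ f x∈ | ∈-map⁻ f y∈
... | _ , i∈ , refl | _ , j∈ , refl = h i∈ j∈

module Critical (H T : Tournament) (free : ¬ ContainsT T H) (X : List (Fin (size T))) (X-unique : Unique X)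
  (q : ℕ) (1≤q : 1 ≤ q) (t : ℕ) (t-attained : ∃[ U ] ChainIn T X U × length U ≡ t)
  (t-max : ∀ {U} → ChainIn T X U → length U ≤ t) (critical : t ^ q < length X)
  (smaller : ∀ Y → Unique Y → (∀ {y} → y ∈ Y → y ∈ X) → length Y < length X → ∃[ U ] ChainIn T Y U × length Y ≤ length U ^ q) where

  private V = Fin (size T)

  1≤t : 1 ≤ t
  1≤t = nonempty X refl
    where
    nonempty : ∀ Y → Y ≡ X → 1 ≤ t
    nonempty []      eq = ⊥-elim (n≮0 (subst (t ^ q <_) (cong length (sym eq)) critical))
    nonempty (x ∷ Y) eq = t-max (([] ∷ []) , λ { (here refl) → subst (x ∈_) eq (here refl) })

  -- (|X|/L)^(1/q) > t L^(-1/q) ≥ t N/(N+1), the last step by Bernoulli's inequality.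
  long-chain-in : ∀ N L Y → 1 ≤ N → N * L ≤ q → Unique Y → (∀ {y} → y ∈ Y → y ∈ X) → length X ≤ L * length Y →
    ∃[ U ] ChainIn T Y U × N * t < suc N * length U
  long-chain-in N L Y 1≤N NL≤q Y-unique Y⊆X X≤LY = decide (suc (length Y) ≤? length X)
    where
    decide : Dec (length Y < length X) → ∃[ U ] ChainIn T Y U × N * t < suc N * length U
    -- `smaller` does not apply if `Y` is as large as `X`; but then `Y` contains all of `X`, in
    -- particular its longest chain.
    decide (no ¬lt) =
      let U , (ch , U⊆X) , len = t-attained
      in U , (ch , λ x∈ → ⊆-length⇒⊇ Fin._≟_ Y-unique Y⊆X (≮⇒≥ ¬lt) (U⊆X x∈))
         , subst (λ ℓ → N * t < suc N * ℓ) (sym len) (+-monoˡ-≤ (N * t) 1≤t)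
    decide (yes lt) =
      let U , U-in , Y≤ = smaller Y Y-unique Y⊆X lt
      in U , U-in , ≰⇒> (λ le → <-irrefl refl (begin-strict
        (N * t) ^ q                 ≡⟨ ^-distribʳ-* N t q ⟩
        N ^ q * t ^ q               <⟨ *-monoʳ-< (N ^ q) {{m^n≢0 N q {{>-nonZero 1≤N}}}} critical ⟩
        N ^ q * length X            ≤⟨ *-monoʳ-≤ (N ^ q) (≤-trans X≤LY (*-monoʳ-≤ L Y≤)) ⟩
        N ^ q * (L * length U ^ q)  ≡⟨ shuffle (N ^ q) L (length U ^ q) ⟩
        L * N ^ q * length U ^ q    ≤⟨ *-monoˡ-≤ (length U ^ q) (exponential-growth N q L 1≤q NL≤q) ⟩
        suc N ^ q * length U ^ q    ≡⟨ ^-distribʳ-* (suc N) (length U) q ⟨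
        (suc N * length U) ^ q      ≤⟨ ^-monoˡ-≤ q le ⟩
        (N * t) ^ q                 ∎))
      where
      open ≤-Reasoning
      shuffle : ∀ a b c → a * (b * c) ≡ b * a * c
      shuffle = solve-∀

  half-chain-in : ∀ L Y → L ≤ q → Unique Y → (∀ {y} → y ∈ Y → y ∈ X) → length X ≤ L * length Y →
    ∃[ U ] ChainIn T Y U × t < 2 * length U
  half-chain-in L Y L≤q Y-unique Y⊆X le =
    let U , U-in , lt = long-chain-in 1 L Y ≤-refl (≤-trans (≤-reflexive (*-identityˡ L)) L≤q) Y-unique Y⊆X le
    in U , U-in , subst (_< 2 * length U) (*-identityˡ t) lt

  join : ∀ {P Q} → ChainIn T X P → ChainIn T X Q → (∀ {x y} → x ∈ P → y ∈ Q → Arc T x y) → length P + length Q ≤ t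
  join {P} {Q} (P-chain , P⊆) (Q-chain , Q⊆) arcs = ≤-trans (≤-reflexive (sym (length-++ P)))
    (t-max (AllPairs.++⁺ P-chain Q-chain (All.tabulate λ x∈ → All.tabulate λ y∈ → arcs x∈ y∈) , λ x∈ → Sum.[ P⊆ , Q⊆ ] (∈-++⁻ P x∈)))

  -- One of the two neighbourhoods of a vertex x has at least (|X| - 1)/2 vertices, and x extends each of its chains.
  t-large : ∀ Q → Q * 3 ≤ q → Q < t
  t-large Q 3Q≤q = from t refl
    where
    from : ∀ t′ → t ≡ t′ → Q < t
    from zero     eq = ⊥-elim (<-irrefl refl (subst (1 ≤_) eq 1≤t))
    -- Suppose t = N+1 ≤ Q. Chains in a neighbourhood of x have at most N vertices, so each
    -- neighbourhood has at most N^q. This gives t^q ≤ |X|-1 ≤ 2N^q, whereas q ≥ 3N gives t^q ≥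
    -- 3N^q.
    from (suc N) eq = ≰⇒> λ t≤Q → contradict N eq (exponential-growth N q 3 1≤q
        (≤-trans (*-monoˡ-≤ 3 (≤-trans (n≤1+n N) (≤-trans (≤-reflexive (sym eq)) t≤Q))) 3Q≤q)) X refl X-unique
      where
      contradict : ∀ N → t ≡ suc N → 3 * N ^ q ≤ suc N ^ q → ∀ Z → Z ≡ X → Unique Z → ⊥
      contradict N eq growth [] Z≡X _ = n≮0 (subst (t ^ q <_) (cong length (sym Z≡X)) critical)
      contradict N refl growth (x ∷ X₀) refl (x∉ ∷ X₀-unique) = <-irrefl refl (begin-strict
        2 * N ^ q          <⟨ *-monoˡ-< (N ^ q) {{>-nonZero 1≤Nq}} {2} {3} ≤-refl ⟩
        3 * N ^ q          ≤⟨ growth ⟩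
        suc N ^ q          ≤⟨ X₀≥ ⟩
        length X₀          ≤⟨ X₀≤ ⟩
        2 * N ^ q          ∎)
        where
        open ≤-Reasoning
        Outs = filter (arc? T x) X₀
        Ins  = filter (λ y → ¬? (arc? T x y)) X₀
        X₀≥ : suc N ^ q ≤ length X₀
        X₀≥ = ≤-pred critical
        nbhd : ∀ Y → Unique Y → (∀ {y} → y ∈ Y → y ∈ X₀) →
          (∀ {U} → ChainIn T Y U → length U + 1 ≤ suc N) → length Y ≤ N ^ q
        nbhd Y Y-unique Y⊆ bound =
          let U , U-in , Y≤ = smaller Y Y-unique (λ y∈ → there (Y⊆ y∈)) (s≤s (length-⊆ Y-unique Y⊆))
          in ≤-trans Y≤ (^-monoˡ-≤ q (≤-pred (subst (_≤ suc N) (+-comm (length U) 1) (bound U-in))))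
        single : ChainIn T X (x ∷ [])
        single = ([] ∷ []) , λ { (here refl) → here refl }
        outs⊆ : ∀ {y} → y ∈ Outs → y ∈ X₀ × Arc T x y
        outs⊆ = ∈-filter⁻ (arc? T x) {xs = X₀}
        ins⊆ : ∀ {y} → y ∈ Ins → y ∈ X₀ × ¬ Arc T x y
        ins⊆ = ∈-filter⁻ (λ y → ¬? (arc? T x y)) {xs = X₀}
        in-arc : ∀ {y} → y ∈ Ins → Arc T y x
        in-arc {y} y∈ = arc-total T (All.lookup x∉ (proj₁ (ins⊆ y∈))) (¬-not (proj₂ (ins⊆ y∈)))
        outs≤ : length Outs ≤ N ^ q
        outs≤ = nbhd Outs (Unique-filter⁺ (arc? T x) X₀-unique) (λ y∈ → proj₁ (outs⊆ y∈)) λ {U} (ch , sub) →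
          ≤-trans (≤-reflexive (+-comm (length U) 1)) (join single (ch , λ y∈ → there (proj₁ (outs⊆ (sub y∈)))) (λ { (here refl) y∈ → proj₂ (outs⊆ (sub y∈)) }))
        ins≤ : length Ins ≤ N ^ q
        ins≤ = nbhd Ins (Unique-filter⁺ (λ y → ¬? (arc? T x y)) X₀-unique) (λ y∈ → proj₁ (ins⊆ y∈)) λ {U} (ch , sub) →
          join (ch , λ y∈ → there (proj₁ (ins⊆ (sub y∈)))) single (λ { y∈ (here refl) → in-arc (sub y∈) })
        X₀≤ : length X₀ ≤ 2 * N ^ q
        X₀≤ = begin
          length X₀                 ≡⟨ count-split (arc? T x) X₀ ⟨
          length Outs + length Ins  ≤⟨ +-mono-≤ outs≤ ins≤ ⟩
          N ^ q + N ^ q             ≡⟨ cong (N ^ q +_) (+-identityʳ (N ^ q)) ⟨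
          2 * N ^ q                 ∎
        1≤Nq : 1 ≤ N ^ q
        1≤Nq = n≢0⇒n>0 (λ Nq≡0 → n≮0 (≤-trans (≤-trans (m^n>0 (suc N) q) (≤-trans X₀≥ X₀≤)) (≤-reflexive (cong (2 *_) Nq≡0))))

  module _ {v η} (R k c K L : ℕ) (bound : EHBound v η c k K (λ T _ → ContainsT T H))
    (scale : suc (length v) * (4 * suc R) ≡ suc c)
    (build : ∀ u → Oracle T X L (suc R * u) → Structure T X v η L u (suc k))
    (2R+1≤t : 2 * suc R < t)
    (q-large : 2 * suc K * (L * suc K) ≤ q) where

    private
      K′ = suc K

      LK≤q : L * K′ ≤ q
      LK≤q = ≤-trans (m≤n*m (L * K′) (2 * K′)) q-large

      L≤q : L ≤ q
      L≤q = ≤-trans (m≤m*n L K′) LK≤q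

      -- The oracle finds chains of more than t/2 vertices, enough for R+1 parts of length u. As t >
      -- 2(R+1), rounding costs at most a factor 2, so every part has at least t/(4(R+1)) vertices.
      u : ℕ
      u = t / (2 * suc R)

      2Ru≤t : 2 * (suc R * u) ≤ t
      2Ru≤t = ≤-trans (≤-reflexive (shuffle (suc R) u)) (m/n*n≤m t (2 * suc R))
        where
        shuffle : ∀ a b → 2 * (a * b) ≡ b * (2 * a)
        shuffle = solve-∀

      1≤u : 1 ≤ u
      1≤u = ≤-trans (≤-reflexive (sym (m*n/n≡m 1 (2 * suc R)))) (/-monoˡ-≤ (2 * suc R) (≤-trans (≤-reflexive (*-identityˡ (2 * suc R))) (<⇒≤ 2R+1≤t)))

      t≤4Ru : t ≤ 4 * suc R * u
      t≤4Ru = begin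
        t                                   ≡⟨ m≡m%n+[m/n]*n t r ⟩
        t % r + u * r                       ≤⟨ +-monoˡ-≤ (u * r) (≤-trans (<⇒≤ (m%n<n t r)) (m≤n*m r u {{>-nonZero 1≤u}})) ⟩
        u * r + u * r                       ≡⟨ shuffle (suc R) u ⟩
        4 * suc R * u                       ∎
        where
        open ≤-Reasoning
        r = 2 * suc R
        shuffle : ∀ a b → b * (2 * a) + b * (2 * a) ≡ 4 * a * b
        shuffle = solve-∀

      oracle : Oracle T X L (suc R * u)
      oracle Y Y-unique Y⊆X le =
        let U , (ch , sub) , lt = half-chain-in L Y L≤q Y-unique Y⊆X le
        in U , ch , sub , <⇒≤ (*-cancelˡ-< 2 (suc R * u) (length U) (≤-<-trans 2Ru≤t lt))

    open Structure (build u oracle)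

    private
      ι : Fin (length X′) → V
      ι = lookup X′

      T′ : Tournament
      T′ = induced T X′ X′-unique

      preimage : ∀ {x} → x ∈ X′ → ∃[ i ] ι i ≡ x
      preimage x∈ = Any.index x∈ , sym (lookup-index x∈)

      pulled : ∃[ qs ] map (mapPiece ι) qs ≡ pieces
      pulled = piece-preimages ι preimage pieces pieces⊆X′

      X≤LX′ : length X ≤ L * length X′
      X≤LX′ = ≤-trans X≤ (*-monoʳ-≤ L s≤X′)

      1≤X′ : 1 ≤ length X′
      1≤X′ = 1≤C*⇒1≤ {C = L} (≤-trans (s≤s z≤n) critical) X≤LX′

      image-in : ∀ {xs} → Chain T′ xs → ChainIn T X (map ι xs)
      image-in {xs} ch = AllPairs.map⁺ ch , λ x∈ → X′⊆X (∈-map-lookup X′ xs x∈)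

      t-max′ : ∀ {U} → Chain T′ U → length U ≤ t
      t-max′ {U} ch = ≤-trans (≤-reflexive (sym (length-map ι U))) (t-max (image-in ch))

      -- Here the constant becomes independent of `L`: |X′| ≤ (|v|+1)s serves the bulk pieces and t
      -- ≤ 4(R+1)u the stacks, and c+1 is the product of the two factors.
      layout′ : Layout T′ v η (length X′) t (suc c) (suc k) (proj₁ pulled)
      layout′ = induced-layout T X′ X′-unique (proj₁ pulled) (subst (Layout T v η s u 1 (suc k)) (sym (proj₂ pulled)) layout)
        (λ {ℓ} s≤ → begin
          length X′                              ≤⟨ X′≤ ⟩
          suc (length v) * s                     ≤⟨ *-mono-≤ (m≤m*n (suc (length v)) (4 * suc R)) (≤-trans s≤ (≤-reflexive (*-identityˡ ℓ))) ⟩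
          suc (length v) * (4 * suc R) * ℓ       ≡⟨ cong (_* ℓ) scale ⟩
          suc c * ℓ                              ∎)
        (λ {ℓ} u≤ → begin
          t                                      ≤⟨ t≤4Ru ⟩
          4 * suc R * u                          ≤⟨ *-mono-≤ (m≤n*m (4 * suc R) (suc (length v))) (≤-trans u≤ (≤-reflexive (*-identityˡ ℓ))) ⟩
          suc (length v) * (4 * suc R) * ℓ       ≡⟨ cong (_* ℓ) scale ⟩
          suc c * ℓ                              ∎)
        where open ≤-Reasoning

      copy-impossible : ¬ ContainsT T′ H
      copy-impossible (φ , _ , hom) = free (ι ∘ φ , adj-hom⇒injective (adj T) (irrefl T) H (ι ∘ φ) hom , hom)

      pair-impossible : ¬ CompletePair T′ K′
      pair-impossible cp = contradiction B-large
        where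
        open CompletePair cp
        image⊆X : ∀ zs {x} → x ∈ map ι zs → x ∈ X
        image⊆X zs x∈ = X′⊆X (∈-map-lookup X′ zs x∈)
        image-unique : ∀ {zs} → Unique zs → Unique (map ι zs)
        image-unique = Unique-map⁺ (Unique-lookup-injective X′-unique)
        image-large : ∀ zs → length X′ ≤ K′ * length zs → length X ≤ L * K′ * length (map ι zs)
        image-large zs le = begin
          length X                         ≤⟨ X≤LX′ ⟩
          L * length X′                    ≤⟨ *-monoʳ-≤ L le ⟩
          L * (K′ * length zs)             ≡⟨ *-assoc L K′ (length zs) ⟨
          L * K′ * length zs               ≡⟨ cong (L * K′ *_) (length-map ι zs) ⟨
          L * K′ * length (map ι zs)       ∎
          where open ≤-Reasoning
        joined : ∀ {P Q} → ChainIn T X P → ChainIn T X Q → (∀ {x} → x ∈ P → x ∈ map ι A) → (∀ {x} → x ∈ Q → x ∈ map ι B) →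
          length P + length Q ≤ t
        joined {P} {Q} P-in Q-in P⊆ Q⊆ = orient complete
          where
          orient : (∀ {x y} → x ∈ A → y ∈ B → Arc T′ x y) ⊎ (∀ {x y} → x ∈ A → y ∈ B → Arc T′ y x) → length P + length Q ≤ t
          orient (inj₁ f) = join P-in Q-in (λ x∈ y∈ → map-relate {R = Arc T} ι f (P⊆ x∈) (Q⊆ y∈))
          orient (inj₂ f) = ≤-trans (≤-reflexive (+-comm (length P) (length Q)))
            (join Q-in P-in (λ y∈ x∈ → map-relate {R = λ x y → Arc T y x} ι f (P⊆ x∈) (Q⊆ y∈)))
        -- Each side contains a chain of more than t/2 vertices, and together these form a chain
        -- longer than t.
        two-large : length X′ ≤ K′ * length B → ⊥
        two-large B≤ =
          let P , (P-ch , P⊆) , t<P = half-chain-in (L * K′) (map ι A) LK≤q (image-unique A-unique) (image⊆X A) (image-large A A-large)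
              Q , (Q-ch , Q⊆) , t<Q = half-chain-in (L * K′) (map ι B) LK≤q (image-unique B-unique) (image⊆X B) (image-large B B≤)
          in <-irrefl refl (begin-strict
            2 * t                          ≡⟨ cong (t +_) (+-identityʳ t) ⟩
            t + t                          <⟨ +-mono-< t<P t<Q ⟩
            2 * length P + 2 * length Q    ≡⟨ *-distribˡ-+ 2 (length P) (length Q) ⟨
            2 * (length P + length Q)      ≤⟨ *-monoʳ-≤ 2 (joined (P-ch , λ x∈ → image⊆X A (P⊆ x∈)) (Q-ch , λ x∈ → image⊆X B (Q⊆ x∈)) P⊆ Q⊆) ⟩
            2 * t                          ∎)
          where open ≤-Reasoning
        -- Here |B| ≥ tr(T′)/K′ > t/(2K′), so that A has to contain a chain of more than (1 - 1/(2K′)) t vertices.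
        one-chain : Chain T′ B → (∀ {U} → Chain T′ U → length U ≤ K′ * length B) → ⊥
        one-chain B-chain B-max =
          let W , (W-ch , W⊆) , t<W = half-chain-in L X′ L≤q X′-unique X′⊆X X≤LX′
              W′ , W′-eq = preimages ι preimage W W⊆
              P , (P-ch , P⊆) , Nt<P = long-chain-in N (L * K′) (map ι A) (m≤n⇒m≤o+n K (s≤s z≤n)) (≤-trans (*-monoˡ-≤ (L * K′) (n≤1+n N)) q-large)
                (image-unique A-unique) (image⊆X A) (image-large A A-large)
              W′-ch = AllPairs.map⁻ (subst (Chain T) (sym W′-eq) W-ch)
              t<B = <-≤-trans t<W (*-monoʳ-≤ 2 (≤-trans (≤-reflexive (trans (cong length (sym W′-eq)) (length-map ι W′))) (B-max W′-ch)))
          in <-irrefl refl (begin-strict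
            suc N * t                                      ≡⟨ +-comm t (N * t) ⟩
            N * t + t                                      <⟨ +-mono-< Nt<P t<B ⟩
            suc N * length P + 2 * (K′ * length B)         ≡⟨ cong (suc N * length P +_) (trans (sym (*-assoc 2 K′ (length B))) (cong (suc N *_) (sym (length-map ι B)))) ⟩
            suc N * length P + suc N * length (map ι B)    ≡⟨ *-distribˡ-+ (suc N) (length P) (length (map ι B)) ⟨
            suc N * (length P + length (map ι B))          ≤⟨ *-monoʳ-≤ (suc N) (joined (P-ch , λ x∈ → image⊆X A (P⊆ x∈)) (image-in B-chain) P⊆ id) ⟩
            suc N * t                                      ∎)
          where
          open ≤-Reasoning
          -- `suc N` reduces to `2 * K′`. Adding Nt < 2K′|P| and t < 2K′|B| gives t < |P| + |B|,
          -- although P and B join to one chain.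
          N = K + (K′ + 0)
        contradiction : length X′ ≤ K′ * length B ⊎ (Chain T′ B × (∀ {U} → Chain T′ U → length U ≤ K′ * length B)) → ⊥
        contradiction (inj₁ le)       = two-large le
        contradiction (inj₂ (ch , f)) = one-chain ch f

    impossible : ⊥
    impossible = Sum.[ copy-impossible , pair-impossible ] (bound T′ t (proj₁ pulled) k ≤-refl 1≤X′ 1≤t t-max′ layout′)

-- Induction on the vertex set and choice of constants

η≤1+sum : ∀ η → All (_≤ suc (sum η)) η
η≤1+sum η = All.tabulate (λ r∈ → ≤-trans (∈⇒≤sum r∈) (n≤1+n _))
  where
  ∈⇒≤sum : ∀ {r η} → r ∈ η → r ≤ sum η
  ∈⇒≤sum {η = r ∷ η} (here refl) = m≤m+n r (sum η)
  ∈⇒≤sum {η = r ∷ η} (there r∈)  = ≤-trans (∈⇒≤sum r∈) (m≤n+m (sum η) r)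

module _ (H : Tournament) {v η} (R k c K L q : ℕ) (1≤q : 1 ≤ q) (bound : EHBound v η c k K (λ T _ → ContainsT T H))
  (scale : suc (length v) * (4 * suc R) ≡ suc c)
  (build : ∀ (T : Tournament) → ¬ ContainsT T H → ∀ X → Unique X → L ≤ length X → ∀ u →
    Oracle T X L (suc R * u) → Structure T X v η L u (suc k))
  (Q : ℕ) (2R≤Q : 2 * suc R ≤ Q) (L≤Q : L ≤ Q) (Q3≤q : Q * 3 ≤ q) (q-large : 2 * suc K * (L * suc K) ≤ q)
  (T : Tournament) (free : ¬ ContainsT T H) where

  -- Strong induction on |X|, with `n` as a bound, replaces the choice of a smallest counterexample:
  -- the induction hypothesis is the argument `smaller` of `Critical`. The tournament stays fixed
  -- and only vertex lists vary.
  large-chain : ∀ n X → Unique X → length X < n → ∃[ U ] ChainIn T X U × length X ≤ length U ^ q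
  large-chain (suc n) X X-unique (s≤s X≤n) = conclude (longest-chain T X)
    where
    conclude : ∃[ U ] ChainIn T X U × (∀ {U′} → ChainIn T X U′ → length U′ ≤ length U) → ∃[ U ] ChainIn T X U × length X ≤ length U ^ q
    conclude (U , U-in , U-max) = decide (length X ≤? length U ^ q)
      where
      t = length U
      module _ (critical : t ^ q < length X) where
        open Critical H T free X X-unique q 1≤q t (U , U-in , refl) U-max critical
          (λ Y Y-unique Y⊆X lt → large-chain n Y Y-unique (<-≤-trans lt X≤n))
        Q<t : Q < t
        Q<t = t-large Q Q3≤q
        L≤X : L ≤ length X
        L≤X = begin
          L             ≤⟨ L≤Q ⟩
          Q             ≤⟨ <⇒≤ Q<t ⟩
          t             ≡⟨ ^-identityʳ t ⟨
          t ^ 1         ≤⟨ ^-monoʳ-≤ t {{>-nonZero 1≤t}} 1≤q ⟩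
          t ^ q         ≤⟨ <⇒≤ critical ⟩
          length X      ∎
          where open ≤-Reasoning
        absurd : ⊥
        absurd = impossible {v} {η} R k c K L bound scale (λ u oracle → build T free X X-unique L≤X u oracle)
          (≤-<-trans 2R≤Q Q<t) q-large
      decide : Dec (length X ≤ t ^ q) → ∃[ U ] ChainIn T X U × length X ≤ length U ^ q
      decide (yes le) = U , U-in , le
      decide (no ¬le) = ⊥-elim (absurd (≰⇒> ¬le))

large-chains : ∀ H {v η} → length η ≡ Defs.count true v → (∀ c → ∃[ k ] ∃[ K ] EHBound v η c k K (λ T _ → ContainsT T H)) →
  ∃[ q ] (1 ≤ q × (∀ (T : Tournament) → ¬ ContainsT T H → ∀ X → Unique X → ∃[ U ] ChainIn T X U × length X ≤ length U ^ q))
large-chains H {v} {η} len bounds =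
  let R = sum η
      -- This is the normal form for which `suc c` and `suc (length v) * (4 * suc R)` agree by
      -- computation, so that `scale` is `refl`.
      c = R + 3 * suc R + length v * suc (R + 3 * suc R)
      k , K , bound = bounds c
      L , 1≤L , build = structure H (suc R) (suc k) (s≤s z≤n) v η len (η≤1+sum η)
      Q = 2 * suc R + L
      -- The first summand forces t > Q, making t and |X| large enough for u ≥ 1 and for
      -- `structure`; the second yields the long chains that exclude strong pairs.
      q = Q * 3 + 2 * suc K * (L * suc K)
  in q , ≤-trans 1≤L (≤-trans (m≤n+m L (2 * suc R)) (≤-trans (m≤m*n Q 3) (m≤m+n (Q * 3) _)))
     , λ T free X X-unique → large-chain H {v} {η} R k c K L q
         (≤-trans 1≤L (≤-trans (m≤n+m L (2 * suc R)) (≤-trans (m≤m*n Q 3) (m≤m+n (Q * 3) _)))) bound refl build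
         Q (m≤m+n (2 * suc R) L) (m≤n+m L (2 * suc R)) (m≤m+n (Q * 3) _) (m≤n+m (2 * suc K * (L * suc K)) (Q * 3))
         T free (suc (length X)) X X-unique ≤-refl

theorem12 : ∀ (H : Tournament) → Regular H →
    ∃[ p ] ∃[ q ] (0 < p × 0 < q ×
    ∀ (T : Tournament) → ¬ ContainsT T H →
    ∃[ S ] (Transitive T S × size T ^ p ≤ ∣ S ∣ ^ q))
theorem12 H regular =
  let v , η , len , bounds = regular-bound H regular
      q , 1≤q , chains = large-chains H {v} {η} len bounds
  -- The exponent is 1/q, as |T| is at most the q-th power of the length of the chain found.
  in 1 , q , s≤s z≤n , 1≤q , λ T free →
    let U , (ch , _) , le = chains T free (allFin (size T)) (Unique-allFin (size T))
    in toSubset U , Chain⇒Transitive T ch (∈-toSubset⁻ U) ,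
       subst₂ (λ a b → a ≤ b ^ q) (trans (length-tabulate id) (sym (^-identityʳ (size T)))) (sym (∣toSubset∣ (Chain⇒Unique T ch))) le
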